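{- Let $0<|q|<1$. Define \begin{align*} \vartheta_8(a_0,\dots,a_7):=\frac{1}{8J_4}\Big[&a_0\overline{J}_{4,8}\overline{J}_{28,64}+a_1q^4\overline{J}_{0,8}\overline{J}_{52,64}+a_2q\overline{J}_{4,8}\overline{J}_{20,64}+a_3q\overline{J}_{0,8}\overline{J}_{28,64}\\ &+a_4q^2\overline{J}_{0,8}\overline{J}_{20,64}+a_5q^6\overline{J}_{4,8}\overline{J}_{60,64}+a_6q^3\overline{J}_{4,8}\overline{J}_{52,64}+a_7q^7\overline{J}_{0,8}\overline{J}_{60,64}\Big], \end{align*} \[ \vartheta_8'(c_0,c_1,c_2,c_3):=\frac{1}{2J_4}\Big[c_0J_{4,8}\overline{J}_{28,64}+c_1qJ_{4,8}\overline{J}_{20,64}+c_2q^6J_{4,8}\overline{J}_{60,64}+c_3q^3J_{4,8}\overline{J}_{52,64}\Big]. \] Then \begin{align*} D_C(0,8)&=\vartheta_8(3,-1,1,-3,-1,3,1,-3)+\vartheta_8'(1,-1,-1,1),\\ D_C(1,8)=D_C(7,8)&=\vartheta_8(-1,-1,1,1,-1,-1,1,1)+\vartheta_8'(0,1,0,-1),\\ D_C(2,8)=D_C(6,8)&=\vartheta_8(-1,3,-3,1,3,-1,-3,1),\\ D_C(3,8)=D_C(5,8)&=\vartheta_8(-1,-1,1,1,-1,-1,1,1)+\vartheta_8'(0,-1,0,1),\\ D_C(4,8)&=\vartheta_8(3,-1,1,-3,-1,3,1,-3)+\vartheta_8'(-1,1,1,-1). \end{align*}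
   Context: Throughout $q$ is complex with $0<|q|<1$. Notation: $(x;q)_\infty=\prod_{i\ge0}(1-xq^i)$, $j(x;q)=(x;q)_\infty(q/x;q)_\infty(q;q)_\infty=\sum_{n\in\mathbb Z}(-1)^nq^{\binom n2}x^n$; for integers $a$ and $m>0$, $J_{a,m}=j(q^a;q^m)$, $\overline{J}_{a,m}=j(-q^a;q^m)$, $J_m=\prod_{i\ge1}(1-q^{mi})$. Let $C(m,n)$ be defined by $\sum_{n\ge0}\sum_{m\in\mathbb Z}C(m,n)z^mq^n=\prod_{n\ge1}\frac{1-q^n}{(1-zq^n)(1-z^{ -1}q^n)}$ (the Andrews–Garvan crank generating function). For $M\ge1$ let $C(a,M;n)=\sum_{m\equiv a\ (\mathrm{mod}\ M)}C(m,n)$, $p(n)$ the number of partitions of $n$ ($p(0)=1$), and $D_C(a,M)=\sum_{n\ge0}\big(C(a,M;n)-p(n)/M\big)q^n$; equivalently $D_C(a,M)=\frac1M\sum_{j=1}^{M-1}\zeta_M^{ -aj}\frac{(q;q)_\infty}{(\zeta_M^jq;q)_\infty(\zeta_M^{ -j}q;q)_\infty}$ with $\zeta_M$ a primitive $M$-th root of unity. -}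

module Defs where

open import Data.Nat as ℕ using (ℕ; zero; suc; _∸_; _≤?_; NonZero)
open import Data.Nat.DivMod using (_mod_)
open import Data.Nat.Divisibility using (_∣?_)
open import Data.Fin using (Fin; toℕ)
open import Data.Integer as ℤ using (ℤ; +_)
open import Data.Rational as ℚ using (ℚ)
open import Data.List using (List; []; _∷_; [_]; _++_; map; concatMap; filter; length; upTo; replicate)
open import Relation.Nullary using (does)
open import Relation.Binary.PropositionalEquality using (_≡_)
open import Data.Bool using (if_then_else_)

module PowerSeries {A : Set} (_+_ _*_ : A → A → A) (0# 1# : A) where

  Series : Set
  Series = ℕ → A

  Σ≤ : ℕ → (ℕ → A) → A
  Σ≤ zero    f = f 0
  Σ≤ (suc n) f = Σ≤ n f + f (suc n)

  _⊕_ : Series → Series → Series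
  (f ⊕ g) n = f n + g n

  _⊛_ : Series → Series → Series
  (f ⊛ g) n = Σ≤ n (λ k → f k * g (n ∸ k))

  _·_ : A → Series → Series
  (c · f) n = c * f n

  one : Series
  one zero    = 1#
  one (suc _) = 0#

  qpow : ℕ → Series → Series
  qpow k f n = if does (k ≤? n) then f (n ∸ k) else 0#

  prod : ℕ → (ℕ → Series) → Series
  prod zero    F = one
  prod (suc N) F = prod N F ⊛ F (suc N)

  -- infinite product ∏_{i ≥ 1} F i, for factors with F i ≡ 1 (mod q^i):
  -- the coefficient of q^n is that of the finite product ∏_{i=1}^{n} F i.
  ∏∞ : (ℕ → Series) → Series
  ∏∞ F n = prod n F n

  _≋_ : Series → Series → Set
  f ≋ g = ∀ n → f n ≡ g n

-- The group ring ℤ[z]/(z^M - 1) = ℤ[ℤ/Mℤ]; an element u has u r =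
-- coefficient of z^r (r a residue mod M).

module GroupRing (M : ℕ) .{{_ : NonZero M}} where

  GR : Set
  GR = Fin M → ℤ

  sumFin : ∀ {n} → (Fin n → ℤ) → ℤ
  sumFin {zero}  f = + 0
  sumFin {suc n} f = f Fin.zero ℤ.+ sumFin (λ i → f (Fin.suc i))
    where import Data.Fin as Fin

  _+G_ : GR → GR → GR
  (u +G v) r = u r ℤ.+ v r

  _*G_ : GR → GR → GR
  (u *G v) r = sumFin (λ s → u s ℤ.* v ((toℕ r ℕ.+ (M ∸ toℕ s)) mod M))

  0G : GR
  0G _ = + 0

  1G : GR
  1G r = if does (r Fin.≟ (0 mod M)) then + 1 else + 0
    where import Data.Fin as Fin

  zpow : ℕ → GR
  zpow k r = if does (r Fin.≟ (k mod M)) then + 1 else + 0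
    where import Data.Fin as Fin

  -- z^(-k), for k : ℕ  (note -k ≡ k(M-1) mod M)
  zpow⁻ : ℕ → GR
  zpow⁻ k r = if does (r Fin.≟ ((k ℕ.* (M ∸ 1)) mod M)) then + 1 else + 0
    where import Data.Fin as Fin

  open PowerSeries _+G_ _*G_ 0G 1G public

  oneMinusQ : ℕ → Series
  oneMinusQ i n = if does (n ℕ.≟ 0) then 1G
                  else if does (n ℕ.≟ i) then (λ r → ℤ.- 1G r) else 0G

  -- 1/(1 - z q^i) = Σ_k z^k q^{ik}   (i ≥ 1)
  geomZ : ℕ → Series
  geomZ i n = if does ((suc (ℕ.pred i)) ∣? n) then zpow (n ℕ./ suc (ℕ.pred i)) else 0G

  -- 1/(1 - z^{-1} q^i) = Σ_k z^{-k} q^{ik}   (i ≥ 1)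
  geomZ⁻ : ℕ → Series
  geomZ⁻ i n = if does ((suc (ℕ.pred i)) ∣? n) then zpow⁻ (n ℕ./ suc (ℕ.pred i)) else 0G

  -- the crank generating function ∏_{n≥1} (1-q^n)/((1-zq^n)(1-z^{-1}q^n)),
  -- reduced modulo z^M - 1
  crankGF : Series
  crankGF = ∏∞ (λ i → (oneMinusQ i ⊛ geomZ i) ⊛ geomZ⁻ i)

-- C(a,M;n) = Σ_{m ≡ a (mod M)} C(m,n), for a residue given by a : ℕ
Ccrank : (a M : ℕ) .{{_ : NonZero M}} (n : ℕ) → ℤ
Ccrank a M n = GroupRing.crankGF M n (a mod M)

parts : ℕ → ℕ → List (List ℕ)
parts n zero    = if does (n ℕ.≟ 0) then [ [] ] else []
parts n (suc k) =
  concatMap (λ j → map (replicate j (suc k) ++_) (parts (n ∸ j ℕ.* suc k) k))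
            (filter (λ j → j ℕ.* suc k ≤? n) (upTo (suc n)))

p : ℕ → ℕ
p n = length (parts n n)

open PowerSeries ℚ._+_ ℚ._*_ ℚ.0ℚ ℚ.1ℚ public

⟦_⟧ : ℤ → ℚ
⟦ i ⟧ = i ℚ./ 1

D-C : (a M : ℕ) .{{_ : NonZero M}} → Series
D-C a M n = ⟦ Ccrank a M n ⟧ ℚ.- ((+ p n) ℚ./ M)

private
  win : ℕ → ℕ → ℤ
  win N k = (+ k) ℤ.- (+ suc N)

  -- exponent test: m·n(n-1)/2 + a·n = N, i.e. m·n(n-1) + 2a·n = 2N
  hit : ℕ → ℕ → ℕ → ℤ → ℚ
  hit a m N n =
    if does (((+ m) ℤ.* n ℤ.* (n ℤ.- + 1)) ℤ.+ ((+ (2 ℕ.* a)) ℤ.* n) ℤ.≟ + (2 ℕ.* N))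
    then ℚ.1ℚ else ℚ.0ℚ

  sgn : ℤ → ℚ
  sgn n = if does (ℤ.∣ n ∣ ℕ.% 2 ℕ.≟ 0) then ℚ.1ℚ else ℚ.- ℚ.1ℚ

-- J̄_{a,m} = j(-q^a; q^m) = Σ_{n∈ℤ} q^{m·C(n,2) + a n}.
-- For 0 ≤ a < m every exponent is ≥ |n| - 1, so the coefficient of q^N
-- only receives contributions from |n| ≤ N+1.
Jbar : ℕ → ℕ → Series
Jbar a m N = Σ≤ (2 ℕ.* suc N) (λ k → hit a m N (win N k))

-- J_{a,m} = j(q^a; q^m) = Σ_{n∈ℤ} (-1)^n q^{m·C(n,2) + a n}  (same window remark)
J : ℕ → ℕ → Series
J a m N = Σ≤ (2 ℕ.* suc N) (λ k → sgn (win N k) ℚ.* hit a m N (win N k))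

-- 1/J_4 = ∏_{i≥1} 1/(1 - q^{4i}) = ∏_{i≥1} Σ_k q^{4ik}
invJ4 : Series
invJ4 = ∏∞ (λ i n → if does ((4 ℕ.* i) ∣? n) then ℚ.1ℚ else ℚ.0ℚ)

ϑ₈ : (a₀ a₁ a₂ a₃ a₄ a₅ a₆ a₇ : ℤ) → Series
ϑ₈ a₀ a₁ a₂ a₃ a₄ a₅ a₆ a₇ =
  ((+ 1) ℚ./ 8) · (invJ4 ⊛
      (((((((( ⟦ a₀ ⟧ · (Jbar 4 8 ⊛ Jbar 28 64))
      ⊕ (⟦ a₁ ⟧ · qpow 4 (Jbar 0 8 ⊛ Jbar 52 64)))
      ⊕ (⟦ a₂ ⟧ · qpow 1 (Jbar 4 8 ⊛ Jbar 20 64)))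
      ⊕ (⟦ a₃ ⟧ · qpow 1 (Jbar 0 8 ⊛ Jbar 28 64)))
      ⊕ (⟦ a₄ ⟧ · qpow 2 (Jbar 0 8 ⊛ Jbar 20 64)))
      ⊕ (⟦ a₅ ⟧ · qpow 6 (Jbar 4 8 ⊛ Jbar 60 64)))
      ⊕ (⟦ a₆ ⟧ · qpow 3 (Jbar 4 8 ⊛ Jbar 52 64)))
      ⊕ (⟦ a₇ ⟧ · qpow 7 (Jbar 0 8 ⊛ Jbar 60 64))))

ϑ₈′ : (c₀ c₁ c₂ c₃ : ℤ) → Series
ϑ₈′ c₀ c₁ c₂ c₃ =
  ((+ 1) ℚ./ 2) · (invJ4 ⊛
      (((( ⟦ c₀ ⟧ · (J 4 8 ⊛ Jbar 28 64))
      ⊕ (⟦ c₁ ⟧ · qpow 1 (J 4 8 ⊛ Jbar 20 64)))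
      ⊕ (⟦ c₂ ⟧ · qpow 6 (J 4 8 ⊛ Jbar 60 64)))
      ⊕ (⟦ c₃ ⟧ · qpow 3 (J 4 8 ⊛ Jbar 52 64))))

-- Let R = ℚ[z]/(z⁸ - 1). The coefficient of z^a in F = (q)∞ / ((zq)∞ (z⁻¹q)∞),
-- taken in R[[q]], generates the numbers C(a,8;n). Write 8 = N + e₁ + e₂ + e₃ with
-- e₁, e₂, e₃ and N = 1 + z + ... + z⁷ eight times the idempotents of R at which z
-- has order 2, 4, 8 and 1. Then N F = N/(q)∞ accounts for the term p(n)/8. On e₁ and
-- e₂ the denominator of F becomes (-q)∞² and (-q²;q²)∞, and Euler's identity
-- (q;q²)∞ (-q)∞ = 1 gives φ(-q)ψ(-q)/J₄ and φ(-q)ψ(q)/J₄. On e₃ the product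
-- (zq)∞ (z⁻¹q)∞ (z³q)∞ (z⁻³q)∞ is (-q⁴;q⁴)∞, so that F becomes φ(-q⁴)/J₄ times
-- (q)∞ (z³q)∞ (z⁻³q)∞, which is a theta series by the triple product identity.
-- The exponents of ψ and of the last theta series are the triangular numbers T(j);
-- splitting them by j mod 8 gives the series J̄_{a,64}, each from a pair j ≡ s, 7 - s.

{-# OPTIONS --safe #-}
module Submission where

-- R has zero divisors and no root of unity is adjoined to ℚ, so the components of R are never
-- separated. An identity on a component is kept multiplied by e₁, e₂ or e₃, and infinite products
-- are changed factor by factor under that multiplier. F enters only through F E = (q)∞ with E =
-- (zq)∞ (z⁻¹q)∞; both sides are compared after multiplication by E, which has constant term 1 and
-- can be cancelled. The obstacle is on e₃: for c = z³ the triple product yields the wanted product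
-- times 1 - c⁻¹, a zero divisor in R. Dividing by it is replaced by an explicit element κ with κ(1
-- - c⁻¹) = e₃. The choice c = z³ is made because there z⁴ = -1, and z, z⁻¹, c, c⁻¹ are the four
-- roots ω for which the factors 1 - ωx multiply to 1 + x⁴. The triple product is the q-adic limit
-- of a finite identity valid in every commutative ring, so the same proof serves series over ℚ and
-- over R; limits are congruences modulo q^n. The integers in the theorem come from the coordinates
-- of e₁, e₂, e₃ and e₃(z + z⁻¹) at z^a.

open import Algebra.Bundles using (CommutativeRing)
import Algebra.Properties.Ring as RingProperties
open import Data.Bool using (if_then_else_; true; false) renaming (_≟_ to _≟B_)
open import Data.Integer as ℤ using (ℤ; +_; -[1+_])
import Data.Integer.Properties as ℤP
open import Data.Nat as ℕ using (ℕ; zero; suc; pred; _∸_; _≤_; _<_; _≤?_; s≤s; z≤n; NonZero)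
import Data.Nat.Properties as ℕP
import Data.Nat.Tactic.RingSolver as ℕSolver
open import Data.Product using (_,_)
open import Data.Rational as ℚ using (ℚ; 0ℚ; 1ℚ)
import Data.Rational.Properties as ℚP
open import Data.Sum using (inj₁; inj₂)
open import Function using (mk⇔)
open import Level using (0ℓ)
open import Relation.Binary.PropositionalEquality as ≡ using (_≡_)
import Relation.Binary.Reasoning.Setoid as SetoidReasoning
open import Relation.Nullary using (does; yes; no)
open import Relation.Nullary.Decidable using (from-yes; dec-true; dec-false; does-⇔)
import Defs

-- A polynomial solver with integer coefficients over any commutative ring

module IntegerSolver {c ℓ} (R : CommutativeRing c ℓ) where

  open import Algebra.Solver.Ring.AlmostCommutativeRing
    using (fromCommutativeRing; _-Raw-AlmostCommutative⟶_)
  import Algebra.Properties.AbelianGroup as AbelianGroupProperties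
  import Algebra.Properties.Semiring.Mult.TCOptimised as Multiples
  import Algebra.Solver.Ring as RingSolver
  open import Data.Maybe using (Maybe; just; nothing)

  open CommutativeRing R hiding (zero)
  open RingProperties ring using (-0#≈0#; -‿distribˡ-*; -‿distribʳ-*; -‿involutive)
  open AbelianGroupProperties +-abelianGroup using (⁻¹-∙-comm)
  open Multiples semiring using (_×_; 1+×; ×-homo-+; ×1-homo-*)
  open SetoidReasoning setoid

  -- The optimised multiples make `fromℤ (+ 1)` and `fromℤ -[1+ 0 ]` reduce to `1#` and `- 1#`, so
  -- that numerals in solver goals match the ring constants by computation.
  fromℤ : ℤ → Carrier
  fromℤ (+ n)     = n × 1#
  fromℤ -[1+ n ]  = - (suc n × 1#)

  private
    cancel-1# : ∀ a b → (1# + a) + - (1# + b) ≈ a + - b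
    cancel-1# a b = begin
      (1# + a) + - (1# + b)      ≈⟨ +-cong (+-comm 1# a) (sym (⁻¹-∙-comm 1# b)) ⟩
      (a + 1#) + (- 1# + - b)    ≈⟨ +-assoc a 1# _ ⟩
      a + (1# + (- 1# + - b))    ≈⟨ +-congˡ (sym (+-assoc 1# (- 1#) (- b))) ⟩
      a + ((1# + - 1#) + - b)    ≈⟨ +-congˡ (+-congʳ (-‿inverseʳ 1#)) ⟩
      a + (0# + - b)             ≈⟨ +-congˡ (+-identityˡ _) ⟩
      a + - b                    ∎

    fromℤ-⊖ : ∀ m n → fromℤ (m ℤ.⊖ n) ≈ m × 1# + - (n × 1#)
    fromℤ-⊖ zero    zero    = sym (-‿inverseʳ 0#)
    fromℤ-⊖ zero    (suc n) = sym (+-identityˡ _)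
    fromℤ-⊖ (suc m) zero    = sym (trans (+-congˡ -0#≈0#) (+-identityʳ _))
    fromℤ-⊖ (suc m) (suc n) = begin
      fromℤ (suc m ℤ.⊖ suc n)             ≡⟨ ≡.cong fromℤ (ℤP.[1+m]⊖[1+n]≡m⊖n m n) ⟩
      fromℤ (m ℤ.⊖ n)                     ≈⟨ fromℤ-⊖ m n ⟩
      m × 1# + - (n × 1#)                 ≈⟨ sym (cancel-1# _ _) ⟩
      (1# + m × 1#) + - (1# + n × 1#)
        ≈⟨ sym (+-cong (1+× m 1#) (-‿cong (1+× n 1#))) ⟩
      suc m × 1# + - (suc n × 1#)         ∎

    fromℤ-neg : ∀ i → fromℤ (ℤ.- i) ≈ - fromℤ i
    fromℤ-neg (+ zero)   = sym -0#≈0#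
    fromℤ-neg (+ suc n)  = refl
    fromℤ-neg -[1+ n ]   = sym (-‿involutive _)

    fromℤ-+ : ∀ i j → fromℤ (i ℤ.+ j) ≈ fromℤ i + fromℤ j
    fromℤ-+ (+ m)    (+ n)    = ×-homo-+ 1# m n
    fromℤ-+ (+ m)    -[1+ n ] = fromℤ-⊖ m (suc n)
    fromℤ-+ -[1+ m ] (+ n)    = trans (fromℤ-⊖ n (suc m)) (+-comm _ _)
    fromℤ-+ -[1+ m ] -[1+ n ] = begin
      - (suc (suc (m ℕ.+ n)) × 1#)     ≡⟨ ≡.cong (λ k → - (suc k × 1#)) (ℕP.+-suc m n) ⟨
      - ((suc m ℕ.+ suc n) × 1#)       ≈⟨ -‿cong (×-homo-+ 1# (suc m) (suc n)) ⟩
      - (suc m × 1# + suc n × 1#)      ≈⟨ sym (⁻¹-∙-comm _ _) ⟩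
      - (suc m × 1#) + - (suc n × 1#)  ∎

    fromℤ-*-pos : ∀ m j → fromℤ (+ m ℤ.* j) ≈ (m × 1#) * fromℤ j
    fromℤ-*-pos m (+ n) = begin
      fromℤ (+ m ℤ.* + n)       ≡⟨ ≡.cong fromℤ (≡.sym (ℤP.pos-* m n)) ⟩
      (m ℕ.* n) × 1#            ≈⟨ ×1-homo-* m n ⟩
      (m × 1#) * (n × 1#)       ∎
    fromℤ-*-pos m -[1+ n ] = begin
      fromℤ (+ m ℤ.* ℤ.- (+ suc n))      ≡⟨ ≡.cong fromℤ (≡.sym (ℤP.neg-distribʳ-* (+ m) (+ suc n))) ⟩
      fromℤ (ℤ.- (+ m ℤ.* + suc n))      ≈⟨ fromℤ-neg (+ m ℤ.* + suc n) ⟩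
      - fromℤ (+ m ℤ.* + suc n)          ≈⟨ -‿cong (fromℤ-*-pos m (+ suc n)) ⟩
      - ((m × 1#) * (suc n × 1#))        ≈⟨ -‿distribʳ-* _ _ ⟩
      (m × 1#) * - (suc n × 1#)          ∎

    fromℤ-* : ∀ i j → fromℤ (i ℤ.* j) ≈ fromℤ i * fromℤ j
    fromℤ-* (+ m)    j = fromℤ-*-pos m j
    fromℤ-* -[1+ m ] j = begin
      fromℤ (ℤ.- (+ suc m) ℤ.* j)      ≡⟨ ≡.cong fromℤ (≡.sym (ℤP.neg-distribˡ-* (+ suc m) j)) ⟩
      fromℤ (ℤ.- (+ suc m ℤ.* j))      ≈⟨ fromℤ-neg (+ suc m ℤ.* j) ⟩
      - fromℤ (+ suc m ℤ.* j)          ≈⟨ -‿cong (fromℤ-*-pos (suc m) j) ⟩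
      - ((suc m × 1#) * fromℤ j)       ≈⟨ -‿distribˡ-* _ _ ⟩
      - (suc m × 1#) * fromℤ j         ∎

    morphism : ℤ.+-*-rawRing -Raw-AlmostCommutative⟶ fromCommutativeRing R
    morphism = record
      { ⟦_⟧    = fromℤ
      ; +-homo = fromℤ-+
      ; *-homo = fromℤ-*
      ; -‿homo = fromℤ-neg
      ; 0-homo = refl
      ; 1-homo = refl
      }

    fromℤ-≟ : ∀ i j → Maybe (fromℤ i ≈ fromℤ j)
    fromℤ-≟ i j with i ℤ.≟ j
    ... | yes ≡.refl = just refl
    ... | no _       = nothing

  open RingSolver ℤ.+-*-rawRing (fromCommutativeRing R) morphism fromℤ-≟ public

-- Finite sums over initial segments

module FiniteSums {c ℓ} (R : CommutativeRing c ℓ) where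

  import Algebra.Properties.CommutativeSemigroup as CommutativeSemigroupProperties

  open CommutativeRing R hiding (zero)
  open CommutativeSemigroupProperties +-commutativeSemigroup using (interchange)
  open SetoidReasoning setoid

  Σ< : ℕ → (ℕ → Carrier) → Carrier
  Σ< zero    f = 0#
  Σ< (suc n) f = Σ< n f + f n

  Σ<-cong< : ∀ n {f g} → (∀ k → k ℕ.< n → f k ≈ g k) → Σ< n f ≈ Σ< n g
  Σ<-cong< zero    f≈g = refl
  Σ<-cong< (suc n) f≈g =
    +-cong (Σ<-cong< n (λ k k<n → f≈g k (ℕP.m<n⇒m<1+n k<n))) (f≈g n ℕP.≤-refl)

  Σ<-cong : ∀ n {f g} → (∀ k → f k ≈ g k) → Σ< n f ≈ Σ< n g
  Σ<-cong n f≈g = Σ<-cong< n (λ k _ → f≈g k)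

  Σ<-zero : ∀ n {f} → (∀ k → k ℕ.< n → f k ≈ 0#) → Σ< n f ≈ 0#
  Σ<-zero zero    f≈0 = refl
  Σ<-zero (suc n) f≈0 = trans
    (+-cong (Σ<-zero n (λ k k<n → f≈0 k (ℕP.m<n⇒m<1+n k<n))) (f≈0 n ℕP.≤-refl))
    (+-identityˡ 0#)

  Σ<-+ : ∀ n f g → Σ< n (λ k → f k + g k) ≈ Σ< n f + Σ< n g
  Σ<-+ zero    f g = sym (+-identityˡ 0#)
  Σ<-+ (suc n) f g = trans (+-congʳ (Σ<-+ n f g)) (interchange _ _ _ _)

  Σ<-*ˡ : ∀ n a f → Σ< n (λ k → a * f k) ≈ a * Σ< n f
  Σ<-*ˡ zero    a f = sym (zeroʳ a)
  Σ<-*ˡ (suc n) a f = trans (+-congʳ (Σ<-*ˡ n a f)) (sym (distribˡ a _ _))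

  Σ<-head : ∀ n f → Σ< (suc n) f ≈ f 0 + Σ< n (λ k → f (suc k))
  Σ<-head zero    f = +-comm 0# (f 0)
  Σ<-head (suc n) f = trans (+-congʳ (Σ<-head n f)) (+-assoc _ _ _)

  Σ<-++ : ∀ m n f → Σ< (m ℕ.+ n) f ≈ Σ< m f + Σ< n (λ k → f (m ℕ.+ k))
  Σ<-++ m zero    f = trans
    (reflexive (≡.cong (λ k → Σ< k f) (ℕP.+-identityʳ m))) (sym (+-identityʳ _))
  Σ<-++ m (suc n) f = begin
    Σ< (m ℕ.+ suc n) f              ≡⟨ ≡.cong (λ k → Σ< k f) (ℕP.+-suc m n) ⟩
    Σ< (m ℕ.+ n) f + f (m ℕ.+ n)    ≈⟨ +-congʳ (Σ<-++ m n f) ⟩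
    (Σ< m f + Σ< n (λ k → f (m ℕ.+ k))) + f (m ℕ.+ n)  ≈⟨ +-assoc _ _ _ ⟩
    Σ< m f + Σ< (suc n) (λ k → f (m ℕ.+ k))            ∎

  Σ<-blocks : ∀ m n f → Σ< (n ℕ.* m) f ≈ Σ< n (λ i → Σ< m (λ s → f (i ℕ.* m ℕ.+ s)))
  Σ<-blocks m zero    f = refl
  Σ<-blocks m (suc n) f = begin
    Σ< (m ℕ.+ n ℕ.* m) f    ≡⟨ ≡.cong (λ k → Σ< k f) (ℕP.+-comm m (n ℕ.* m)) ⟩
    Σ< (n ℕ.* m ℕ.+ m) f    ≈⟨ Σ<-++ (n ℕ.* m) m f ⟩
    Σ< (n ℕ.* m) f + Σ< m (λ s → f (n ℕ.* m ℕ.+ s))  ≈⟨ +-congʳ (Σ<-blocks m n f) ⟩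
    Σ< (suc n) (λ i → Σ< m (λ s → f (i ℕ.* m ℕ.+ s))) ∎

  Σ<-reverse : ∀ n f → Σ< n f ≈ Σ< n (λ k → f (n ℕ.∸ suc k))
  Σ<-reverse zero    f = refl
  Σ<-reverse (suc n) f = begin
    Σ< n f + f n                                 ≈⟨ +-congʳ (Σ<-reverse n f) ⟩
    Σ< n (λ k → f (n ℕ.∸ suc k)) + f n           ≈⟨ +-comm _ _ ⟩
    f n + Σ< n (λ k → f (n ℕ.∸ suc k))           ≈⟨ sym (Σ<-head n (λ k → f (n ℕ.∸ k))) ⟩
    Σ< (suc n) (λ k → f (n ℕ.∸ k))               ∎

-- Formal power series as a commutative ring

module SeriesRing (R : CommutativeRing 0ℓ 0ℓ) where

  import Algebra.Properties.CommutativeSemigroup as CommutativeSemigroupProperties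
  open import Algebra.Structures using (IsCommutativeRing)

  open CommutativeRing R hiding (zero)
  open CommutativeSemigroupProperties +-commutativeSemigroup using (interchange)
  open Defs.PowerSeries _+_ _*_ 0# 1# public using (Series; Σ≤; _⊕_; _⊛_; one)
  open SetoidReasoning setoid

  infix 4 _≃_
  -- A record rather than a bare family of equations, so that unification can
  -- read off the two series from the type.
  record _≃_ (f g : Series) : Set where
    constructor coeffwise
    field at : ∀ n → f n ≈ g n
  open _≃_ public

  tail : Series → Series
  tail f n = f (suc n)

  -- Opaque, so that unification compares sums and products of series
  -- argument by argument instead of unfolding them to their coefficients.
  opaque
    infixl 6 _✚_
    infixl 7 _✶_
    _✚_ _✶_ : Series → Series → Series
    _✚_ = _⊕_
    _✶_ = _⊛_

    negS : Series → Series
    negS f n = - f n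

    ✚-at : ∀ f g n → (f ✚ g) n ≡ (f ⊕ g) n
    ✚-at f g n = ≡.refl

    ✶-at : ∀ f g n → (f ✶ g) n ≡ (f ⊛ g) n
    ✶-at f g n = ≡.refl

    negS-at : ∀ f n → negS f n ≡ - f n
    negS-at f n = ≡.refl

  zeroS : Series
  zeroS _ = 0#

  C : Carrier → Series
  C c zero    = c
  C c (suc _) = 0#

  q : Series
  q 1 = 1#
  q _ = 0#

  Σ≤-cong≤ : ∀ n {f g} → (∀ k → k ≤ n → f k ≈ g k) → Σ≤ n f ≈ Σ≤ n g
  Σ≤-cong≤ zero    f≈g = f≈g 0 z≤n
  Σ≤-cong≤ (suc n) f≈g =
    +-cong (Σ≤-cong≤ n (λ k k≤n → f≈g k (ℕP.m≤n⇒m≤1+n k≤n))) (f≈g (suc n) ℕP.≤-refl)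

  Σ≤-head : ∀ n f → Σ≤ (suc n) f ≈ f 0 + Σ≤ n (λ k → f (suc k))
  Σ≤-head zero    f = refl
  Σ≤-head (suc n) f = trans (+-congʳ (Σ≤-head n f)) (+-assoc _ _ _)

  Σ≤-+ : ∀ n f g → Σ≤ n (λ k → f k + g k) ≈ Σ≤ n f + Σ≤ n g
  Σ≤-+ zero    f g = refl
  Σ≤-+ (suc n) f g = trans (+-congʳ (Σ≤-+ n f g)) (interchange _ _ _ _)

  Σ≤-*ˡ : ∀ n a f → Σ≤ n (λ k → a * f k) ≈ a * Σ≤ n f
  Σ≤-*ˡ zero    a f = refl
  Σ≤-*ˡ (suc n) a f = trans (+-congʳ (Σ≤-*ˡ n a f)) (sym (distribˡ a _ _))

  Σ≤-zero : ∀ n {f} → (∀ k → f k ≈ 0#) → Σ≤ n f ≈ 0#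
  Σ≤-zero zero    f≈0 = f≈0 0
  Σ≤-zero (suc n) f≈0 = trans (+-cong (Σ≤-zero n f≈0) (f≈0 (suc n))) (+-identityˡ 0#)

  ⊛-head : ∀ f g n → (f ⊛ g) (suc n) ≈ f 0 * g (suc n) + (tail f ⊛ g) n
  ⊛-head f g n = Σ≤-head n (λ k → f k * g (suc n ∸ k))

  ⊛-last : ∀ f g n → (f ⊛ g) (suc n) ≈ (f ⊛ tail g) n + f (suc n) * g 0
  ⊛-last f g n = +-cong
    (Σ≤-cong≤ n (λ k k≤n → *-congˡ (reflexive (≡.cong g (ℕP.+-∸-assoc 1 k≤n)))))
    (*-congˡ (reflexive (≡.cong g (ℕP.n∸n≡0 n))))

  private
    ⊛-cong′ : ∀ {f f′ g g′} → (∀ n → f n ≈ f′ n) → (∀ n → g n ≈ g′ n) →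
              ∀ n → (f ⊛ g) n ≈ (f′ ⊛ g′) n
    ⊛-cong′ p r n = Σ≤-cong≤ n (λ k _ → *-cong (p k) (r (n ∸ k)))

    -- Peeling the first summand of one product and the last summand of the other leaves products
    -- with `tail f`, one coefficient lower, so induction on `n` applies.
    ⊛-comm′ : ∀ f g n → (f ⊛ g) n ≈ (g ⊛ f) n
    ⊛-comm′ f g zero    = *-comm _ _
    ⊛-comm′ f g (suc n) = begin
      (f ⊛ g) (suc n)                       ≈⟨ ⊛-head f g n ⟩
      f 0 * g (suc n) + (tail f ⊛ g) n      ≈⟨ +-cong (*-comm _ _) (⊛-comm′ (tail f) g n) ⟩
      g (suc n) * f 0 + (g ⊛ tail f) n      ≈⟨ +-comm _ _ ⟩
      (g ⊛ tail f) n + g (suc n) * f 0      ≈⟨ sym (⊛-last g f n) ⟩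
      (g ⊛ f) (suc n)                       ∎

    ⊛-distribʳ′ : ∀ h f g n → ((f ⊕ g) ⊛ h) n ≈ ((f ⊛ h) ⊕ (g ⊛ h)) n
    ⊛-distribʳ′ h f g n = trans
      (Σ≤-cong≤ n (λ k _ → distribʳ (h (n ∸ k)) (f k) (g k))) (Σ≤-+ n _ _)

    scale-⊛ : ∀ a f g n → ((λ k → a * f k) ⊛ g) n ≈ a * (f ⊛ g) n
    scale-⊛ a f g n = trans (Σ≤-cong≤ n (λ k _ → *-assoc _ _ _)) (Σ≤-*ˡ n a _)

    -- The tail of a product is `f 0` times `tail g` plus `tail f` times `g`; distributivity then
    -- leaves one triple product, with `tail f`, at the smaller index.
    ⊛-assoc′ : ∀ f g h n → ((f ⊛ g) ⊛ h) n ≈ (f ⊛ (g ⊛ h)) n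
    ⊛-assoc′ f g h zero    = *-assoc _ _ _
    ⊛-assoc′ f g h (suc n) = begin
      ((f ⊛ g) ⊛ h) (suc n)
        ≈⟨ ⊛-head (f ⊛ g) h n ⟩
      f 0 * g 0 * h (suc n) + (tail (f ⊛ g) ⊛ h) n
        ≈⟨ +-cong (*-assoc _ _ _) (⊛-cong′ {g = h} (⊛-head f g) (λ _ → refl) n) ⟩
      f 0 * (g 0 * h (suc n)) + (((λ k → f 0 * tail g k) ⊕ (tail f ⊛ g)) ⊛ h) n
        ≈⟨ +-congˡ (⊛-distribʳ′ h _ _ n) ⟩
      f 0 * (g 0 * h (suc n)) + (((λ k → f 0 * tail g k) ⊛ h) n + ((tail f ⊛ g) ⊛ h) n)
        ≈⟨ +-congˡ (+-cong (scale-⊛ (f 0) (tail g) h n) (⊛-assoc′ (tail f) g h n)) ⟩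
      f 0 * (g 0 * h (suc n)) + (f 0 * (tail g ⊛ h) n + (tail f ⊛ (g ⊛ h)) n)
        ≈⟨ sym (+-assoc _ _ _) ⟩
      f 0 * (g 0 * h (suc n)) + f 0 * (tail g ⊛ h) n + (tail f ⊛ (g ⊛ h)) n
        ≈⟨ +-congʳ (sym (distribˡ _ _ _)) ⟩
      f 0 * (g 0 * h (suc n) + (tail g ⊛ h) n) + (tail f ⊛ (g ⊛ h)) n
        ≈⟨ +-congʳ (*-congˡ (sym (⊛-head g h n))) ⟩
      f 0 * (g ⊛ h) (suc n) + (tail f ⊛ (g ⊛ h)) n
        ≈⟨ sym (⊛-head f (g ⊛ h) n) ⟩
      (f ⊛ (g ⊛ h)) (suc n) ∎

  C-⊛ : ∀ c f n → (C c ⊛ f) n ≈ c * f n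
  C-⊛ c f zero    = refl
  C-⊛ c f (suc n) = trans (⊛-head (C c) f n)
    (trans (+-congˡ (Σ≤-zero n (λ k → zeroˡ _))) (+-identityʳ _))

  one≃C1 : one ≃ C 1#
  one≃C1 = coeffwise λ { zero → refl ; (suc _) → refl }

  private
    one-⊛ : ∀ f n → (one ⊛ f) n ≈ f n
    one-⊛ f n = trans (⊛-cong′ {g = f} (at one≃C1) (λ _ → refl) n)
                      (trans (C-⊛ 1# f n) (*-identityˡ _))

  opaque
    unfolding _✚_ _✶_ negS
    ✚-✶-isCommutativeRing : IsCommutativeRing _≃_ _✚_ _✶_ negS zeroS one
    ✚-✶-isCommutativeRing = record
      { isRing = record
        { +-isAbelianGroup = record
          { isGroup = record
            { isMonoid = record
              { isSemigroup = record
                { isMagma = record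
                  { isEquivalence = record
                    { refl  = coeffwise λ _ → refl
                    ; sym   = λ p → coeffwise λ n → sym (at p n)
                    ; trans = λ p r → coeffwise λ n → trans (at p n) (at r n)
                    }
                  ; ∙-cong = λ p r → coeffwise λ n → +-cong (at p n) (at r n)
                  }
                ; assoc = λ _ _ _ → coeffwise λ _ → +-assoc _ _ _
                }
              ; identity = (λ _ → coeffwise λ _ → +-identityˡ _) , (λ _ → coeffwise λ _ → +-identityʳ _)
              }
            ; inverse = (λ _ → coeffwise λ _ → -‿inverseˡ _) , (λ _ → coeffwise λ _ → -‿inverseʳ _)
            ; ⁻¹-cong = λ p → coeffwise λ n → -‿cong (at p n)
            }
          ; comm = λ _ _ → coeffwise λ _ → +-comm _ _
          }
        ; *-cong = λ p r → coeffwise (⊛-cong′ (at p) (at r))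
        ; *-assoc = λ f g h → coeffwise (⊛-assoc′ f g h)
        ; *-identity = (λ f → coeffwise (one-⊛ f))
                     , (λ f → coeffwise λ n → trans (⊛-comm′ f one n) (one-⊛ f n))
        ; distrib = (λ f g h → coeffwise λ n → trans (⊛-comm′ f (g ⊕ h) n)
                       (trans (⊛-distribʳ′ f g h n) (+-cong (⊛-comm′ g f n) (⊛-comm′ h f n))))
                  , (λ f g h → coeffwise (⊛-distribʳ′ f g h))
        }
      ; *-comm = λ f g → coeffwise (⊛-comm′ f g)
      }

  seriesRing : CommutativeRing 0ℓ 0ℓ
  seriesRing = record { isCommutativeRing = ✚-✶-isCommutativeRing }

  q-⊛-suc : ∀ f n → (q ⊛ f) (suc n) ≈ f n
  q-⊛-suc f n = begin
    (q ⊛ f) (suc n)                      ≈⟨ ⊛-head q f n ⟩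
    0# * f (suc n) + (tail q ⊛ f) n      ≈⟨ +-cong (zeroˡ _) (⊛-cong′ {g = f} tail-q (λ _ → refl) n) ⟩
    0# + (one ⊛ f) n                     ≈⟨ trans (+-identityˡ _) (one-⊛ f n) ⟩
    f n                                  ∎
    where
    tail-q : ∀ n → tail q n ≈ one n
    tail-q zero    = refl
    tail-q (suc n) = refl

  C-cong : ∀ {a b} → a ≈ b → C a ≃ C b
  C-cong p = coeffwise λ { zero → p ; (suc n) → refl }

  opaque
    unfolding _✚_ _✶_ negS
    C-+ : ∀ a b → C (a + b) ≃ C a ✚ C b
    C-+ a b = coeffwise λ { zero → refl ; (suc n) → sym (+-identityˡ 0#) }

    C-* : ∀ a b → C (a * b) ≃ C a ✶ C b
    C-* a b = coeffwise λ
      { zero → refl ; (suc n) → sym (trans (C-⊛ a (C b) (suc n)) (zeroʳ a)) }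

    C-negS : ∀ a → C (- a) ≃ negS (C a)
    C-negS a = coeffwise λ
      { zero → refl ; (suc n) → sym (RingProperties.-0#≈0# ring) }

  C-0 : C 0# ≃ zeroS
  C-0 = coeffwise λ { zero → refl ; (suc n) → refl }

-- Gaussian binomials and the finite Jacobi triple product

module FiniteTripleProduct {c ℓ} (R : CommutativeRing c ℓ) (x y : CommutativeRing.Carrier R) where

  open CommutativeRing R hiding (zero)

  open import Algebra.Properties.Semiring.Exp semiring using (_^_; ^-homo-*)

  open FiniteSums R
  open IntegerSolver R using (solve; _:=_; _:+_; _:*_; _:-_; con)
  open SetoidReasoning setoid

  -- With base `x * y` the usual pair of arguments z and Q/z becomes `x` and `y`, so no argument has
  -- to be inverted.
  Q : Carrier
  Q = x * y

  -- gauss n k is the Gaussian binomial coefficient [n choose k] in base Q.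
  gauss : ℕ → ℕ → Carrier
  gauss n       zero    = 1#
  gauss zero    (suc k) = 0#
  gauss (suc n) (suc k) = gauss n k + Q ^ suc k * gauss n (suc k)

  gauss-> : ∀ n k → n < k → gauss n k ≈ 0#
  gauss-> zero    (suc k) _         = refl
  gauss-> (suc n) (suc k) (s≤s n<k) = begin
    gauss n k + Q ^ suc k * gauss n (suc k)
      ≈⟨ +-cong (gauss-> n k n<k) (*-congˡ (gauss-> n (suc k) (ℕP.m<n⇒m<1+n n<k))) ⟩
    0# + Q ^ suc k * 0#   ≈⟨ trans (+-identityˡ _) (zeroʳ _) ⟩
    0#                    ∎

  gauss-n-n : ∀ n → gauss n n ≈ 1#
  gauss-n-n zero    = refl
  gauss-n-n (suc n) = begin
    gauss n n + Q ^ suc n * gauss n (suc n)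
      ≈⟨ +-cong (gauss-n-n n) (*-congˡ (gauss-> n (suc n) ℕP.≤-refl)) ⟩
    1# + Q ^ suc n * 0#   ≈⟨ trans (+-congˡ (zeroʳ _)) (+-identityʳ _) ⟩
    1#                    ∎

  -- This is the Pascal rule with the power on the other term. The upper index is `k + i`, so that
  -- the exponent n - k is `i` and no subtraction occurs. Both binomials of the defining rule are
  -- expanded by induction and reassembled.
  gauss-pascal : ∀ i k → gauss (suc (k ℕ.+ i)) (suc k) ≈
                 Q ^ i * gauss (k ℕ.+ i) k + gauss (k ℕ.+ i) (suc k)
  gauss-pascal zero k = begin
    gauss (k ℕ.+ 0) k + Q ^ suc k * gauss (k ℕ.+ 0) (suc k)
      ≈⟨ +-cong (sym (*-identityˡ _)) (*-congˡ g≈0) ⟩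
    1# * gauss (k ℕ.+ 0) k + Q ^ suc k * 0#
      ≈⟨ +-congˡ (trans (zeroʳ _) (sym g≈0)) ⟩
    1# * gauss (k ℕ.+ 0) k + gauss (k ℕ.+ 0) (suc k) ∎
    where
    g≈0 : gauss (k ℕ.+ 0) (suc k) ≈ 0#
    g≈0 = gauss-> (k ℕ.+ 0) (suc k) (s≤s (ℕP.≤-reflexive (ℕP.+-identityʳ k)))
  gauss-pascal (suc i) zero = begin
    1# + Q ^ 1 * gauss (suc i) 1
      ≈⟨ +-congˡ (*-congˡ (gauss-pascal i zero)) ⟩
    1# + Q ^ 1 * (Q ^ i * 1# + gauss i 1)
      ≈⟨ solve 3 (λ Q Qⁱ g → con (+ 1) :+ Q :* con (+ 1) :* (Qⁱ :* con (+ 1) :+ g)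
                     := Q :* Qⁱ :* con (+ 1) :+ (con (+ 1) :+ Q :* con (+ 1) :* g)) refl Q (Q ^ i) (gauss i 1) ⟩
    Q ^ suc i * 1# + gauss (suc i) 1 ∎
  gauss-pascal (suc i) (suc k) = begin
    gauss (suc (k ℕ.+ suc i)) (suc k) + Q ^ suc (suc k) * gauss (suc (k ℕ.+ suc i)) (suc (suc k))
      ≡⟨ ≡.cong (λ n → gauss (suc (k ℕ.+ suc i)) (suc k) + Q ^ suc (suc k) * gauss (suc n) (suc (suc k)))
                (ℕP.+-suc k i) ⟩
    gauss (suc (k ℕ.+ suc i)) (suc k) + Q ^ suc (suc k) * gauss (suc (suc k ℕ.+ i)) (suc (suc k))
      ≈⟨ +-cong (gauss-pascal (suc i) k) (*-congˡ (gauss-pascal i (suc k))) ⟩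
    (Q * Q ^ i * gauss (k ℕ.+ suc i) k + gauss (k ℕ.+ suc i) (suc k))
      + Q ^ suc (suc k) * (Q ^ i * gauss (suc k ℕ.+ i) (suc k) + gauss (suc k ℕ.+ i) (suc (suc k)))
      ≡⟨ ≡.cong (λ n → (Q * Q ^ i * gauss (k ℕ.+ suc i) k + gauss (k ℕ.+ suc i) (suc k))
              + Q ^ suc (suc k) * (Q ^ i * gauss n (suc k) + gauss n (suc (suc k)))) (ℕP.+-suc k i) ⟨
    (Q * Q ^ i * gauss (k ℕ.+ suc i) k + gauss (k ℕ.+ suc i) (suc k))
      + Q ^ suc (suc k) * (Q ^ i * gauss (k ℕ.+ suc i) (suc k) + gauss (k ℕ.+ suc i) (suc (suc k)))
      ≈⟨ solve 6 (λ Q Qⁱ Qᵏ a b c →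
           (Q :* Qⁱ :* a :+ b) :+ (Q :* (Q :* Qᵏ)) :* (Qⁱ :* b :+ c)
             := Q :* Qⁱ :* (a :+ (Q :* Qᵏ) :* b) :+ (b :+ (Q :* (Q :* Qᵏ)) :* c)) refl
           Q (Q ^ i) (Q ^ k) _ _ _ ⟩
    Q ^ suc i * gauss (suc (k ℕ.+ suc i)) (suc k) + gauss (suc (k ℕ.+ suc i)) (suc (suc k)) ∎

  poch : ℕ → Carrier
  poch zero    = 1#
  poch (suc n) = poch n * (1# - Q ^ suc n)

  -- The quotient formula for Gaussian binomials with the denominators cleared. The induction rests
  -- on 1 - st = (1 - s) + s(1 - t) for s = Q^(k+1) and t = Q^(i+1).
  gauss-poch : ∀ i k → poch k * poch i * gauss (k ℕ.+ i) k ≈ poch (k ℕ.+ i)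
  gauss-poch i zero = trans (*-identityʳ _) (*-identityˡ _)
  gauss-poch zero (suc k) = begin
    poch (suc k) * 1# * gauss (suc (k ℕ.+ 0)) (suc k)
      ≡⟨ ≡.cong (λ n → poch (suc k) * 1# * gauss (suc n) (suc k)) (ℕP.+-identityʳ k) ⟩
    poch (suc k) * 1# * gauss (suc k) (suc k)
      ≈⟨ trans (*-cong (*-identityʳ _) (gauss-n-n (suc k))) (*-identityʳ _) ⟩
    poch (suc k)
      ≡⟨ ≡.cong (λ n → poch (suc n)) (ℕP.+-identityʳ k) ⟨
    poch (suc (k ℕ.+ 0)) ∎
  gauss-poch (suc i) (suc k) = begin
    poch k * (1# - Q ^ suc k) * poch (suc i) * (gauss (k ℕ.+ suc i) k + Q ^ suc k * gauss (k ℕ.+ suc i) (suc k))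
      ≈⟨ solve 6 (λ p r a b s t → p :* (con (+ 1) :- s) :* (r :* (con (+ 1) :- t)) :* (a :+ s :* b)
           := (con (+ 1) :- s) :* (p :* (r :* (con (+ 1) :- t)) :* a)
              :+ s :* (con (+ 1) :- t) :* ((p :* (con (+ 1) :- s)) :* r :* b)) refl
           (poch k) (poch i) (gauss (k ℕ.+ suc i) k) (gauss (k ℕ.+ suc i) (suc k)) (Q ^ suc k) (Q ^ suc i) ⟩
    (1# - Q ^ suc k) * (poch k * poch (suc i) * gauss (k ℕ.+ suc i) k)
      + Q ^ suc k * (1# - Q ^ suc i) * (poch (suc k) * poch i * gauss (k ℕ.+ suc i) (suc k))
      ≈⟨ +-cong (*-congˡ (gauss-poch (suc i) k)) (*-congˡ second) ⟩
    (1# - Q ^ suc k) * poch (k ℕ.+ suc i) + Q ^ suc k * (1# - Q ^ suc i) * poch (k ℕ.+ suc i)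
      ≈⟨ solve 3 (λ p s t → (con (+ 1) :- s) :* p :+ s :* (con (+ 1) :- t) :* p
           := p :* (con (+ 1) :- s :* t)) refl (poch (k ℕ.+ suc i)) (Q ^ suc k) (Q ^ suc i) ⟩
    poch (k ℕ.+ suc i) * (1# - Q ^ suc k * Q ^ suc i)
      ≈⟨ *-congˡ (+-congˡ (-‿cong (sym (^-homo-* Q (suc k) (suc i))))) ⟩
    poch (k ℕ.+ suc i) * (1# - Q ^ suc (k ℕ.+ suc i)) ∎
    where
    second : poch (suc k) * poch i * gauss (k ℕ.+ suc i) (suc k) ≈ poch (k ℕ.+ suc i)
    second = ≡.subst (λ n → poch (suc k) * poch i * gauss n (suc k) ≈ poch n)
               (≡.sym (ℕP.+-suc k i)) (gauss-poch i (suc k))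

  module _ (N : ℕ) (w : Carrier) (u : ℕ → Carrier) where

    -- Both forms of Pascal's rule turn a geometric-type relation between
    -- neighbouring terms into one more linear factor of the product.
    gauss-sum-suc : (∀ j i → j ℕ.+ i ≡ N → u (suc j) * Q ^ i ≈ w * u j) →
      Σ< (suc (suc N)) (λ j → gauss (suc N) j * u j) ≈
      (1# + w) * Σ< (suc N) (λ j → gauss N j * u j)
    gauss-sum-suc rel = begin
      Σ< (suc (suc N)) (λ j → gauss (suc N) j * u j)
        ≈⟨ Σ<-head (suc N) _ ⟩
      1# * u 0 + Σ< (suc N) (λ j → gauss (suc N) (suc j) * u (suc j))
        ≈⟨ +-congˡ (Σ<-cong< (suc N) term) ⟩
      1# * u 0 + Σ< (suc N) (λ j → w * (gauss N j * u j) + gauss N (suc j) * u (suc j))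
        ≈⟨ +-congˡ (Σ<-+ (suc N) _ _) ⟩
      1# * u 0 + (Σ< (suc N) (λ j → w * (gauss N j * u j)) + Σ< (suc N) (λ j → gauss N (suc j) * u (suc j)))
        ≈⟨ solve 3 (λ a b c → a :+ (b :+ c) := (a :+ c) :+ b) refl _ _ _ ⟩
      1# * u 0 + Σ< (suc N) (λ j → gauss N (suc j) * u (suc j)) + Σ< (suc N) (λ j → w * (gauss N j * u j))
        ≈⟨ +-cong (sym (Σ<-head (suc N) (λ j → gauss N j * u j))) (Σ<-*ˡ (suc N) w _) ⟩
      (S + gauss N (suc N) * u (suc N)) + w * S
        ≈⟨ +-congʳ (+-congˡ (trans (*-congʳ (gauss-> N (suc N) ℕP.≤-refl)) (zeroˡ _))) ⟩
      (S + 0#) + w * S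
        ≈⟨ solve 2 (λ S w → (S :+ con (+ 0)) :+ w :* S := (con (+ 1) :+ w) :* S) refl S w ⟩
      (1# + w) * S ∎
      where
      S = Σ< (suc N) (λ j → gauss N j * u j)
      term : ∀ j → j < suc N → gauss (suc N) (suc j) * u (suc j) ≈
                               w * (gauss N j * u j) + gauss N (suc j) * u (suc j)
      term j (s≤s j≤N) = begin
        gauss (suc N) (suc j) * u (suc j)
          ≡⟨ ≡.cong (λ n → gauss (suc n) (suc j) * u (suc j)) eq ⟨
        gauss (suc (j ℕ.+ i)) (suc j) * u (suc j)
          ≈⟨ *-congʳ (gauss-pascal i j) ⟩
        (Q ^ i * gauss (j ℕ.+ i) j + gauss (j ℕ.+ i) (suc j)) * u (suc j)
          ≡⟨ ≡.cong (λ n → (Q ^ i * gauss n j + gauss n (suc j)) * u (suc j)) eq ⟩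
        (Q ^ i * gauss N j + gauss N (suc j)) * u (suc j)
          ≈⟨ solve 4 (λ a b c v → (a :* b :+ c) :* v := b :* (v :* a) :+ c :* v) refl _ _ _ _ ⟩
        gauss N j * (u (suc j) * Q ^ i) + gauss N (suc j) * u (suc j)
          ≈⟨ +-congʳ (*-congˡ (rel j i eq)) ⟩
        gauss N j * (w * u j) + gauss N (suc j) * u (suc j)
          ≈⟨ +-congʳ (solve 3 (λ a b c → a :* (b :* c) := b :* (a :* c)) refl _ _ _) ⟩
        w * (gauss N j * u j) + gauss N (suc j) * u (suc j) ∎
        where
        i = N ∸ j
        eq : j ℕ.+ i ≡ N
        eq = ℕP.m+[n∸m]≡n j≤N

    gauss-sum-shift : (∀ j → Q ^ j * u j ≈ w * u (suc j)) →
      Σ< (suc (suc N)) (λ j → gauss (suc N) j * u j) ≈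
      (1# + w) * Σ< (suc N) (λ j → gauss N j * u (suc j))
    gauss-sum-shift rel = begin
      Σ< (suc (suc N)) (λ j → gauss (suc N) j * u j)
        ≈⟨ Σ<-head (suc N) _ ⟩
      1# * u 0 + Σ< (suc N) (λ j → gauss (suc N) (suc j) * u (suc j))
        ≈⟨ +-congˡ (Σ<-cong (suc N) λ j → distribʳ _ _ _) ⟩
      1# * u 0 + Σ< (suc N) (λ j → gauss N j * u (suc j) + Q ^ suc j * gauss N (suc j) * u (suc j))
        ≈⟨ +-cong (*-congʳ (sym (*-identityʳ 1#))) (Σ<-+ (suc N) _ _) ⟩
      1# * 1# * u 0 + (S + Σ< (suc N) (λ j → Q ^ suc j * gauss N (suc j) * u (suc j)))
        ≈⟨ solve 3 (λ a b c → a :+ (b :+ c) := b :+ (a :+ c)) refl _ _ _ ⟩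
      S + (1# * 1# * u 0 + Σ< (suc N) (λ j → Q ^ suc j * gauss N (suc j) * u (suc j)))
        ≈⟨ +-congˡ (sym (Σ<-head (suc N) (λ j → Q ^ j * gauss N j * u j))) ⟩
      S + (Σ< (suc N) (λ j → Q ^ j * gauss N j * u j) + Q ^ suc N * gauss N (suc N) * u (suc N))
        ≈⟨ +-congˡ (+-cong (Σ<-cong (suc N) term) (*-congʳ (*-congˡ (gauss-> N (suc N) ℕP.≤-refl)))) ⟩
      S + (Σ< (suc N) (λ j → w * (gauss N j * u (suc j))) + Q ^ suc N * 0# * u (suc N))
        ≈⟨ +-congˡ (+-congʳ (Σ<-*ˡ (suc N) w _)) ⟩
      S + (w * S + Q ^ suc N * 0# * u (suc N))
        ≈⟨ solve 4 (λ S w a b → S :+ (w :* S :+ a :* con (+ 0) :* b) := (con (+ 1) :+ w) :* S) refl S w _ _ ⟩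
      (1# + w) * S ∎
      where
      S = Σ< (suc N) (λ j → gauss N j * u (suc j))
      term : ∀ j → Q ^ j * gauss N j * u j ≈ w * (gauss N j * u (suc j))
      term j = begin
        Q ^ j * gauss N j * u j       ≈⟨ solve 3 (λ a b c → a :* b :* c := b :* (a :* c)) refl _ _ _ ⟩
        gauss N j * (Q ^ j * u j)     ≈⟨ *-congˡ (rel j) ⟩
        gauss N j * (w * u (suc j))   ≈⟨ solve 3 (λ a b c → a :* (b :* c) := b :* (a :* c)) refl _ _ _ ⟩
        w * (gauss N j * u (suc j))   ∎

  -- pos k = x^k Q^(k(k-1)/2) and neg k = y^k Q^(k(k-1)/2) are the terms of index
  -- k and -k of the bilateral theta series; term j n is the one of index j - n.
  pos neg : ℕ → Carrier
  pos zero    = 1#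
  pos (suc k) = x * Q ^ k * pos k
  neg zero    = 1#
  neg (suc k) = y * Q ^ k * neg k

  term : ℕ → ℕ → Carrier
  term j       zero    = pos j
  term zero    (suc n) = neg (suc n)
  term (suc j) (suc n) = term j n

  term-neg : ∀ n → term 0 n ≈ neg n
  term-neg zero    = refl
  term-neg (suc n) = refl

  -- Neighbouring terms, of index e and e + 1, have ratio x Q^e. For e = j - n - 1 possibly negative
  -- this is cleared by multiplying with `y * Q ^ n`, since xy = Q.
  term-shift : ∀ j n → Q ^ j * term j (suc n) ≈ y * Q ^ n * term (suc j) (suc n)
  term-shift zero    n       = trans (*-identityˡ _) (*-congˡ (sym (term-neg n)))
  term-shift (suc j) zero    = solve 4 (λ x y Qʲ p → x :* y :* Qʲ :* p :=
    y :* con (+ 1) :* (x :* Qʲ :* p)) refl x y (Q ^ j) (pos j)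
  term-shift (suc j) (suc n) = begin
    Q * Q ^ j * term j (suc n)                ≈⟨ *-assoc _ _ _ ⟩
    Q * (Q ^ j * term j (suc n))              ≈⟨ *-congˡ (term-shift j n) ⟩
    Q * (y * Q ^ n * term (suc j) (suc n))
      ≈⟨ solve 4 (λ Q y Qⁿ t → Q :* (y :* Qⁿ :* t) := y :* (Q :* Qⁿ) :* t) refl _ _ _ _ ⟩
    y * (Q * Q ^ n) * term (suc j) (suc n)    ∎

  -- The ratio x Q^(j-n) of neighbouring terms, cleared with `Q ^ i`; the hypothesis says that j - n
  -- + i = m.
  term-suc : ∀ j i n m → j ℕ.+ i ≡ n ℕ.+ m → term (suc j) n * Q ^ i ≈ x * Q ^ m * term j n
  term-suc j i zero m ≡.refl = begin
    x * Q ^ j * pos j * Q ^ i      ≈⟨ solve 4 (λ x a b p → x :* a :* p :* b := x :* (a :* b) :* p) refl _ _ _ _ ⟩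
    x * (Q ^ j * Q ^ i) * pos j    ≈⟨ *-congʳ (*-congˡ (sym (^-homo-* Q j i))) ⟩
    x * Q ^ (j ℕ.+ i) * pos j      ∎
  term-suc zero i (suc n) m ≡.refl = begin
    term 0 n * (Q * Q ^ (n ℕ.+ m))        ≈⟨ *-cong (term-neg n) (*-congˡ (^-homo-* Q n m)) ⟩
    neg n * (Q * (Q ^ n * Q ^ m))
      ≈⟨ solve 5 (λ x y a b t → t :* (x :* y :* (a :* b)) := x :* b :* (y :* a :* t)) refl x y _ _ _ ⟩
    x * Q ^ m * (y * Q ^ n * neg n)       ∎
  term-suc (suc j) i (suc n) m eq = term-suc j i n m (ℕP.suc-injective eq)

  partialProduct : ℕ → Carrier
  partialProduct zero    = 1#
  partialProduct (suc n) = partialProduct n * ((1# + x * Q ^ n) * (1# + y * Q ^ n))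

  -- One step raises the upper index by two. `gauss-sum-shift` recentres the sum and yields the
  -- factor with `y`; `gauss-sum-suc` keeps the centre and yields the factor with `x`.
  finite-triple-product : ∀ n → Σ< (suc (n ℕ.* 2)) (λ j → gauss (n ℕ.* 2) j * term j n) ≈ partialProduct n
  finite-triple-product zero    = trans (+-identityˡ _) (*-identityˡ 1#)
  finite-triple-product (suc n) = begin
    Σ< (suc (suc (suc N))) (λ j → gauss (suc (suc N)) j * term j (suc n))
      ≈⟨ gauss-sum-shift (suc N) (y * Q ^ n) (λ j → term j (suc n)) (λ j → term-shift j n) ⟩
    (1# + y * Q ^ n) * Σ< (suc (suc N)) (λ j → gauss (suc N) j * term j n)
      ≈⟨ *-congˡ (gauss-sum-suc N (x * Q ^ n) (λ j → term j n) (λ j i eq → term-suc j i n n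
           (≡.trans eq (≡.trans (ℕP.*-comm n 2) (≡.cong (n ℕ.+_) (ℕP.+-identityʳ n)))))) ⟩
    (1# + y * Q ^ n) * ((1# + x * Q ^ n) * Σ< (suc N) (λ j → gauss N j * term j n))
      ≈⟨ *-congˡ (*-congˡ (finite-triple-product n)) ⟩
    (1# + y * Q ^ n) * ((1# + x * Q ^ n) * partialProduct n)
      ≈⟨ solve 3 (λ a b c → a :* (b :* c) := c :* (b :* a)) refl _ _ _ ⟩
    partialProduct n * ((1# + x * Q ^ n) * (1# + y * Q ^ n)) ∎
    where N = n ℕ.* 2

-- q-adic limits, infinite sums and infinite products

module InfiniteProducts (K : CommutativeRing 0ℓ 0ℓ) where

  private module K = CommutativeRing K
  open SeriesRing K public
  open CommutativeRing seriesRing hiding (zero)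
  open import Algebra.Properties.Semiring.Exp semiring using (_^_; ^-homo-*) public
  open FiniteSums seriesRing
  open IntegerSolver seriesRing using (solve; _:=_; _:*_)

  prod : ℕ → (ℕ → Series) → Series
  prod zero    F = 1#
  prod (suc n) F = prod n F * F (suc n)

  ∏∞ : (ℕ → Series) → Series
  ∏∞ F n = prod n F n

  infix 4 _≈[_]_
  record _≈[_]_ (f : Series) (n : ℕ) (g : Series) : Set where
    constructor modulo
    field below : ∀ k → k < n → f k K.≈ g k
  open _≈[_]_ public

  ≈[]-refl : ∀ {n f} → f ≈[ n ] f
  ≈[]-refl = modulo λ _ _ → K.refl

  ≈[]-sym : ∀ {n f g} → f ≈[ n ] g → g ≈[ n ] f
  ≈[]-sym p = modulo λ k k<n → K.sym (below p k k<n)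

  ≈[]-trans : ∀ {n f g h} → f ≈[ n ] g → g ≈[ n ] h → f ≈[ n ] h
  ≈[]-trans p r = modulo λ k k<n → K.trans (below p k k<n) (below r k k<n)

  ≃⇒≈[] : ∀ {n f g} → f ≃ g → f ≈[ n ] g
  ≃⇒≈[] p = modulo λ k _ → at p k

  ≈[]-mono : ∀ {m n f g} → m ≤ n → f ≈[ n ] g → f ≈[ m ] g
  ≈[]-mono m≤n p = modulo λ k k<m → below p k (ℕP.≤-trans k<m m≤n)

  ≈[]-limit : ∀ {f g} → (∀ n → f ≈[ n ] g) → f ≃ g
  ≈[]-limit p = coeffwise λ n → below (p (suc n)) n ℕP.≤-refl

  opaque
    unfolding _✚_ _✶_ negS
    +-cong-≈[] : ∀ {n f f′ g g′} → f ≈[ n ] f′ → g ≈[ n ] g′ → f + g ≈[ n ] f′ + g′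
    +-cong-≈[] p r = modulo λ k k<n → K.+-cong (below p k k<n) (below r k k<n)

    *-cong-≈[] : ∀ {n f f′ g g′} → f ≈[ n ] f′ → g ≈[ n ] g′ → f * g ≈[ n ] f′ * g′
    *-cong-≈[] p r = modulo λ k k<n → Σ≤-cong≤ k λ i i≤k →
      K.*-cong (below p i (ℕP.≤-<-trans i≤k k<n)) (below r (k ∸ i) (ℕP.≤-<-trans (ℕP.m∸n≤m k i) k<n))

    -- Below q^(a+b), a coefficient of `f` at or beyond q^a only meets coefficients of `h` below
    -- q^b, which are zero. Hence `f` has to be known only modulo q^a.
    *-order : ∀ {a b n f g h} → f ≈[ a ] g → h ≈[ b ] 0# → n ≤ a ℕ.+ b → f * h ≈[ n ] g * h
    *-order {a} {b} {n} {f} {g} {h} p r n≤a+b = modulo λ k k<n → Σ≤-cong≤ k λ i i≤k → go k i i≤k k<n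
      where
      go : ∀ k i → i ≤ k → k < n → f i K.* h (k ∸ i) K.≈ g i K.* h (k ∸ i)
      go k i i≤k k<n with ℕP.<-≤-connex i a
      ... | inj₁ i<a = K.*-congʳ (below p i i<a)
      ... | inj₂ a≤i = K.trans (zero-tail (f i)) (K.sym (zero-tail (g i)))
        where
        k∸i<b : k ∸ i < b
        k∸i<b = ℕP.+-cancelˡ-< a (k ∸ i) b (ℕP.≤-<-trans (ℕP.+-monoˡ-≤ (k ∸ i) a≤i)
          (≡.subst (_< a ℕ.+ b) (≡.sym (ℕP.m+[n∸m]≡n i≤k)) (ℕP.<-≤-trans k<n n≤a+b)))
        zero-tail : ∀ c → c K.* h (k ∸ i) K.≈ K.0#
        zero-tail c = K.trans (K.*-congˡ (below r (k ∸ i) k∸i<b)) (K.zeroʳ c)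

  order-* : ∀ {a b n f h} → f ≈[ a ] 0# → h ≈[ b ] 0# → n ≤ a ℕ.+ b → f * h ≈[ n ] 0#
  order-* p r n≤ = ≈[]-trans (*-order p r n≤) (≃⇒≈[] (zeroˡ _))

  order-0 : ∀ {f g} → f ≈[ 0 ] g
  order-0 = modulo λ k ()

  order-q : q ≈[ 1 ] 0#
  order-q = modulo λ { zero _ → K.refl ; (suc _) (s≤s ()) }

  order-^ : ∀ {f} n → f ≈[ 1 ] 0# → f ^ n ≈[ n ] 0#
  order-^ zero    p = order-0
  order-^ (suc n) p = order-* p (order-^ n p) ℕP.≤-refl

  order-*ˡ : ∀ {n} f {h} → h ≈[ n ] 0# → f * h ≈[ n ] 0#
  order-*ˡ f r = order-* {f = f} order-0 r ℕP.≤-refl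

  -- The sum of a family of series is only meaningful when f k has order at least k.
  S : (ℕ → Series) → Series
  S f n = Σ< (suc n) f n

  Summable : (ℕ → Series) → Set
  Summable f = ∀ k → f k ≈[ k ] 0#

  opaque
    unfolding _✚_ _✶_ negS
    Σ<-at : ∀ n f k → Σ< n f k K.≈ FiniteSums.Σ< K n (λ i → f i k)
    Σ<-at zero    f k = K.refl
    Σ<-at (suc n) f k = K.+-congʳ (Σ<-at n f k)

    Σ<-stable : ∀ {f} → Summable f → ∀ n k → suc n ≤ k → Σ< k f n K.≈ S f n
    Σ<-stable {f} f-sum n k n<k with ℕP.m≤n⇒∃[o]m+o≡n n<k
    ... | i , ≡.refl = go i
      where
      go : ∀ i → Σ< (suc n ℕ.+ i) f n K.≈ S f n
      go zero    = K.reflexive (≡.cong (λ m → Σ< m f n) (ℕP.+-identityʳ (suc n)))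
      go (suc i) = K.trans (K.reflexive (≡.cong (λ m → Σ< m f n) (ℕP.+-suc (suc n) i)))
        (K.trans (K.+-cong (go i) (below (f-sum (suc n ℕ.+ i)) n (ℕP.m≤m+n (suc n) i))) (K.+-identityʳ _))

  Σ<≈S : ∀ {f} → Summable f → ∀ n k → n ≤ k → Σ< k f ≈[ n ] S f
  Σ<≈S f-sum n k n≤k = modulo λ i i<n → Σ<-stable f-sum i k (ℕP.≤-trans i<n n≤k)

  S-cong : ∀ {f g} → (∀ k → f k ≃ g k) → S f ≃ S g
  S-cong f≃g = coeffwise λ n → at (Σ<-cong (suc n) f≃g) n

  S-+ : ∀ {f g} → S (λ k → f k + g k) ≃ S f + S g
  S-+ {f} {g} = coeffwise λ n → K.trans (at (Σ<-+ (suc n) f g) n) (K.sym (split n))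
    where
    opaque
      unfolding _✚_
      split : ∀ n → (S f + S g) n K.≈ (Σ< (suc n) f + Σ< (suc n) g) n
      split n = K.refl

  S-*ˡ : ∀ a {f} → Summable f → S (λ k → a * f k) ≃ a * S f
  S-*ˡ a {f} f-sum = ≈[]-limit λ n →
    ≈[]-trans (≈[]-sym (Σ<≈S (λ k → order-*ˡ a (f-sum k)) n n ℕP.≤-refl))
    (≈[]-trans (≃⇒≈[] (Σ<-*ˡ n a f)) (*-cong-≈[] {f = a} ≈[]-refl (Σ<≈S f-sum n n ℕP.≤-refl)))

  S-blocks : ∀ m .{{_ : ℕ.NonZero m}} {f} → Summable f →
             S f ≃ S (λ i → Σ< m (λ s → f (i ℕ.* m ℕ.+ s)))
  S-blocks m {f} f-sum = coeffwise λ n → K.trans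
    (K.sym (Σ<-stable f-sum n (suc n ℕ.* m) (ℕP.m≤m*n (suc n) m)))
    (at (Σ<-blocks m (suc n) f) n)

  prod-cong : ∀ n {F G} → (∀ i → F (suc i) ≃ G (suc i)) → prod n F ≃ prod n G
  prod-cong zero    p = refl
  prod-cong (suc n) p = *-cong (prod-cong n p) (p n)

  prod-* : ∀ n F G → prod n (λ i → F i * G i) ≃ prod n F * prod n G
  prod-* zero    F G = sym (*-identityˡ 1#)
  prod-* (suc n) F G = trans (*-congʳ (prod-* n F G))
    (solve 4 (λ a b c d → (a :* b) :* (c :* d) := (a :* c) :* (b :* d)) refl _ _ _ _)

  prod-one : ∀ n → prod n (λ _ → 1#) ≃ 1#
  prod-one zero    = refl
  prod-one (suc n) = trans (*-identityʳ _) (prod-one n)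

  -- The multiplier `e` is lent to one factor at a time and handed back, so a replacement that is
  -- valid only after multiplication by `e` extends to products even when `e` is a zero divisor.
  prod-absorb : ∀ e n {F G} → (∀ i → e * F (suc i) ≃ e * G (suc i)) → e * prod n F ≃ e * prod n G
  prod-absorb e zero    p = refl
  prod-absorb e (suc n) {F} {G} p =
    trans (solve 3 (λ e a b → e :* (a :* b) := (e :* b) :* a) refl e (prod n F) (F (suc n)))
    (trans (*-congʳ (p n))
    (trans (solve 3 (λ e a b → (e :* b) :* a := (e :* a) :* b) refl e (prod n F) (G (suc n)))
    (trans (*-congʳ (prod-absorb e n p)) (*-assoc _ _ _))))

  -- The index `i + pred i` encodes 2i - 1, the odd numbers from 1 on.
  prod-pairs : ∀ n F → prod (n ℕ.* 2) F ≃
               prod n (λ i → F (i ℕ.+ pred i)) * prod n (λ i → F (i ℕ.* 2))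
  prod-pairs zero    F = sym (*-identityˡ 1#)
  prod-pairs (suc n) F = trans (*-congʳ (*-cong (prod-pairs n F) (reflexive (≡.cong F eq))))
    (solve 4 (λ a b c d → ((a :* b) :* c) :* d := (a :* c) :* (b :* d)) refl _ _ _ _)
    where
    eq : suc (n ℕ.* 2) ≡ suc (n ℕ.+ n)
    eq = ≡.cong suc (≡.trans (ℕP.*-comm n 2) (≡.cong (n ℕ.+_) (ℕP.+-identityʳ n)))

  Convergent : (ℕ → Series) → Set
  Convergent F = ∀ i → F (suc i) ≈[ suc i ] 1#

  -- The factors after the `k`-th are 1 modulo q^(k+1), so `k` factors already fix the coefficients
  -- up to q^k; this is why `n` may exceed `k` by one.
  prod≈∏∞ : ∀ {F} → Convergent F → ∀ n k → n ≤ suc k → prod k F ≈[ n ] ∏∞ F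
  prod≈∏∞ {F} F-conv n k n≤1+k = modulo λ i i<n → stable i k (ℕP.≤-pred (ℕP.≤-trans i<n n≤1+k))
    where
    step : ∀ k → prod (suc k) F ≈[ suc k ] prod k F
    step k = ≈[]-trans (*-cong-≈[] {f = prod k F} ≈[]-refl (F-conv k)) (≃⇒≈[] (*-identityʳ _))
    stable : ∀ i k → i ≤ k → prod k F i K.≈ ∏∞ F i
    stable i zero    z≤n = K.refl
    stable i (suc k) i≤k with ℕP.m≤n⇒m<n∨m≡n i≤k
    ... | inj₁ (s≤s i≤k′) = K.trans (below (step k) i (s≤s i≤k′)) (stable i k i≤k′)
    ... | inj₂ ≡.refl     = K.refl

  ∏∞-cong : ∀ {F G} → (∀ i → F (suc i) ≃ G (suc i)) → ∏∞ F ≃ ∏∞ G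
  ∏∞-cong p = coeffwise λ n → at (prod-cong n p) n

  Convergent-* : ∀ {F G} → Convergent F → Convergent G → Convergent (λ i → F i * G i)
  Convergent-* p r i = ≈[]-trans (*-cong-≈[] (p i) (r i)) (≃⇒≈[] (*-identityˡ 1#))

  ∏∞-* : ∀ {F G} → Convergent F → Convergent G → ∏∞ (λ i → F i * G i) ≃ ∏∞ F * ∏∞ G
  ∏∞-* {F} {G} p r = ≈[]-limit λ n →
    ≈[]-trans (≈[]-sym (prod≈∏∞ (Convergent-* {F} {G} p r) n n (ℕP.n≤1+n n)))
    (≈[]-trans (≃⇒≈[] (prod-* n F G))
    (*-cong-≈[] (prod≈∏∞ p n n (ℕP.n≤1+n n)) (prod≈∏∞ r n n (ℕP.n≤1+n n))))

  ∏∞-inverse : ∀ {F G} → Convergent F → Convergent G → (∀ i → F (suc i) * G (suc i) ≃ 1#) →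
               ∏∞ F * ∏∞ G ≃ 1#
  ∏∞-inverse p r FG≃1 = trans (sym (∏∞-* p r))
    (trans (∏∞-cong FG≃1) (coeffwise λ n → at (prod-one n) n))

  ∏∞-absorb : ∀ e {F G} → Convergent F → Convergent G → (∀ i → e * F (suc i) ≃ e * G (suc i)) →
              e * ∏∞ F ≃ e * ∏∞ G
  ∏∞-absorb e p r eq = ≈[]-limit λ n →
    ≈[]-trans (*-cong-≈[] {f = e} ≈[]-refl (≈[]-sym (prod≈∏∞ p n n (ℕP.n≤1+n n))))
    (≈[]-trans (≃⇒≈[] (prod-absorb e n eq))
    (*-cong-≈[] {f = e} ≈[]-refl (prod≈∏∞ r n n (ℕP.n≤1+n n))))

  Convergent-∘ : ∀ {F} (e : ℕ → ℕ) → (∀ i → suc i ≤ e (suc i)) → Convergent F → Convergent (λ i → F (e i))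
  Convergent-∘ {F} e le p i with e (suc i) | le i
  ... | suc j | le′ = ≈[]-mono le′ (p j)

  ∏∞-pairs : ∀ {F} → Convergent F →
             ∏∞ F ≃ ∏∞ (λ i → F (i ℕ.+ pred i)) * ∏∞ (λ i → F (i ℕ.* 2))
  ∏∞-pairs {F} p = ≈[]-limit λ n →
    ≈[]-trans (≈[]-sym (prod≈∏∞ p n (n ℕ.* 2) (ℕP.m≤n⇒m≤1+n (ℕP.m≤m*n n 2))))
    (≈[]-trans (≃⇒≈[] (prod-pairs n F))
    (*-cong-≈[] (prod≈∏∞ (Convergent-∘ {F} (λ i → i ℕ.+ pred i) (λ i → ℕP.m≤m+n (suc i) i) p) n n (ℕP.n≤1+n n))
                (prod≈∏∞ (Convergent-∘ {F} (λ i → i ℕ.* 2) (λ i → ℕP.m≤m*n (suc i) 2) p) n n (ℕP.n≤1+n n))))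

  module TripleProduct (x y : Series) (x-order : x ≈[ 1 ] 0#) where

    open FiniteTripleProduct seriesRing x y public

    Q-order : Q ≈[ 1 ] 0#
    Q-order = order-* {b = 0} x-order order-0 ℕP.≤-refl

    pos-summable : Summable pos
    pos-summable zero    = order-0
    pos-summable (suc k) = order-* (order-* {b = 0} x-order order-0 ℕP.≤-refl) (pos-summable k) ℕP.≤-refl

    -- `y` may have order 0, so the term of index -(k+1) takes its order from the factor `Q ^ k`.
    neg-summable : Summable (λ k → neg (suc k))
    neg-summable zero    = order-0
    neg-summable (suc k) = order-* {a = suc k} {b = 0}
      (order-*ˡ y (order-^ (suc k) Q-order)) order-0 (ℕP.≤-reflexive (ℕP.+-comm 0 (suc k)))

    term-pos : ∀ n k → term (n ℕ.+ k) n ≡ pos k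
    term-pos zero    k = ≡.refl
    term-pos (suc n) k = term-pos n k

    term-neg-suc : ∀ j l → term j (j ℕ.+ suc l) ≡ neg (suc l)
    term-neg-suc zero    l = ≡.refl
    term-neg-suc (suc j) l = term-neg-suc j l

    module Limit {E E⁻¹ Π : Series} (E-unit : E * E⁻¹ ≃ 1#)
                 (poch-limit : ∀ n → poch n ≈[ n ] E)
                 (product-limit : ∀ n → partialProduct n ≈[ n ] Π) where

      -- In `gauss-poch` all three Pochhammer products are `E` modulo q^n, so E² times the binomial
      -- is `E`; then `E⁻¹` cancels one factor.
      gauss-limit : ∀ n k i → n ≤ k → n ≤ i → E * gauss (k ℕ.+ i) k ≈[ n ] 1#
      gauss-limit n k i n≤k n≤i =
        ≈[]-trans (≃⇒≈[] insert)
        (≈[]-trans (*-cong-≈[] {f = E⁻¹} ≈[]-refl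
          (≈[]-trans (*-cong-≈[] {g = gauss (k ℕ.+ i) k}
            (*-cong-≈[] (limit k n≤k) (limit i n≤i)) ≈[]-refl)
          (≈[]-trans (≃⇒≈[] (gauss-poch i k)) (≈[]-sym (limit (k ℕ.+ i) (ℕP.≤-trans n≤k (ℕP.m≤m+n k i)))))))
        (≃⇒≈[] (trans (*-comm E⁻¹ E) E-unit)))
        where
        limit : ∀ k → n ≤ k → E ≈[ n ] poch k
        limit k n≤k = ≈[]-sym (≈[]-mono n≤k (poch-limit k))
        insert : E * gauss (k ℕ.+ i) k ≃ E⁻¹ * (E * E * gauss (k ℕ.+ i) k)
        insert = trans (sym (*-identityˡ _)) (trans (*-congʳ (sym E-unit))
          (solve 3 (λ e e′ g → e :* e′ :* (e :* g) := e′ :* (e :* e :* g)) refl E E⁻¹ _))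

      -- The finite identity at index `suc n` is multiplied by `E`, which normalises the Gaussian
      -- binomials to 1 in the limit. Its sum is cut at the centre; the lower part, reversed,
      -- carries the negative indices.
      triple-product : E * Π ≃ S pos + S (λ k → neg (suc k))
      triple-product = ≈[]-limit λ n →
        ≈[]-trans (*-cong-≈[] {f = E} ≈[]-refl (≈[]-sym (≈[]-mono (ℕP.n≤1+n n) (product-limit (suc n)))))
        (≈[]-trans (≃⇒≈[] (expand n))
        (≈[]-trans (+-cong-≈[] (Σ<-cong-≈[] (suc n) (left n)) (Σ<-cong-≈[] (suc (suc n)) (right n)))
        (≈[]-trans (+-cong-≈[] (Σ<≈S neg-summable n (suc n) (ℕP.n≤1+n n))
                               (Σ<≈S pos-summable n (suc (suc n)) (ℕP.m≤n⇒m≤1+n (ℕP.n≤1+n n))))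
        (≃⇒≈[] (+-comm _ _)))))
        where
        Σ<-cong-≈[] : ∀ {n} m {f g} → (∀ k → k < m → f k ≈[ n ] g k) → Σ< m f ≈[ n ] Σ< m g
        Σ<-cong-≈[] zero    p = ≈[]-refl
        Σ<-cong-≈[] (suc m) p = +-cong-≈[]
          (Σ<-cong-≈[] m (λ k k<m → p k (ℕP.m<n⇒m<1+n k<m))) (p m ℕP.≤-refl)

        N : ℕ → ℕ
        N n = suc n ℕ.* 2

        N≡ : ∀ n → N n ≡ suc n ℕ.+ suc n
        N≡ n = ≡.trans (ℕP.*-comm (suc n) 2) (≡.cong (suc n ℕ.+_) (ℕP.+-identityʳ (suc n)))

        summand : ℕ → ℕ → Series
        summand n j = E * (gauss (N n) j * term j (suc n))

        expand : ∀ n → E * partialProduct (suc n) ≃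
          Σ< (suc n) (λ k → summand n (n ∸ k)) + Σ< (suc (suc n)) (λ k → summand n (suc n ℕ.+ k))
        expand n = trans (*-congˡ (sym (finite-triple-product (suc n))))
          (trans (sym (Σ<-*ˡ (suc (N n)) E _))
          (trans (reflexive (≡.cong (λ m → Σ< m (summand n))
                   (≡.trans (≡.cong suc (N≡ n)) (≡.sym (ℕP.+-suc (suc n) (suc n))))))
          (trans (Σ<-++ (suc n) (suc (suc n)) (summand n))
          (+-congʳ (Σ<-reverse (suc n) (summand n))))))

        -- Towards the ends of the sum the normalised binomial is known only modulo q^(n-k), but
        -- there the theta term has order `k`; `*-order` adds the two bounds up to `n`.
        summand-limit : ∀ n k j i {t} → j ℕ.+ i ≡ N n → n ∸ k ≤ j → n ∸ k ≤ i →
                        term j (suc n) ≡ t → t ≈[ k ] 0# → summand n j ≈[ n ] t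
        summand-limit n k j i {t} j+i≡N ≤j ≤i ≡.refl t-order =
          ≈[]-trans (≃⇒≈[] (sym (*-assoc E (gauss (N n) j) t)))
          (≈[]-trans (*-order
            (≡.subst (λ m → E * gauss m j ≈[ n ∸ k ] 1#) j+i≡N (gauss-limit (n ∸ k) j i ≤j ≤i))
            t-order
            (ℕP.≤-trans (ℕP.m≤n+m∸n n k) (ℕP.≤-reflexive (ℕP.+-comm k (n ∸ k)))))
          (≃⇒≈[] (*-identityˡ t)))

        left : ∀ n k → k < suc n → summand n (n ∸ k) ≈[ n ] neg (suc k)
        left n k (s≤s k≤n) = summand-limit n k (n ∸ k) (suc k ℕ.+ suc n)
          (≡.trans (≡.sym (ℕP.+-assoc (n ∸ k) (suc k) (suc n)))
                   (≡.trans (≡.cong (ℕ._+ suc n) eq) (≡.sym (N≡ n))))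
          ℕP.≤-refl
          (ℕP.≤-trans (ℕP.m∸n≤m n k) (ℕP.≤-trans (ℕP.n≤1+n n) (ℕP.m≤n+m (suc n) (suc k))))
          (≡.subst (λ m → term (n ∸ k) m ≡ neg (suc k)) eq (term-neg-suc (n ∸ k) k))
          (neg-summable k)
          where
          eq : n ∸ k ℕ.+ suc k ≡ suc n
          eq = ≡.trans (ℕP.+-suc (n ∸ k) k) (≡.cong suc (ℕP.m∸n+n≡m k≤n))

        right : ∀ n k → k < suc (suc n) → summand n (suc n ℕ.+ k) ≈[ n ] pos k
        right n k (s≤s k≤1+n) = summand-limit n k (suc n ℕ.+ k) (suc n ∸ k)
          (≡.trans (ℕP.+-assoc (suc n) k (suc n ∸ k))
                   (≡.trans (≡.cong (suc n ℕ.+_) (ℕP.m+[n∸m]≡n k≤1+n)) (≡.sym (N≡ n))))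
          (ℕP.≤-trans (ℕP.m∸n≤m n k) (ℕP.≤-trans (ℕP.n≤1+n n) (ℕP.m≤m+n (suc n) k)))
          (ℕP.∸-monoˡ-≤ k (ℕP.n≤1+n n))
          (term-pos (suc n) k)
          (pos-summable k)

-- Euler products and theta series with monomial arguments

module ThetaSeries (K : CommutativeRing 0ℓ 0ℓ) where

  import Algebra.Properties.Semiring.Exp as Exponentiation

  private module K = CommutativeRing K
  private module KR = RingProperties K.ring
  open Exponentiation K.semiring using () renaming (_^_ to _^K_) public
  open InfiniteProducts K public
  open CommutativeRing seriesRing hiding (zero) public
  open FiniteSums seriesRing public
  open IntegerSolver seriesRing using (solve; _:=_; _:+_; _:*_; _:-_; :-_; con)
  open import Algebra.Properties.Semiring.Exp semiring using (^-assocʳ; ^-congʳ; ^-congˡ)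

  order-q^ : ∀ {k e} → k ≤ e → q ^ e ≈[ k ] 0#
  order-q^ k≤e = ≈[]-mono k≤e (order-^ _ order-q)

  inverse-1- : ∀ {x} → x ≈[ 1 ] 0# → (1# - x) * S (x ^_) ≃ 1#
  inverse-1- {x} x-order = trans (*-distribʳ-minus (S (x ^_)))
    (trans (+-congʳ head) (solve 1 (λ a → (con (+ 1) :+ a) :- a := con (+ 1)) refl (x * S (x ^_))))
    where
    *-distribʳ-minus : ∀ g → (1# - x) * g ≃ g - x * g
    *-distribʳ-minus g = solve 2 (λ x g → (con (+ 1) :- x) :* g := g :- x :* g) refl x g
    powers : Summable (x ^_)
    powers k = order-^ k x-order
    head : S (x ^_) ≃ 1# + x * S (x ^_)
    head = ≈[]-limit λ n →
      ≈[]-trans (≈[]-sym (Σ<≈S powers n (suc n) (ℕP.n≤1+n n)))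
      (≈[]-trans (≃⇒≈[] (trans (Σ<-head n (x ^_)) (+-congˡ (Σ<-*ˡ n x (x ^_)))))
      (+-cong-≈[] {f = 1#} ≈[]-refl (*-cong-≈[] {f = x} ≈[]-refl (Σ<≈S powers n n ℕP.≤-refl))))

  recip : Series → Series
  recip f = S ((1# - f) ^_)

  recip-inverse : ∀ {f} → f ≈[ 1 ] 1# → f * recip f ≃ 1#
  recip-inverse {f} p = trans
    (*-congʳ (solve 1 (λ f → f := con (+ 1) :- (con (+ 1) :- f)) refl f))
    (inverse-1- (≈[]-trans (+-cong-≈[] {f = 1#} ≈[]-refl neg-cong) (≃⇒≈[] (-‿inverseʳ 1#))))
    where
    neg-cong : - f ≈[ 1 ] - 1#
    neg-cong = ≈[]-trans (≃⇒≈[] (solve 1 (λ f → :- f := con -[1+ 0 ] :* f) refl f))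
      (≈[]-trans (*-cong-≈[] {f = - 1#} ≈[]-refl p) (≃⇒≈[] (*-identityʳ _)))

  -- A constant term 1 makes a series invertible even over a ring with zero divisors; this is how
  -- denominators are removed.
  cancel : ∀ {f} → f ≈[ 1 ] 1# → ∀ {g h} → g * f ≃ h * f → g ≃ h
  cancel {f} p {g} {h} eq = trans (expand g) (trans (*-congʳ eq) (sym (expand h)))
    where
    expand : ∀ g → g ≃ g * f * recip f
    expand g = trans (sym (*-identityʳ g))
      (trans (*-congˡ (sym (recip-inverse p))) (sym (*-assoc g f _)))

  lin : K.Carrier → ℕ → Series
  lin c e = 1# - C c * q ^ e

  lin-conv : ∀ c (e : ℕ → ℕ) → (∀ i → suc i ≤ e (suc i)) → Convergent (λ i → lin c (e i))
  lin-conv c e le i = ≈[]-trans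
    (≃⇒≈[] (solve 2 (λ c x → con (+ 1) :- c :* x := con (+ 1) :+ (:- c) :* x) refl (C c) (q ^ e (suc i))))
    (≈[]-trans (+-cong-≈[] {f = 1#} ≈[]-refl (order-*ˡ (- C c) (order-q^ (le i)))) (≃⇒≈[] (+-identityʳ 1#)))

  lin-≡ : ∀ c {d e} → d ≡ e → lin c d ≃ lin c e
  lin-≡ c ≡.refl = refl

  C-neg : ∀ a → C (K.- a) ≃ - C a
  C-neg a = C-negS a

  C1 : C K.1# ≃ 1#
  C1 = sym one≃C1

  -- In Pochhammer notation `η d c` is (c q^d; q^d)∞, and `o d c`, its part with odd indices, is (c
  -- q^d; q^(2d))∞.
  η : ℕ → K.Carrier → Series
  η d c = ∏∞ (λ i → lin c (d ℕ.* i))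

  o : ℕ → K.Carrier → Series
  o d c = ∏∞ (λ i → lin c (d ℕ.* (i ℕ.+ pred i)))

  η-conv : ∀ d .{{_ : NonZero d}} c → Convergent (λ i → lin c (d ℕ.* i))
  η-conv d c = lin-conv c (d ℕ.*_) (λ i → ℕP.m≤n*m (suc i) d)

  o-conv : ∀ d .{{_ : NonZero d}} c → Convergent (λ i → lin c (d ℕ.* (i ℕ.+ pred i)))
  o-conv d c = lin-conv c (λ i → d ℕ.* (i ℕ.+ pred i)) (λ i → ℕP.≤-trans (ℕP.m≤m+n (suc i) i) (ℕP.m≤n*m _ d))

  ∏∞-order : ∀ {F} → Convergent F → ∏∞ F ≈[ 1 ] 1#
  ∏∞-order F-conv = ≈[]-sym (prod≈∏∞ F-conv 1 0 ℕP.≤-refl)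

  η-order : ∀ d .{{_ : NonZero d}} c → η d c ≈[ 1 ] 1#
  η-order d c = ∏∞-order (η-conv d c)

  η-split : ∀ d .{{_ : NonZero d}} c → η d c ≃ o d c * η (d ℕ.* 2) c
  η-split d c = trans (∏∞-pairs (η-conv d c))
    (*-congˡ (∏∞-cong λ i → lin-≡ c (eq d (suc i))))
    where
    eq : ∀ d i → d ℕ.* (i ℕ.* 2) ≡ d ℕ.* 2 ℕ.* i
    eq = ℕSolver.solve-∀

  lin-square : ∀ e → lin K.1# e * lin (K.- K.1#) e ≃ lin K.1# (2 ℕ.* e)
  lin-square e = trans
    (*-cong (+-congˡ (-‿cong (*-congʳ C1)))
            (+-congˡ (-‿cong (*-congʳ (trans (C-neg K.1#) (-‿cong C1))))))
    (trans (solve 1 (λ x → (con (+ 1) :- con (+ 1) :* x) :* (con (+ 1) :- con -[1+ 0 ] :* x)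
               := con (+ 1) :- con (+ 1) :* (x :* x)) refl (q ^ e))
    (+-congˡ (-‿cong (*-cong (sym C1) (trans (sym (^-homo-* q e e))
      (^-congʳ q (≡.cong (e ℕ.+_) (≡.sym (ℕP.+-identityʳ e)))))))))

  η-square : ∀ d .{{_ : NonZero d}} → η d K.1# * η d (K.- K.1#) ≃ η (d ℕ.* 2) K.1#
  η-square d = trans (sym (∏∞-* (η-conv d K.1#) (η-conv d (K.- K.1#))))
    (∏∞-cong λ i → trans (lin-square (d ℕ.* suc i)) (lin-≡ K.1# (eq d (suc i))))
    where
    eq : ∀ d i → 2 ℕ.* (d ℕ.* i) ≡ d ℕ.* 2 ℕ.* i
    eq = ℕSolver.solve-∀

  -- Multiplied by (q^(2d); q^(2d))∞ both sides agree: `η-split` completes the odd product to `η d`,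
  -- and `η-square` leads back to (q^(2d); q^(2d))∞.
  euler : ∀ d .{{_ : NonZero d}} → o d K.1# * η d (K.- K.1#) ≃ 1#
  euler d = cancel (η-order (d ℕ.* 2) {{ℕP.m*n≢0 d 2}} K.1#) (trans
    (solve 3 (λ a b c → (a :* b) :* c := (a :* c) :* b) refl _ _ _)
    (trans (*-congʳ (sym (η-split d K.1#)))
    (trans (η-square d) (sym (*-identityˡ _)))))

  mono : K.Carrier → ℕ → Series
  mono c e = C c * q ^ e

  mono-cong : ∀ {a b d e} → a K.≈ b → d ≡ e → mono a d ≃ mono b e
  mono-cong p ≡.refl = *-congʳ (C-cong p)

  mono-* : ∀ a b d e → mono a d * mono b e ≃ mono (a K.* b) (d ℕ.+ e)
  mono-* a b d e = trans
    (solve 4 (λ a b x y → (a :* x) :* (b :* y) := (a :* b) :* (x :* y)) refl _ _ _ _)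
    (*-cong (sym (C-* a b)) (sym (^-homo-* q d e)))

  mono-1 : ∀ e → mono K.1# e ≃ q ^ e
  mono-1 e = trans (*-congʳ C1) (*-identityˡ _)

  mono-order : ∀ c {k e} → k ≤ e → mono c e ≈[ k ] 0#
  mono-order c k≤e = order-*ˡ (C c) (order-q^ k≤e)

  powerSum : (ℕ → ℕ) → Series
  powerSum e = S (λ i → q ^ e i)

  powerSum-cong : ∀ {d e} → (∀ i → d i ≡ e i) → powerSum d ≃ powerSum e
  powerSum-cong p = S-cong (λ i → reflexive (≡.cong (q ^_) (p i)))

  S-Σ< : ∀ m (f : ℕ → ℕ → Series) → S (λ i → Σ< m (λ s → f s i)) ≃ Σ< m (λ s → S (f s))
  S-Σ< zero    f = coeffwise λ n → at (Σ<-zero (suc n) {λ _ → 0#} (λ _ _ → refl)) n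
  S-Σ< (suc m) f = trans S-+ (+-congʳ (S-Σ< m f))

  -- This removes root-of-unity weights from a theta series: a periodic weight is constant on a
  -- residue class and leaves the inner sum.
  S-periodic : ∀ m .{{_ : NonZero m}} (w : ℕ → K.Carrier) (e : ℕ → ℕ) →
    (∀ i s → w (i ℕ.* m ℕ.+ s) K.≈ w s) → (∀ k → k ≤ e k) →
    S (λ k → mono (w k) (e k)) ≃ Σ< m (λ s → C (w s) * powerSum (λ i → e (i ℕ.* m ℕ.+ s)))
  S-periodic m w e periodic k≤e = trans (S-blocks m (λ k → mono-order (w k) (k≤e k)))
    (trans (S-cong (λ i → Σ<-cong m (λ s → mono-cong {d = e (i ℕ.* m ℕ.+ s)} (periodic i s) ≡.refl)))
    (trans (S-Σ< m _) (Σ<-cong m (λ s → S-*ˡ (C (w s)) (λ i → order-q^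
      (ℕP.≤-trans (ℕP.≤-trans (ℕP.m≤m*n i m) (ℕP.m≤m+n _ s)) (k≤e (i ℕ.* m ℕ.+ s))))))))

  ^K-periodic : ∀ {a} m → a ^K m K.≈ K.1# → ∀ i s → a ^K (i ℕ.* m ℕ.+ s) K.≈ a ^K s
  ^K-periodic {a} m p i s = K.trans (Exponentiation.^-homo-* K.semiring a (i ℕ.* m) s)
    (K.trans (K.*-congʳ (ones i)) (K.*-identityˡ _))
    where
    ones : ∀ i → a ^K (i ℕ.* m) K.≈ K.1#
    ones zero    = K.refl
    ones (suc i) = K.trans (Exponentiation.^-homo-* K.semiring a m (i ℕ.* m))
      (K.trans (K.*-cong p (ones i)) (K.*-identityˡ _))

  module Theta (c c′ : K.Carrier) (cc′≈1 : c K.* c′ K.≈ K.1#) (s t : ℕ) (1≤s : 1 ≤ s) where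

    d : ℕ
    d = s ℕ.+ t

    x y : Series
    x = mono (K.- c) s
    y = mono (K.- c′) t

    x-order : x ≈[ 1 ] 0#
    x-order = mono-order (K.- c) 1≤s

    open TripleProduct x y x-order

    Q≃ : Q ≃ q ^ d
    Q≃ = trans (mono-* _ _ s t) (trans (mono-cong {d = d} neg-neg ≡.refl) (mono-1 d))
      where
      neg-neg : (K.- c) K.* (K.- c′) K.≈ K.1#
      neg-neg = K.trans (K.sym (KR.-‿distribˡ-* c (K.- c′)))
        (K.trans (K.-‿cong (K.sym (KR.-‿distribʳ-* c c′)))
        (K.trans (KR.-‿involutive _) cc′≈1))

    Q^≃ : ∀ n → Q ^ n ≃ q ^ (d ℕ.* n)
    Q^≃ n = trans (^-congˡ n Q≃) (^-assocʳ q d n)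

    -- The closed forms are s k + d k(k-1)/2 and t k + d k(k-1)/2; the recursion follows `pos` and
    -- `neg` and avoids halving.
    posExp negExp : ℕ → ℕ
    posExp zero    = 0
    posExp (suc k) = s ℕ.+ d ℕ.* k ℕ.+ posExp k
    negExp zero    = 0
    negExp (suc k) = t ℕ.+ d ℕ.* k ℕ.+ negExp k

    private
      mono-Q : ∀ a e n → mono a e * Q ^ n ≃ mono a (e ℕ.+ d ℕ.* n)
      mono-Q a e n = trans (*-congˡ (Q^≃ n)) (trans (*-assoc _ _ _) (*-congˡ (sym (^-homo-* q e (d ℕ.* n)))))

      1+mono : ∀ a e → 1# + mono (K.- a) e ≃ lin a e
      1+mono a e = +-congˡ (trans (*-congʳ (C-neg a))
        (solve 2 (λ c x → (:- c) :* x := :- (c :* x)) refl (C a) (q ^ e)))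

    pos≃ : ∀ k → pos k ≃ mono ((K.- c) ^K k) (posExp k)
    pos≃ zero    = sym (mono-1 0)
    pos≃ (suc k) = trans (*-cong (mono-Q (K.- c) s k) (pos≃ k)) (mono-* _ _ (s ℕ.+ d ℕ.* k) (posExp k))

    neg≃ : ∀ k → neg k ≃ mono ((K.- c′) ^K k) (negExp k)
    neg≃ zero    = sym (mono-1 0)
    neg≃ (suc k) = trans (*-cong (mono-Q (K.- c′) t k) (neg≃ k)) (mono-* _ _ (t ℕ.+ d ℕ.* k) (negExp k))

    factor : ℕ → Series
    factor i = lin c (s ℕ.+ d ℕ.* pred i) * lin c′ (t ℕ.+ d ℕ.* pred i)

    partialProduct≃ : ∀ n → partialProduct n ≃ prod n factor
    partialProduct≃ zero    = refl
    partialProduct≃ (suc n) = *-cong (partialProduct≃ n)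
      (*-cong (trans (+-congˡ (mono-Q _ s n)) (1+mono c (s ℕ.+ d ℕ.* n)))
              (trans (+-congˡ (mono-Q _ t n)) (1+mono c′ (t ℕ.+ d ℕ.* n))))

    instance
      d≢0 : NonZero d
      d≢0 = ℕ.>-nonZero (ℕP.≤-trans 1≤s (ℕP.m≤m+n s t))

    poch-limit : ∀ n → poch n ≈[ n ] η d K.1#
    poch-limit n = ≈[]-trans (≃⇒≈[] (poch≃ n)) (prod≈∏∞ (η-conv d K.1#) n n (ℕP.n≤1+n n))
      where
      poch≃ : ∀ n → poch n ≃ prod n (λ i → lin K.1# (d ℕ.* i))
      poch≃ zero    = refl
      poch≃ (suc n) = *-cong (poch≃ n)
        (+-congˡ (-‿cong (trans (Q^≃ (suc n)) (sym (mono-1 (d ℕ.* suc n))))))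

    -- The limit `Π` is a parameter because the progressions s and t modulo d merge differently in
    -- each application: into a square, into the odd numbers, or with a constant factor in front.
    theta : ∀ {Π} → (∀ n → prod n factor ≈[ n ] Π) →
      η d K.1# * Π ≃ S (λ k → mono ((K.- c) ^K k) (posExp k))
                   + S (λ k → mono ((K.- c′) ^K suc k) (negExp (suc k)))
    theta limit = trans
      (Limit.triple-product (recip-inverse (η-order d K.1#)) poch-limit
        (λ n → ≈[]-trans (≃⇒≈[] (partialProduct≃ n)) (limit n)))
      (+-cong (S-cong pos≃) (S-cong (λ k → neg≃ (suc k))))

-- The theta series of φ, of ψ and of a root of unity, with their dissections

module EulerProducts (K : CommutativeRing 0ℓ 0ℓ) where

  private module K = CommutativeRing K
  private module KR = RingProperties K.ring
  private module KS = IntegerSolver K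
  open ThetaSeries K public
  open IntegerSolver seriesRing using (solve; _:=_; _:+_; _:*_; _:-_; :-_; con)

  -1K : K.Carrier
  -1K = K.- K.1#

  C-1 : C -1K ≃ - 1#
  C-1 = trans (C-neg K.1#) (-‿cong C1)

  square : ℕ → ℕ
  square k = k ℕ.* k

  tri : ℕ → ℕ
  tri zero    = 0
  tri (suc n) = suc n ℕ.+ tri n

  n≤tri : ∀ n → n ≤ tri n
  n≤tri zero    = z≤n
  n≤tri (suc n) = ℕP.m≤m+n (suc n) (tri n)

  n≤square : ∀ n → n ≤ square n
  n≤square zero    = z≤n
  n≤square (suc n) = ℕP.m≤m*n (suc n) (suc n)

  -- Gauss's theta function φ(-q^d), the sum of (-1)^n q^(d n²) over all integers n, with n ≥ 0 and
  -- n < 0 kept apart.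
  φ : ℕ → Series
  φ d = S (λ k → mono (-1K ^K k) (d ℕ.* square k)) + S (λ k → mono (-1K ^K suc k) (d ℕ.* square (suc k)))

  -- The triple product with both arguments q^d and base q^(2d) gives the square of `o d` times
  -- `η (2d)`; one `o d` joins `η (2d)` to form `η d`.
  φ-product : ∀ d .{{_ : NonZero d}} → o d K.1# * η d K.1# ≃ φ d
  φ-product d@(suc d-1) = trans (trans (*-congˡ (η-split d K.1#))
      (trans (solve 2 (λ o h → o :* (o :* h) := h :* (o :* o)) refl (o d K.1#) (η (d ℕ.* 2) K.1#))
      (*-congʳ (reflexive (≡.cong (λ m → η m K.1#) (eq₁ d))))))
    (trans (T.theta limit) (+-cong
      (S-cong (λ k → mono-cong {e = d ℕ.* square k} K.refl (exp k)))
      (S-cong (λ k → mono-cong {e = d ℕ.* square (suc k)} K.refl (≡.trans (neg-exp (suc k)) (exp (suc k)))))))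
    where
    module T = Theta K.1# K.1# (K.*-identityˡ K.1#) d d (s≤s z≤n)
    eq₁ : ∀ d → d ℕ.* 2 ≡ d ℕ.+ d
    eq₁ = ℕSolver.solve-∀
    eq₂ : ∀ d k → d ℕ.+ (d ℕ.+ d) ℕ.* k ℕ.+ d ℕ.* (k ℕ.* k) ≡ d ℕ.* ((1 ℕ.+ k) ℕ.* (1 ℕ.+ k))
    eq₂ = ℕSolver.solve-∀
    exp : ∀ k → T.posExp k ≡ d ℕ.* square k
    exp zero    = ≡.sym (ℕP.*-zeroʳ d)
    exp (suc k) = ≡.trans (≡.cong (d ℕ.+ (d ℕ.+ d) ℕ.* k ℕ.+_) (exp k)) (eq₂ d k)
    neg-exp : ∀ k → T.negExp k ≡ T.posExp k
    neg-exp zero    = ≡.refl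
    neg-exp (suc k) = ≡.cong (d ℕ.+ (d ℕ.+ d) ℕ.* k ℕ.+_) (neg-exp k)
    eq₃ : ∀ d i → d ℕ.+ (d ℕ.+ d) ℕ.* i ≡ d ℕ.* (1 ℕ.+ i ℕ.+ i)
    eq₃ = ℕSolver.solve-∀
    limit : ∀ n → prod n T.factor ≈[ n ] o d K.1# * o d K.1#
    limit n = ≈[]-trans
      (≃⇒≈[] (trans (prod-cong n {G = λ i → F i * F i} (λ i → *-cong (lin-≡ K.1# (eq₃ d i)) (lin-≡ K.1# (eq₃ d i))))
                    (prod-* n F F)))
      (*-cong-≈[] conv conv)
      where
      F : ℕ → Series
      F i = lin K.1# (d ℕ.* (i ℕ.+ pred i))
      conv : prod n F ≈[ n ] o d K.1#
      conv = prod≈∏∞ (o-conv d K.1#) n n (ℕP.n≤1+n n)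

  module Triangular where
    U : ℕ → Series
    U s = powerSum (λ i → tri (i ℕ.* 8 ℕ.+ s))

    private
      double : ∀ k → 4 ℕ.* k ℕ.+ 3 ℕ.+ tri (k ℕ.* 2) ≡ tri (suc k ℕ.* 2)
      double k = lemma (k ℕ.* 2) (tri (k ℕ.* 2)) (≡.sym (ℕP.*-comm k 2))
        where
        lemma : ∀ m t → 2 ℕ.* k ≡ m → 4 ℕ.* k ℕ.+ 3 ℕ.+ t ≡ suc (suc m) ℕ.+ (suc m ℕ.+ t)
        lemma _ t ≡.refl = eq k t
          where
          eq : ∀ k t → 4 ℕ.* k ℕ.+ 3 ℕ.+ t ≡ 2 ℕ.+ 2 ℕ.* k ℕ.+ (1 ℕ.+ 2 ℕ.* k ℕ.+ t)
          eq = ℕSolver.solve-∀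

      double-odd : ∀ k → 1 ℕ.+ 4 ℕ.* suc k ℕ.+ tri (suc (k ℕ.* 2)) ≡ tri (suc (suc k ℕ.* 2))
      double-odd k = lemma (k ℕ.* 2) (tri (suc (k ℕ.* 2))) (≡.sym (ℕP.*-comm k 2))
        where
        lemma : ∀ m t → 2 ℕ.* k ≡ m → 1 ℕ.+ 4 ℕ.* suc k ℕ.+ t ≡ suc (suc (suc m)) ℕ.+ (suc (suc m) ℕ.+ t)
        lemma _ t ≡.refl = eq k t
          where
          eq : ∀ k t → 1 ℕ.+ 4 ℕ.* (1 ℕ.+ k) ℕ.+ t ≡ 3 ℕ.+ 2 ℕ.* k ℕ.+ (2 ℕ.+ 2 ℕ.* k ℕ.+ t)
          eq = ℕSolver.solve-∀

    -- For s = 3 and t = 1 the exponents 3 and 1 modulo 4 merge into the odd numbers, and the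
    -- indices k and -(k+1) carry T(2k) and T(2k+1). The weights have period 2, but k is split
    -- modulo 4 so as to reach the residues of j modulo 8.
    ψ-product : ∀ ε → ε K.* ε K.≈ K.1# →
      o 1 ε * η 4 K.1# ≃ (U 0 + U 7) - C ε * (U 1 + U 6) - C ε * (U 2 + U 5) + (U 3 + U 4)
    ψ-product ε ε²≈1 = trans (*-comm _ _) (trans (T.theta limit)
      (trans (+-cong pos-part neg-part)
      (trans (+-cong
         (+-cong (+-cong (+-cong (+-cong refl (*-congʳ Cw0)) (*-congʳ Cw1)) (*-congʳ Cw2)) (*-congʳ Cw3))
         (+-cong (+-cong (+-cong (+-cong refl (*-congʳ Cw1)) (*-congʳ Cw2)) (*-congʳ Cw3)) (*-congʳ Cw4)))
       (solve 9 (λ e u0 u1 u2 u3 u4 u5 u6 u7 →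
          con (+ 0) :+ con (+ 1) :* u0 :+ (:- e) :* u2 :+ con (+ 1) :* u4 :+ (:- e) :* u6
          :+ (con (+ 0) :+ (:- e) :* u1 :+ con (+ 1) :* u3 :+ (:- e) :* u5 :+ con (+ 1) :* u7)
          := (u0 :+ u7) :- e :* (u1 :+ u6) :- e :* (u2 :+ u5) :+ (u3 :+ u4)) refl
          (C ε) (U 0) (U 1) (U 2) (U 3) (U 4) (U 5) (U 6) (U 7)))))
      where
      module T = Theta ε ε ε²≈1 3 1 (s≤s z≤n)
      w : ℕ → K.Carrier
      w k = (K.- ε) ^K k
      w2 : w 2 K.≈ K.1#
      w2 = K.trans (KS.solve 1 (λ e → (KS.:- e) KS.:* ((KS.:- e) KS.:* KS.con (+ 1)) KS.:= e KS.:* e) K.refl ε) ε²≈1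
      w3 : w 3 K.≈ K.- ε
      w3 = K.trans (K.*-congˡ w2) (K.*-identityʳ _)
      w4 : w 4 K.≈ K.1#
      w4 = K.trans (K.*-congˡ w3) (K.trans (K.*-congˡ (K.sym (K.*-identityʳ _))) w2)
      Cw0 : C (w 0) ≃ 1#
      Cw0 = C1
      Cw1 : C (w 1) ≃ - C ε
      Cw1 = trans (C-cong (K.*-identityʳ _)) (C-neg ε)
      Cw2 : C (w 2) ≃ 1#
      Cw2 = trans (C-cong w2) C1
      Cw3 : C (w 3) ≃ - C ε
      Cw3 = trans (C-cong w3) (C-neg ε)
      Cw4 : C (w 4) ≃ 1#
      Cw4 = trans (C-cong w4) C1
      pos-exp : ∀ k → T.posExp k ≡ tri (k ℕ.* 2)
      pos-exp zero    = ≡.refl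
      pos-exp (suc k) = ≡.trans (≡.cong₂ ℕ._+_ (ℕP.+-comm 3 (4 ℕ.* k)) (pos-exp k)) (double k)
      neg-exp : ∀ k → T.negExp (suc k) ≡ tri (suc (k ℕ.* 2))
      neg-exp zero    = ≡.refl
      neg-exp (suc k) = ≡.trans (≡.cong (1 ℕ.+ 4 ℕ.* suc k ℕ.+_) (neg-exp k)) (double-odd k)
      index : ∀ i s → (i ℕ.* 4 ℕ.+ s) ℕ.* 2 ≡ i ℕ.* 8 ℕ.+ s ℕ.* 2
      index = ℕSolver.solve-∀
      U≃ : ∀ {f : ℕ → ℕ} s → (∀ i → f i ≡ i ℕ.* 8 ℕ.+ s) → powerSum (λ i → tri (f i)) ≃ U s
      U≃ s f≡ = powerSum-cong (λ i → ≡.cong tri (f≡ i))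
      pos-part : S (λ k → mono (w k) (T.posExp k)) ≃
                 0# + C (w 0) * U 0 + C (w 1) * U 2 + C (w 2) * U 4 + C (w 3) * U 6
      pos-part = trans (S-cong (λ k → mono-cong {e = tri (k ℕ.* 2)} K.refl (pos-exp k)))
        (trans (S-periodic 4 w (λ k → tri (k ℕ.* 2)) (^K-periodic 4 w4)
                 (λ k → ℕP.≤-trans (ℕP.m≤m*n k 2) (n≤tri _)))
        (+-cong (+-cong (+-cong (+-cong refl (*-congˡ (U≃ 0 λ i → index i 0)))
          (*-congˡ (U≃ 2 λ i → index i 1))) (*-congˡ (U≃ 4 λ i → index i 2))) (*-congˡ (U≃ 6 λ i → index i 3))))
      index-odd : ∀ i s → suc ((i ℕ.* 4 ℕ.+ s) ℕ.* 2) ≡ i ℕ.* 8 ℕ.+ suc (s ℕ.* 2)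
      index-odd i s = ≡.trans (≡.cong suc (index i s)) (≡.sym (ℕP.+-suc (i ℕ.* 8) (s ℕ.* 2)))
      neg-part : S (λ k → mono (w (suc k)) (T.negExp (suc k))) ≃
                 0# + C (w 1) * U 1 + C (w 2) * U 3 + C (w 3) * U 5 + C (w 4) * U 7
      neg-part = trans (S-cong (λ k → mono-cong {e = tri (suc (k ℕ.* 2))} K.refl (neg-exp k)))
        (trans (S-periodic 4 (λ k → w (suc k)) (λ k → tri (suc (k ℕ.* 2)))
                 (λ i s → K.*-congˡ (^K-periodic 4 w4 i s))
                 (λ k → ℕP.≤-trans (ℕP.m≤m*n k 2) (ℕP.≤-trans (ℕP.n≤1+n _) (n≤tri _))))
        (+-cong (+-cong (+-cong (+-cong refl (*-congˡ (U≃ 1 λ i → index-odd i 0)))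
          (*-congˡ (U≃ 3 λ i → index-odd i 1))) (*-congˡ (U≃ 5 λ i → index-odd i 2))) (*-congˡ (U≃ 7 λ i → index-odd i 3))))
      Fo : ℕ → Series
      Fo i = lin ε (1 ℕ.* (i ℕ.+ pred i))
      odd even : ℕ → Series
      odd i = Fo (i ℕ.+ pred i)
      even i = Fo (i ℕ.* 2)
      eq-even : ∀ i → 3 ℕ.+ 4 ℕ.* i ≡ 1 ℕ.* (suc i ℕ.* 2 ℕ.+ pred (suc i ℕ.* 2))
      eq-even i = eq i
        where
        eq : ∀ i → 3 ℕ.+ 4 ℕ.* i ≡ 1 ℕ.* (2 ℕ.+ i ℕ.* 2 ℕ.+ (1 ℕ.+ i ℕ.* 2))
        eq = ℕSolver.solve-∀
      eq-odd : ∀ i → 1 ℕ.+ 4 ℕ.* i ≡ 1 ℕ.* (suc i ℕ.+ i ℕ.+ pred (suc i ℕ.+ i))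
      eq-odd i = eq i
        where
        eq : ∀ i → 1 ℕ.+ 4 ℕ.* i ≡ 1 ℕ.* (1 ℕ.+ i ℕ.+ i ℕ.+ (i ℕ.+ i))
        eq = ℕSolver.solve-∀
      limit : ∀ n → prod n T.factor ≈[ n ] o 1 ε
      limit n = ≈[]-trans (≃⇒≈[] (trans
        (prod-cong n {G = λ i → even i * odd i} (λ i → *-cong (lin-≡ ε (eq-even i)) (lin-≡ ε (eq-odd i))))
        (trans (prod-* n even odd) (trans (*-comm _ _) (sym (prod-pairs n Fo))))))
        (prod≈∏∞ (o-conv 1 ε) n (n ℕ.* 2) (ℕP.m≤n⇒m≤1+n (ℕP.m≤m*n n 2)))

    -- For s = 1 and t = 0 the indices k and -(k+1) carry the same exponent T(k), so their weights
    -- add. The second progression starts at exponent 0, which is the source of the factor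
    -- `1# - C c′`.
    tri-product : ∀ c c′ → c K.* c′ K.≈ K.1# → c ^K 8 K.≈ K.1# → c′ ^K 8 K.≈ K.1# →
      (1# - C c′) * (η 1 c * η 1 c′ * η 1 K.1#) ≃
      Σ< 8 (λ s → C ((K.- c) ^K s K.+ (K.- c′) ^K suc s) * U s)
    tri-product c c′ cc′≈1 c⁸≈1 c′⁸≈1 = trans
      (solve 4 (λ u a b e → u :* (a :* b :* e) := e :* (a :* (u :* b))) refl _ _ _ _)
      (trans (T.theta limit)
      (trans (+-cong
        (trans (S-cong (λ k → mono-cong {e = tri k} K.refl (pos-exp k)))
               (S-periodic 8 (λ k → (K.- c) ^K k) tri (^K-periodic 8 (neg-8 c⁸≈1)) n≤tri))
        (trans (S-cong (λ k → mono-cong {e = tri k} K.refl (neg-exp k)))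
               (S-periodic 8 (λ k → (K.- c′) ^K suc k) tri
                 (λ i s → K.*-congˡ (^K-periodic 8 (neg-8 c′⁸≈1) i s)) n≤tri)))
      (trans (sym (Σ<-+ 8 (λ s → C (w s) * U s) (λ s → C (w′ s) * U s)))
             (Σ<-cong 8 (λ s → trans (sym (distribʳ (U s) (C (w s)) (C (w′ s)))) (*-congʳ (sym (C-+ (w s) (w′ s)))))))))
      where
      module T = Theta c c′ cc′≈1 1 0 (s≤s z≤n)
      w w′ : ℕ → K.Carrier
      w s  = (K.- c) ^K s
      w′ s = (K.- c′) ^K suc s
      neg-8 : ∀ {a} → a ^K 8 K.≈ K.1# → (K.- a) ^K 8 K.≈ K.1#
      neg-8 {a} = K.trans (KS.solve 1 (λ a → (KS.:- a) KS.:^ 8 KS.:= a KS.:^ 8) K.refl a)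
      pos-exp : ∀ k → T.posExp k ≡ tri k
      pos-exp zero    = ≡.refl
      pos-exp (suc k) = ≡.cong₂ ℕ._+_ (≡.cong suc (ℕP.*-identityˡ k)) (pos-exp k)
      neg-exp : ∀ k → T.negExp (suc k) ≡ tri k
      neg-exp zero    = ≡.refl
      neg-exp (suc k) = ≡.cong₂ ℕ._+_ (ℕP.*-identityˡ (suc k)) (neg-exp k)
      F G : ℕ → Series
      F i = lin c (1 ℕ.* i)
      G i = lin c′ (1 ℕ.* i)
      -- The factors of `c′` have exponents 0, 1, 2, ..., one behind those of `c`: the first is a
      -- constant, and only `n` others stand beside the `suc n` factors of `c`.
      product : ∀ n → prod (suc n) T.factor ≃ prod (suc n) F * ((1# - C c′) * prod n G)
      product zero    = trans (*-identityˡ _) (*-cong (sym (*-identityˡ _))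
        (trans (+-congˡ (-‿cong (*-identityʳ _))) (sym (*-identityʳ _))))
      product (suc n) = trans (*-congʳ (product n))
        (solve 5 (λ f u g a b → (f :* (u :* g)) :* (a :* b) := (f :* a) :* (u :* (g :* b))) refl _ _ _ _ _)
      limit : ∀ n → prod n T.factor ≈[ n ] η 1 c * ((1# - C c′) * η 1 c′)
      limit zero    = order-0
      limit (suc n) = ≈[]-trans (≃⇒≈[] (product n))
        (*-cong-≈[] (prod≈∏∞ (η-conv 1 c) (suc n) (suc n) (ℕP.n≤1+n _))
          (*-cong-≈[] {f = 1# - C c′} ≈[]-refl (prod≈∏∞ (η-conv 1 c′) (suc n) n ℕP.≤-refl)))

  -- `squares-even⁺` starts at 2 because it collects the negative even n, while 0 is counted in
  -- `squares-even`. For odd n both signs give the same series.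
  squares-even squares-even⁺ squares-odd : Series
  squares-even  = powerSum (λ i → square (i ℕ.* 2))
  squares-even⁺ = powerSum (λ i → square (suc (suc (i ℕ.* 2))))
  squares-odd   = powerSum (λ i → square (suc (i ℕ.* 2)))

  φ-dissection : φ 1 ≃ (squares-even + squares-even⁺) - (squares-odd + squares-odd)
  φ-dissection = trans (+-cong first second)
    (trans (+-cong (+-cong (+-congˡ (*-congʳ C1)) (*-congʳ Cw1)) (+-cong (+-congˡ (*-congʳ Cw1)) (*-congʳ Cw2)))
    (solve 3 (λ a b c → con (+ 0) :+ con (+ 1) :* a :+ con -[1+ 0 ] :* c
       :+ (con (+ 0) :+ con -[1+ 0 ] :* c :+ con (+ 1) :* b) := (a :+ b) :- (c :+ c)) refl _ _ _))
    where
    w : ℕ → K.Carrier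
    w k = -1K ^K k
    w2 : w 2 K.≈ K.1#
    w2 = KS.solve 0 (KS.con -[1+ 0 ] KS.:* (KS.con -[1+ 0 ] KS.:* KS.con (+ 1)) KS.:= KS.con (+ 1)) K.refl
    Cw1 : C (w 1) ≃ - 1#
    Cw1 = trans (C-cong (K.*-identityʳ _)) C-1
    Cw2 : C (w 2) ≃ 1#
    Cw2 = trans (C-cong w2) C1
    sq-cong : ∀ {d e : ℕ → ℕ} → (∀ i → d i ≡ e i) → powerSum (λ i → 1 ℕ.* square (d i)) ≃ powerSum (λ i → square (e i))
    sq-cong p = powerSum-cong (λ i → ≡.trans (ℕP.*-identityˡ _) (≡.cong square (p i)))
    +1 : ∀ i → i ℕ.* 2 ℕ.+ 1 ≡ suc (i ℕ.* 2)
    +1 i = ℕP.+-comm (i ℕ.* 2) 1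
    first : S (λ k → mono (w k) (1 ℕ.* square k)) ≃ 0# + C (w 0) * squares-even + C (w 1) * squares-odd
    first = trans (S-periodic 2 w (λ k → 1 ℕ.* square k) (^K-periodic 2 w2)
              (λ k → ℕP.≤-trans (n≤square k) (ℕP.≤-reflexive (≡.sym (ℕP.*-identityˡ _)))))
      (+-cong (+-congˡ (*-congˡ (sq-cong (λ i → ℕP.+-identityʳ (i ℕ.* 2))))) (*-congˡ (sq-cong +1)))
    second : S (λ k → mono (w (suc k)) (1 ℕ.* square (suc k))) ≃ 0# + C (w 1) * squares-odd + C (w 2) * squares-even⁺
    second = trans (S-periodic 2 (λ k → w (suc k)) (λ k → 1 ℕ.* square (suc k))
              (λ i s → K.*-congˡ (^K-periodic 2 w2 i s))
              (λ k → ℕP.≤-trans (ℕP.n≤1+n k) (ℕP.≤-trans (n≤square (suc k)) (ℕP.≤-reflexive (≡.sym (ℕP.*-identityˡ _))))))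
      (+-cong (+-congˡ (*-congˡ (sq-cong (λ i → ≡.cong suc (ℕP.+-identityʳ (i ℕ.* 2)))))) (*-congˡ (sq-cong (λ i → ≡.cong suc (+1 i)))))

-- The crank generating function split over the factors of z⁸ - 1

module CrankSplitting (K : CommutativeRing 0ℓ 0ℓ) where

  private module K = CommutativeRing K
  private module KS = IntegerSolver K
  open EulerProducts K public
  open Triangular public
  open IntegerSolver seriesRing using (solve; _:=_; _:+_; _:*_; _:-_; :-_; con)

  2K 8K : K.Carrier
  2K = K.1# K.+ K.1#
  8K = (2K K.+ 2K) K.+ (2K K.+ 2K)

  -- Dividing (-c)^s + (-c⁻¹)^(s+1) by 1 - c⁻¹ gives (-1)^s times the sum of c^i over -s ≤ i ≤ s.
  -- The table is `e` times this, reduced by c = z³, z⁴ = -1 and t = z + z⁻¹, so that c + c⁻¹ = -t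
  -- and t² = 2.
  thetaWeight : (e t : K.Carrier) → ℕ → K.Carrier
  thetaWeight e t 0 = e
  thetaWeight e t 1 = e K.* (t K.- K.1#)
  thetaWeight e t 2 = e K.* (K.1# K.- t)
  thetaWeight e t 3 = K.- e
  thetaWeight e t 4 = K.- e
  thetaWeight e t 5 = e K.* (K.1# K.- t)
  thetaWeight e t 6 = e K.* (t K.- K.1#)
  thetaWeight e t _ = e

  -- N, e₁, e₂ and e₃ are eight times the idempotents of ℚ[z]/(z⁸ - 1) that
  -- belong to the factors z - 1, z + 1, z² + 1 and z⁴ + 1 of z⁸ - 1, and κ stands
  -- for e₃ / (1 - c⁻¹), where 1 - c⁻¹ is a zero divisor.
  record Splitting : Set where
    field
      z z⁻¹ c c⁻¹ N e₁ e₂ e₃ κ : K.Carrier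
      total     : (N K.+ e₁) K.+ (e₂ K.+ e₃) K.≈ 8K
      z-inverse : z K.* z⁻¹ K.≈ K.1#
      c-inverse : c K.* c⁻¹ K.≈ K.1#
      c⁸≈1      : c ^K 8 K.≈ K.1#
      c⁻⁸≈1     : c⁻¹ ^K 8 K.≈ K.1#
      Nz        : N K.* z K.≈ N
      Nz⁻¹      : N K.* z⁻¹ K.≈ N
      e₁z       : e₁ K.* z K.≈ K.- e₁
      e₁z⁻¹     : e₁ K.* z⁻¹ K.≈ K.- e₁
      e₂-sum    : e₂ K.* (z K.+ z⁻¹) K.≈ K.0#
      e₃-sum    : e₃ K.* ((z K.+ z⁻¹) K.+ (c K.+ c⁻¹)) K.≈ K.0#
      e₃-prod   : e₃ K.* ((z K.+ z⁻¹) K.* (c K.+ c⁻¹) K.+ 2K) K.≈ K.0#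
      κ-factor  : κ K.* (K.1# K.- c⁻¹) K.≈ e₃
      κ-weight  : ∀ s → s < 8 →
                  κ K.* ((K.- c) ^K s K.+ (K.- c⁻¹) ^K suc s) K.≈ thetaWeight e₃ (z K.+ z⁻¹) s

  -- `ψ⁻` and `ψ⁺` are ψ(-q) and ψ(q), as T(j) is odd exactly for j ≡ 1, 2, 5, 6 modulo 8. X + tY is
  -- the sum of the `U s` with the weights of `thetaWeight` for e = 1.
  ψ⁻ ψ⁺ X Y : Series
  ψ⁻ = (U 0 + U 7) - (U 1 + U 6) - (U 2 + U 5) + (U 3 + U 4)
  ψ⁺ = (U 0 + U 7) + (U 1 + U 6) + (U 2 + U 5) + (U 3 + U 4)
  X  = (U 0 + U 7) - (U 1 + U 6) + (U 2 + U 5) - (U 3 + U 4)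
  Y  = (U 1 + U 6) - (U 2 + U 5)

  ψ⁻-product : o 1 K.1# * η 4 K.1# ≃ ψ⁻
  ψ⁻-product = trans (ψ-product K.1# (K.*-identityˡ _))
    (+-congʳ (+-cong (+-congˡ (-‿cong (1* _))) (-‿cong (1* _))))
    where
    1* : ∀ f → C K.1# * f ≃ f
    1* f = trans (*-congʳ C1) (*-identityˡ f)

  ψ⁺-product : o 1 -1K * η 4 K.1# ≃ ψ⁺
  ψ⁺-product = trans
    (ψ-product -1K (KS.solve 0 (KS.con -[1+ 0 ] KS.:* KS.con -[1+ 0 ] KS.:= KS.con (+ 1)) K.refl))
    (+-congʳ (+-cong (+-congˡ (minus _)) (minus _)))
    where
    minus : ∀ f → - (C -1K * f) ≃ f
    minus f = trans (-‿cong (*-congʳ C-1)) (solve 1 (λ f → :- (con -[1+ 0 ] :* f) := f) refl f)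

  o-square : o 1 K.1# * o 1 -1K ≃ o 2 K.1#
  o-square = trans (sym (∏∞-* (o-conv 1 K.1#) (o-conv 1 -1K)))
    (∏∞-cong (λ i → trans (lin-square (1 ℕ.* (suc i ℕ.+ i)))
      (lin-≡ K.1# (≡.cong (2 ℕ.*_) (ℕP.*-identityˡ (suc i ℕ.+ i))))))

  C-zero : ∀ {a} → a K.≈ K.0# → C a ≃ 0#
  C-zero p = trans (C-cong p) C-0

  C-one : ∀ {a} → a K.≈ K.1# → C a ≃ 1#
  C-one p = trans (C-cong p) C1

  module Crank (splitting : Splitting) where
    open Splitting splitting

    h : Series
    h = η 1 K.1#

    lin-absorb : ∀ {a b d} e → a K.* b K.≈ a K.* d → C a * lin b e ≃ C a * lin d e
    lin-absorb {a} {b} {d} e p = trans (expand b) (trans (+-congˡ (-‿cong (*-congʳ (C-cong p)))) (sym (expand d)))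
      where
      expand : ∀ b → C a * lin b e ≃ C a - C (a K.* b) * q ^ e
      expand b = trans
        (solve 3 (λ a b x → a :* (con (+ 1) :- b :* x) := a :- (a :* b) :* x) refl (C a) (C b) (q ^ e))
        (+-congˡ (-‿cong (*-congʳ (sym (C-* a b)))))

    η-absorb : ∀ {a b d} → a K.* b K.≈ a K.* d → C a * η 1 b ≃ C a * η 1 d
    η-absorb {a} {b} {d} p = ∏∞-absorb (C a) (η-conv 1 b) (η-conv 1 d) (λ i → lin-absorb (1 ℕ.* suc i) p)

    η-absorb₂ : ∀ {a b b′ d} → a K.* b K.≈ a K.* d → a K.* b′ K.≈ a K.* d →
                C a * (η 1 b * η 1 b′) ≃ C a * (η 1 d * η 1 d)
    η-absorb₂ {a} {b} {b′} {d} p p′ = trans (sym (*-assoc _ _ _)) (trans (*-congʳ (η-absorb {b = b} {d} p))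
      (trans (solve 3 (λ a x y → (a :* x) :* y := (a :* y) :* x) refl _ _ _)
      (trans (*-congʳ (η-absorb {b = b′} {d} p′)) (*-assoc _ _ _))))

    E : Series
    E = η 1 z * η 1 z⁻¹

    N-part : C N * E ≃ C N * (h * h)
    N-part = η-absorb₂ (K.trans Nz (K.sym (K.*-identityʳ N))) (K.trans Nz⁻¹ (K.sym (K.*-identityʳ N)))

    e₁-part : C e₁ * E ≃ C e₁ * (η 1 -1K * η 1 -1K)
    e₁-part = η-absorb₂ (K.trans e₁z minus) (K.trans e₁z⁻¹ minus)
      where
      minus : K.- e₁ K.≈ e₁ K.* -1K
      minus = KS.solve 1 (λ e → KS.:- e KS.:= e KS.:* KS.con -[1+ 0 ]) K.refl e₁

    private
      Z Z⁻¹ D D⁻¹ : Series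
      Z   = C z
      Z⁻¹ = C z⁻¹
      D   = C c
      D⁻¹ = C c⁻¹

      ZZ⁻¹ : Z * Z⁻¹ ≃ 1#
      ZZ⁻¹ = trans (sym (C-* _ _)) (C-one z-inverse)

      DD⁻¹ : D * D⁻¹ ≃ 1#
      DD⁻¹ = trans (sym (C-* _ _)) (C-one c-inverse)

      E₂-sum : C e₂ * (Z + Z⁻¹) ≃ 0#
      E₂-sum = trans (trans (*-congˡ (sym (C-+ _ _))) (sym (C-* _ _))) (C-zero e₂-sum)

      E₃-sum : C e₃ * ((Z + Z⁻¹) + (D + D⁻¹)) ≃ 0#
      E₃-sum = trans (trans (*-congˡ (trans (+-cong (sym (C-+ _ _)) (sym (C-+ _ _))) (sym (C-+ _ _)))) (sym (C-* _ _)))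
        (C-zero e₃-sum)

      E₃-prod : C e₃ * ((Z + Z⁻¹) * (D + D⁻¹) + (1# + 1#)) ≃ 0#
      E₃-prod = trans (trans (*-congˡ (trans
          (+-cong (trans (*-cong (sym (C-+ _ _)) (sym (C-+ _ _))) (sym (C-* _ _)))
                  (trans (+-cong (sym C1) (sym C1)) (sym (C-+ _ _))))
          (sym (C-+ _ _)))) (sym (C-* _ _)))
        (C-zero e₃-prod)

      lin-pair : ∀ {a b} e → C a * C b ≃ 1# → lin a e * lin b e ≃ 1# - (C a + C b) * q ^ e + q ^ e * q ^ e
      lin-pair {a} {b} e ab≃1 = trans
        (solve 3 (λ a b x → (con (+ 1) :- a :* x) :* (con (+ 1) :- b :* x)
           := con (+ 1) :- (a :+ b) :* x :+ (a :* b) :* (x :* x)) refl (C a) (C b) (q ^ e))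
        (+-congˡ (trans (*-congʳ ab≃1) (*-identityˡ _)))

      lin-neg : ∀ e → lin -1K e ≃ 1# + q ^ e
      lin-neg e = trans (+-congˡ (-‿cong (*-congʳ C-1)))
        (solve 1 (λ x → con (+ 1) :- (con -[1+ 0 ]) :* x := con (+ 1) :+ x) refl (q ^ e))

      q^-double : ∀ e → q ^ (2 ℕ.* e) ≃ q ^ e * q ^ e
      q^-double e = trans (^-homo-* q e (e ℕ.+ 0)) (*-congˡ (reflexive (≡.cong (q ^_) (ℕP.+-identityʳ e))))

      e₂-factor : ∀ e → C e₂ * (lin z e * lin z⁻¹ e) ≃ C e₂ * lin -1K (2 ℕ.* e)
      e₂-factor e = trans (*-congˡ (lin-pair e ZZ⁻¹))
        (trans (solve 3 (λ k a x → k :* (con (+ 1) :- a :* x :+ x :* x) := k :* (con (+ 1) :+ x :* x) :- (k :* a) :* x)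
                  refl (C e₂) (Z + Z⁻¹) (q ^ e))
        (trans (+-congˡ (-‿cong (*-congʳ E₂-sum)))
        (trans (solve 3 (λ k x y → k :* (con (+ 1) :+ x) :- con (+ 0) :* y := k :* (con (+ 1) :+ x))
                  refl (C e₂) (q ^ e * q ^ e) (q ^ e))
        (*-congˡ (trans (+-congˡ (sym (q^-double e))) (sym (lin-neg (2 ℕ.* e))))))))

      -- With x = q^e, a = z + z⁻¹ and b = c + c⁻¹ the four factors give 1 + x⁴ - (a + b)(x + x³) +
      -- (ab + 2)x²; the two relations on `e₃` remove the middle terms.
      e₃-factor : ∀ e → C e₃ * ((lin z e * lin z⁻¹ e) * (lin c e * lin c⁻¹ e)) ≃ C e₃ * lin -1K (4 ℕ.* e)
      e₃-factor e = trans (*-congˡ (*-cong (lin-pair e ZZ⁻¹) (lin-pair e DD⁻¹)))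
        (trans (solve 4 (λ k a b x →
            k :* ((con (+ 1) :- a :* x :+ x :* x) :* (con (+ 1) :- b :* x :+ x :* x)) :=
            k :* (con (+ 1) :+ (x :* x) :* (x :* x)) :- (k :* (a :+ b)) :* (x :+ x :* x :* x)
            :+ (k :* (a :* b :+ (con (+ 1) :+ con (+ 1)))) :* (x :* x)) refl (C e₃) (Z + Z⁻¹) (D + D⁻¹) (q ^ e))
        (trans (+-cong (+-congˡ (-‿cong (*-congʳ E₃-sum))) (*-congʳ E₃-prod))
        (trans (solve 2 (λ k x →
            k :* (con (+ 1) :+ (x :* x) :* (x :* x)) :- con (+ 0) :* (x :+ x :* x :* x) :+ con (+ 0) :* (x :* x)
            := k :* (con (+ 1) :+ (x :* x) :* (x :* x))) refl (C e₃) (q ^ e))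
        (*-congˡ (trans (+-congˡ (sym q^4)) (sym (lin-neg (4 ℕ.* e))))))))
        where
        q^4 : q ^ (4 ℕ.* e) ≃ (q ^ e * q ^ e) * (q ^ e * q ^ e)
        q^4 = trans (reflexive (≡.cong (q ^_) (ℕP.*-assoc 2 2 e)))
          (trans (q^-double (2 ℕ.* e)) (*-cong (q^-double e) (q^-double e)))

    pair : K.Carrier → K.Carrier → ℕ → Series
    pair a b i = lin a (1 ℕ.* i) * lin b (1 ℕ.* i)

    pair-conv : ∀ a b → Convergent (pair a b)
    pair-conv a b = Convergent-* {λ i → lin a (1 ℕ.* i)} {λ i → lin b (1 ℕ.* i)} (η-conv 1 a) (η-conv 1 b)

    e₂-part : C e₂ * E ≃ C e₂ * η 2 -1K
    e₂-part = trans (*-congˡ (sym (∏∞-* (η-conv 1 z) (η-conv 1 z⁻¹))))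
      (∏∞-absorb (C e₂) (pair-conv z z⁻¹) (η-conv 2 -1K)
        (λ i → trans (e₂-factor (1 ℕ.* suc i)) (*-congˡ (lin-≡ -1K (≡.cong (2 ℕ.*_) (ℕP.*-identityˡ (suc i)))))))

    e₃-part : C e₃ * (E * (η 1 c * η 1 c⁻¹)) ≃ C e₃ * η 4 -1K
    e₃-part = trans (*-congˡ (trans
        (*-cong (sym (∏∞-* (η-conv 1 z) (η-conv 1 z⁻¹))) (sym (∏∞-* (η-conv 1 c) (η-conv 1 c⁻¹))))
        (sym (∏∞-* (pair-conv z z⁻¹) (pair-conv c c⁻¹)))))
      (∏∞-absorb (C e₃) (Convergent-* {pair z z⁻¹} {pair c c⁻¹} (pair-conv z z⁻¹) (pair-conv c c⁻¹)) (η-conv 4 -1K)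
        (λ i → trans (e₃-factor (1 ℕ.* suc i)) (*-congˡ (lin-≡ -1K (≡.cong (4 ℕ.*_) (ℕP.*-identityˡ (suc i)))))))

    -- `tri-product` gives the wanted product only with the factor 1 - c⁻¹. Writing e₃ as κ(1 - c⁻¹)
    -- supplies that factor, and the remaining `κ` turns the weights into `thetaWeight`.
    theta-part : C e₃ * (η 1 c * η 1 c⁻¹ * h) ≃ C e₃ * (X + C (z K.+ z⁻¹) * Y)
    theta-part = trans (*-congʳ Ce₃)
      (trans (*-assoc _ _ _)
      (trans (*-congˡ (tri-product c c⁻¹ c-inverse c⁸≈1 c⁻⁸≈1))
      (trans (sym (Σ<-*ˡ 8 (C κ) (λ s → C (w s) * U s)))
      (trans (Σ<-cong< 8 {g = λ s → C (thetaWeight e₃ t s) * U s}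
        (λ s s<8 → trans (sym (*-assoc _ _ _)) (*-congʳ (trans (sym (C-* _ _)) (C-cong (κ-weight s s<8))))))
      (trans (+-cong (+-cong (+-cong (+-cong (+-cong (+-cong (+-cong refl
          (*-congʳ t-1)) (*-congʳ 1-t)) (*-congʳ minus)) (*-congʳ minus)) (*-congʳ 1-t)) (*-congʳ t-1)) refl)
      (solve 10 (λ e t u0 u1 u2 u3 u4 u5 u6 u7 →
        con (+ 0) :+ e :* u0 :+ e :* (t :- con (+ 1)) :* u1 :+ e :* (con (+ 1) :- t) :* u2
          :+ (:- e) :* u3 :+ (:- e) :* u4 :+ e :* (con (+ 1) :- t) :* u5 :+ e :* (t :- con (+ 1)) :* u6 :+ e :* u7
        := e :* (((u0 :+ u7) :- (u1 :+ u6) :+ (u2 :+ u5) :- (u3 :+ u4)) :+ t :* ((u1 :+ u6) :- (u2 :+ u5))))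
        refl (C e₃) (C t) (U 0) (U 1) (U 2) (U 3) (U 4) (U 5) (U 6) (U 7)))))))
      where
      t : K.Carrier
      t = z K.+ z⁻¹
      w : ℕ → K.Carrier
      w s = (K.- c) ^K s K.+ (K.- c⁻¹) ^K suc s
      Ce₃ : C e₃ ≃ C κ * (1# - C c⁻¹)
      Ce₃ = trans (C-cong (K.sym κ-factor)) (trans (C-* _ _)
        (*-congˡ (trans (C-+ _ _) (+-cong C1 (C-neg _)))))
      minus : C (K.- e₃) ≃ - C e₃
      minus = C-neg e₃
      t-1 : C (e₃ K.* (t K.- K.1#)) ≃ C e₃ * (C t - 1#)
      t-1 = trans (C-* _ _) (*-congˡ (trans (C-+ _ _) (+-congˡ C-1)))
      1-t : C (e₃ K.* (K.1# K.- t)) ≃ C e₃ * (1# - C t)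
      1-t = trans (C-* _ _) (*-congˡ (trans (C-+ _ _) (+-cong C1 (C-neg t))))

    -- After multiplication by `E` each of the four terms on the right becomes its component times
    -- `h`, because there `E` cancels against the matching products; the components add up to 8.
    -- Having constant term 1, `E` is then removed.
    crank-splitting : ∀ {F P I} → F * E ≃ h → P * h ≃ 1# → I * η 4 K.1# ≃ 1# →
      C 8K * F ≃ (C N * P + C e₁ * (I * (φ 1 * ψ⁻))) +
                 (C e₂ * (I * (φ 1 * ψ⁺)) + C e₃ * (I * (φ 4 * (X + C (z K.+ z⁻¹) * Y))))
    crank-splitting {F} {P} {I} FE≃h Ph≃1 Iη₄≃1 = cancel E-order (trans lhs (sym rhs))
      where
      o₁ o₁⁻ η₄ : Series
      o₁  = o 1 K.1#
      o₁⁻ = o 1 -1K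
      η₄  = η 4 K.1#
      E-order : E ≈[ 1 ] 1#
      E-order = ≈[]-trans (*-cong-≈[] (η-order 1 z) (η-order 1 z⁻¹)) (≃⇒≈[] (*-identityˡ 1#))
      lhs : C 8K * F * E ≃ ((C N + C e₁) + (C e₂ + C e₃)) * h
      lhs = trans (*-assoc _ _ _) (*-cong (trans (C-cong (K.sym total)) (trans (C-+ _ _) (+-cong (C-+ _ _) (C-+ _ _)))) FE≃h)
      N-term : C N * P * E ≃ C N * h
      N-term = trans (solve 3 (λ n p e → n :* p :* e := (n :* e) :* p) refl (C N) P E)
        (trans (*-congʳ N-part)
        (trans (solve 3 (λ n p h → n :* (h :* h) :* p := n :* ((p :* h) :* h)) refl (C N) P h)
        (*-congˡ (trans (*-congʳ Ph≃1) (*-identityˡ h)))))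
      e₁-term : C e₁ * (I * (φ 1 * ψ⁻)) * E ≃ C e₁ * h
      e₁-term = trans (*-congʳ (*-congˡ (*-congˡ (*-cong (sym (φ-product 1)) (sym ψ⁻-product)))))
        (trans (solve 6 (λ k i o h n e → k :* (i :* ((o :* h) :* (o :* n))) :* e := (k :* e) :* ((i :* n) :* (o :* o :* h)))
                  refl (C e₁) I o₁ h η₄ E)
        (trans (*-cong e₁-part (trans (*-congʳ Iη₄≃1) (*-identityˡ _)))
        -- Each of the two factors (-q)∞ of `E` is paired with one odd product, one coming from φ
        -- and the other from ψ.
        (trans (solve 4 (λ k m o h → (k :* (m :* m)) :* (o :* o :* h) := k :* ((o :* m) :* ((o :* m) :* h)))
                  refl (C e₁) (η 1 -1K) o₁ h)
        (*-congˡ (trans (*-cong (euler 1) (trans (*-congʳ (euler 1)) (*-identityˡ h))) (*-identityˡ h))))))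
      e₂-term : C e₂ * (I * (φ 1 * ψ⁺)) * E ≃ C e₂ * h
      e₂-term = trans (*-congʳ (*-congˡ (*-congˡ (*-cong (sym (φ-product 1)) (sym ψ⁺-product)))))
        (trans (solve 7 (λ k i o o′ h n e → k :* (i :* ((o :* h) :* (o′ :* n))) :* e := (k :* e) :* ((i :* n) :* (o :* o′ :* h)))
                  refl (C e₂) I o₁ o₁⁻ h η₄ E)
        (trans (*-cong e₂-part (trans (*-congʳ Iη₄≃1) (trans (*-identityˡ _) (*-congʳ o-square))))
        (trans (solve 4 (λ k m o h → (k :* m) :* (o :* h) := k :* ((o :* m) :* h)) refl (C e₂) (η 2 -1K) (o 2 K.1#) h)
        (*-congˡ (trans (*-congʳ (euler 2)) (*-identityˡ h))))))
      e₃-term : C e₃ * (I * (φ 4 * (X + C (z K.+ z⁻¹) * Y))) * E ≃ C e₃ * h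
      e₃-term = trans (*-congʳ (*-congˡ (*-congˡ (*-congʳ (sym (φ-product 4))))))
        (trans (solve 6 (λ k i o n x e → k :* (i :* ((o :* n) :* x)) :* e := (k :* x) :* ((i :* n) :* (o :* e)))
                  refl (C e₃) I (o 4 K.1#) η₄ (X + C (z K.+ z⁻¹) * Y) E)
        -- Read from right to left, `theta-part` restores the product over c and c⁻¹, which `E`
        -- completes to the product over z, z⁻¹, c and c⁻¹.
        (trans (*-cong (sym theta-part) (trans (*-congʳ Iη₄≃1) (*-identityˡ _)))
        (trans (solve 5 (λ k g h o e → (k :* (g :* h)) :* (o :* e) := (k :* (e :* g)) :* (o :* h))
                  refl (C e₃) (η 1 c * η 1 c⁻¹) h (o 4 K.1#) E)
        (trans (*-congʳ e₃-part)
        (trans (solve 4 (λ k m o h → (k :* m) :* (o :* h) := k :* ((o :* m) :* h)) refl (C e₃) (η 4 -1K) (o 4 K.1#) h)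
        (*-congˡ (trans (*-congʳ (euler 4)) (*-identityˡ h))))))))
      rhs : ((C N * P + C e₁ * (I * (φ 1 * ψ⁻))) +
             (C e₂ * (I * (φ 1 * ψ⁺)) + C e₃ * (I * (φ 4 * (X + C (z K.+ z⁻¹) * Y))))) * E ≃
            ((C N + C e₁) + (C e₂ + C e₃)) * h
      rhs = trans (solve 5 (λ a b c d e → ((a :+ b) :+ (c :+ d)) :* e := (a :* e :+ b :* e) :+ (c :* e :+ d :* e))
                refl _ _ _ _ E)
        (trans (+-cong (+-cong N-term e₁-term) (+-cong e₂-term e₃-term))
        (solve 5 (λ a b c d e → (a :* e :+ b :* e) :+ (c :* e :+ d :* e) := ((a :+ b) :+ (c :+ d)) :* e)
                refl (C N) (C e₁) (C e₂) (C e₃) h))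

-- The group algebra of the cyclic group of order 8

module GroupAlgebra (R : CommutativeRing 0ℓ 0ℓ) where

  import Algebra.Properties.Semiring.Sum as Sums
  import Algebra.Properties.CommutativeMonoid.Sum as MonoidSums
  open import Data.Fin as Fin using (Fin; zero; suc; toℕ)
  open import Data.Fin.Properties using (all?) renaming (_≟_ to _≟F_)
  open import Data.Fin.Permutation using (Permutation′; permutation; flip)
  open import Data.Nat.DivMod using (_mod_)

  open CommutativeRing R hiding (zero)
  open Sums semiring using (sum; sum-cong-≋; *-distribˡ-sum; *-distribʳ-sum; sum-replicate-zero)
  open MonoidSums +-commutativeMonoid using (sum-permute; ∑-comm; ∑-distrib-+)

  -- `_⊖_` repeats the index expression of `_*G_`, so that products over ℤ and over ℚ correspond
  -- summand by summand. Its laws are decided by running over all residues.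
  _⊖_ _⊞_ : Fin 8 → Fin 8 → Fin 8
  r ⊖ s = (toℕ r ℕ.+ (8 ∸ toℕ s)) mod 8
  r ⊞ s = (toℕ r ℕ.+ toℕ s) mod 8

  ⊖-identity : ∀ r → r ⊖ zero ≡ r
  ⊖-identity = from-yes (all? λ r → (r ⊖ zero) ≟F r)

  ⊖-involutive : ∀ r s → r ⊖ (r ⊖ s) ≡ s
  ⊖-involutive = from-yes (all? λ r → all? λ s → (r ⊖ (r ⊖ s)) ≟F s)

  ⊖-⊞ : ∀ t s → (s ⊖ t) ⊞ t ≡ s
  ⊖-⊞ = from-yes (all? λ t → all? λ s → ((s ⊖ t) ⊞ t) ≟F s)

  ⊞-⊖ : ∀ t s → (s ⊞ t) ⊖ t ≡ s
  ⊞-⊖ = from-yes (all? λ t → all? λ s → ((s ⊞ t) ⊖ t) ≟F s)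

  ⊖-⊖ : ∀ r t s → (r ⊖ t) ⊖ (s ⊖ t) ≡ r ⊖ s
  ⊖-⊖ = from-yes (all? λ r → all? λ t → all? λ s → ((r ⊖ t) ⊖ (s ⊖ t)) ≟F (r ⊖ s))

  ⊖-⊞-assoc : ∀ r t s → r ⊖ (t ⊞ s) ≡ (r ⊖ s) ⊖ t
  ⊖-⊞-assoc = from-yes (all? λ r → all? λ t → all? λ s → (r ⊖ (t ⊞ s)) ≟F ((r ⊖ s) ⊖ t))

  ⊞-≟ : ∀ t s → does (s ≟F (t ⊞ s)) ≡ does (zero {7} ≟F t)
  ⊞-≟ = from-yes (all? λ t → all? λ s → does (s ≟F (t ⊞ s)) ≟B does (zero ≟F t))

  reflection translation : Fin 8 → Permutation′ 8
  reflection r  = permutation (r ⊖_) (r ⊖_) (⊖-involutive r) (⊖-involutive r)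
  translation t = permutation (_⊖ t) (_⊞ t) (⊞-⊖ t) (⊖-⊞ t)

  Element : Set
  Element = Fin 8 → Carrier

  infix 4 _≈A_
  _≈A_ : Element → Element → Set
  u ≈A v = ∀ r → u r ≈ v r

  infixl 6 _+A_
  infixl 7 _*A_
  _+A_ _*A_ : Element → Element → Element
  (u +A v) r = u r + v r
  (u *A v) r = sum (λ s → u s * v (r ⊖ s))

  δ : Fin 8 → Element
  δ s r = if does (s ≟F r) then 1# else 0#

  scalar : Carrier → Element
  scalar a r = a * δ zero r

  *A-cong : ∀ {u u′ v v′} → u ≈A u′ → v ≈A v′ → u *A v ≈A u′ *A v′
  *A-cong p p′ r = sum-cong-≋ λ s → *-cong (p s) (p′ (r ⊖ s))

  *A-comm : ∀ u v → u *A v ≈A v *A u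
  *A-comm u v r = trans (sum-permute (λ s → u s * v (r ⊖ s)) (reflection r))
    (sum-cong-≋ λ s → trans (*-congˡ {u (r ⊖ s)} (reflexive (≡.cong v (⊖-involutive r s)))) (*-comm _ _))

  -- After the two sums are interchanged, translating s by t identifies the inner sum with a
  -- convolution.
  *A-assoc : ∀ u v w → (u *A v) *A w ≈A u *A (v *A w)
  *A-assoc u v w r = trans
    (sum-cong-≋ λ s → trans (*-distribʳ-sum (w (r ⊖ s)) (λ t → u t * v (s ⊖ t)))
                            (sum-cong-≋ λ t → *-assoc (u t) (v (s ⊖ t)) (w (r ⊖ s))))
    (trans (∑-comm (λ s t → u t * (v (s ⊖ t) * w (r ⊖ s))))
    (sum-cong-≋ λ t → trans (sym (*-distribˡ-sum (u t) (λ s → v (s ⊖ t) * w (r ⊖ s))))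
      (*-congˡ (sym (trans (sum-permute (λ s → v s * w ((r ⊖ t) ⊖ s)) (translation t))
        (sum-cong-≋ λ s → *-congˡ {v (s ⊖ t)} (reflexive (≡.cong w (⊖-⊖ r t s)))))))))

  *A-distribʳ : ∀ w u v → (u +A v) *A w ≈A (u *A w) +A (v *A w)
  *A-distribʳ w u v r = trans (sum-cong-≋ λ s → distribʳ (w (r ⊖ s)) (u s) (v s))
    (∑-distrib-+ (λ s → u s * w (r ⊖ s)) (λ s → v s * w (r ⊖ s)))

  scalar-*A : ∀ a u r → (scalar a *A u) r ≈ a * u r
  scalar-*A a u r = trans
    (+-cong (trans (*-congʳ (*-identityʳ a)) (*-congˡ (reflexive (≡.cong u (⊖-identity r)))))
            (trans (sum-cong-≋ {7} {λ s → scalar a (suc s) * u (r ⊖ suc s)} {λ _ → 0#}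
                     λ s → trans (*-congʳ (zeroʳ a)) (zeroˡ _)) (sum-replicate-zero 7)))
    (+-identityʳ _)

  *A-identityˡ : ∀ u → δ zero *A u ≈A u
  *A-identityˡ u r = trans (*A-cong {δ zero} {scalar 1#} {u} (λ s → sym (*-identityˡ _)) (λ _ → refl) r)
    (trans (scalar-*A 1# u r) (*-identityˡ _))

  groupAlgebra : CommutativeRing 0ℓ 0ℓ
  groupAlgebra = record
    { Carrier = Element
    ; _≈_ = _≈A_
    ; _+_ = _+A_
    ; _*_ = _*A_
    ; -_  = λ u r → - u r
    ; 0#  = λ _ → 0#
    ; 1#  = δ zero
    ; isCommutativeRing = record
      { isRing = record
        { +-isAbelianGroup = record
          { isGroup = record
            { isMonoid = record
              { isSemigroup = record
                { isMagma = record
                  { isEquivalence = record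
                    { refl  = λ _ → refl
                    ; sym   = λ p r → sym (p r)
                    ; trans = λ p p′ r → trans (p r) (p′ r)
                    }
                  ; ∙-cong = λ p p′ r → +-cong (p r) (p′ r)
                  }
                ; assoc = λ _ _ _ _ → +-assoc _ _ _
                }
              ; identity = (λ _ _ → +-identityˡ _) , (λ _ _ → +-identityʳ _)
              }
            ; inverse = (λ _ _ → -‿inverseˡ _) , (λ _ _ → -‿inverseʳ _)
            ; ⁻¹-cong = λ p r → -‿cong (p r)
            }
          ; comm = λ _ _ _ → +-comm _ _
          }
        ; *-cong = *A-cong
        ; *-assoc = *A-assoc
        ; *-identity = *A-identityˡ , (λ u r → trans (*A-comm u (δ zero) r) (*A-identityˡ u r))
        ; distrib = (λ w u v r → trans (*A-comm w (u +A v) r)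
                       (trans (*A-distribʳ w u v r) (+-cong (*A-comm u w r) (*A-comm v w r))))
                  , *A-distribʳ
        }
      ; *-comm = *A-comm
      }
    }

  δ-*A : ∀ s v → δ s *A v ≈A λ r → v (r ⊖ s)
  δ-*A s v r = trans (sum-permute (λ t → δ s t * v (r ⊖ t)) (flip (translation s)))
    (trans (sum-cong-≋ λ t → *-cong
      (reflexive (≡.cong (if_then 1# else 0#) (⊞-≟ t s)))
      (reflexive (≡.cong v (⊖-⊞-assoc r t s))))
    (*A-identityˡ v (r ⊖ s)))

  open import Algebra.Properties.Semiring.Exp (CommutativeRing.semiring groupAlgebra) using (_^_)

  -- Powers of a · z^s in a form that evaluates fast: the cost of evaluating nested
  -- convolutions is exponential in the exponent.
  rotation : Carrier → Fin 8 → ℕ → Element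
  rotation a s ℕ.zero    r = δ zero r
  rotation a s (ℕ.suc n) r = a * rotation a s n (r ⊖ s)

  rotation-correct : ∀ {u} a s → (∀ r → u r ≈ a * δ s r) → ∀ n → u ^ n ≈A rotation a s n
  rotation-correct a s p ℕ.zero    r = refl
  rotation-correct {u} a s p (ℕ.suc n) r = trans
    (*A-cong {u} {λ t → a * δ s t} p (rotation-correct a s p n) r)
    (trans (sum-cong-≋ λ t → *-assoc a (δ s t) (rotation a s n (r ⊖ t)))
    (trans (sym (*-distribˡ-sum a (λ t → δ s t * rotation a s n (r ⊖ t))))
    (*-congˡ (δ-*A s (rotation a s n) r))))

-- The idempotents of ℚ[z]/(z⁸ - 1) in coordinates

module CyclicSplitting where

  open import Data.Fin as Fin using (Fin; zero; suc; toℕ; #_; fromℕ<)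
  open import Data.Fin.Properties using (all?; toℕ-fromℕ<)
  open import Data.Vec using (Vec; []; _∷_; lookup)

  ℚ-ring = ℚP.+-*-commutativeRing

  open GroupAlgebra ℚ-ring public
  module AG = CrankSplitting groupAlgebra
  open AG using (Splitting; 2K; 8K; thetaWeight; _^K_)

  open CommutativeRing groupAlgebra hiding (zero)

  vector : Vec ℚ 8 → Element
  vector v r = lookup v r

  -- As polynomials, e₁ is the sum of (-z)^k over k < 8, e₂ = 2(1 - z² + z⁴ - z⁶) and e₃ = 4(1 -
  -- z⁴): each takes the value 8 at the roots of its own factor of z⁸ - 1 and 0 at the other roots.
  zG zG⁻¹ cG cG⁻¹ NG e₁G e₂G e₃G κG : Element
  zG   = δ (# 1)
  zG⁻¹ = δ (# 7)
  cG   = δ (# 3)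
  cG⁻¹ = δ (# 5)
  NG  = λ _ → 1ℚ
  e₁G = vector (1ℚ ∷ ℚ.- 1ℚ ∷ 1ℚ ∷ ℚ.- 1ℚ ∷ 1ℚ ∷ ℚ.- 1ℚ ∷ 1ℚ ∷ ℚ.- 1ℚ ∷ [])
  e₂G = vector (+ 2 ℚ./ 1 ∷ 0ℚ ∷ -[1+ 1 ] ℚ./ 1 ∷ 0ℚ ∷ + 2 ℚ./ 1 ∷ 0ℚ ∷ -[1+ 1 ] ℚ./ 1 ∷ 0ℚ ∷ [])
  e₃G = vector (+ 4 ℚ./ 1 ∷ 0ℚ ∷ 0ℚ ∷ 0ℚ ∷ -[1+ 3 ] ℚ./ 1 ∷ 0ℚ ∷ 0ℚ ∷ 0ℚ ∷ [])
  -- In terms of c this is 4(1 + c⁻¹ + c⁻² + c⁻³), whose product with 1 - c⁻¹ telescopes to 4(1 -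
  -- c⁻⁴) = 4(1 - z⁴).
  κG  = vector (+ 4 ℚ./ 1 ∷ 0ℚ ∷ + 4 ℚ./ 1 ∷ 0ℚ ∷ 0ℚ ∷ + 4 ℚ./ 1 ∷ 0ℚ ∷ + 4 ℚ./ 1 ∷ [])

  private
    cG-power : ∀ n → cG ^K n ≈ rotation 1ℚ (# 3) n
    cG-power = rotation-correct 1ℚ (# 3) (λ r → ≡.sym (ℚP.*-identityˡ _))

    cG⁻¹-power : ∀ n → cG⁻¹ ^K n ≈ rotation 1ℚ (# 5) n
    cG⁻¹-power = rotation-correct 1ℚ (# 5) (λ r → ≡.sym (ℚP.*-identityˡ _))

    -cG-power : ∀ n → (- cG) ^K n ≈ rotation (ℚ.- 1ℚ) (# 3) n
    -cG-power = rotation-correct (ℚ.- 1ℚ) (# 3)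
      (from-yes (all? λ r → (- cG) r ℚP.≟ ℚ.- 1ℚ ℚ.* cG r))

    -cG⁻¹-power : ∀ n → (- cG⁻¹) ^K n ≈ rotation (ℚ.- 1ℚ) (# 5) n
    -cG⁻¹-power = rotation-correct (ℚ.- 1ℚ) (# 5)
      (from-yes (all? λ r → (- cG⁻¹) r ℚP.≟ ℚ.- 1ℚ ℚ.* cG⁻¹ r))

    total : (NG + e₁G) + (e₂G + e₃G) ≈ 8K
    total = from-yes (all? λ r → ((NG + e₁G) + (e₂G + e₃G)) r ℚP.≟ 8K r)

    e₃-prod : e₃G * ((zG + zG⁻¹) * (cG + cG⁻¹) + 2K) ≈ 0#
    e₃-prod = from-yes (all? λ r → (e₃G * ((zG + zG⁻¹) * (cG + cG⁻¹) + 2K)) r ℚP.≟ 0ℚ)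

    weights : ∀ s → κG * (rotation (ℚ.- 1ℚ) (# 3) (toℕ s) + rotation (ℚ.- 1ℚ) (# 5) (ℕ.suc (toℕ s)))
              ≈ thetaWeight e₃G (zG + zG⁻¹) (toℕ {8} s)
    weights = from-yes (all? λ s → all? λ r →
      (κG * (rotation (ℚ.- 1ℚ) (# 3) (toℕ s) + rotation (ℚ.- 1ℚ) (# 5) (ℕ.suc (toℕ s)))) r
        ℚP.≟ thetaWeight e₃G (zG + zG⁻¹) (toℕ {8} s) r)

    κ-weight : ∀ s → s < 8 → κG * ((- cG) ^K s + (- cG⁻¹) ^K ℕ.suc s) ≈ thetaWeight e₃G (zG + zG⁻¹) s
    κ-weight s s<8 = trans (*-congˡ {κG} (+-cong (-cG-power s) (-cG⁻¹-power (ℕ.suc s))))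
      (≡.subst (λ s → κG * (rotation (ℚ.- 1ℚ) (# 3) s + rotation (ℚ.- 1ℚ) (# 5) (ℕ.suc s))
                      ≈ thetaWeight e₃G (zG + zG⁻¹) s)
        (toℕ-fromℕ< s<8) (weights (fromℕ< s<8)))

  splitting : Splitting
  splitting = record
    { z = zG ; z⁻¹ = zG⁻¹ ; c = cG ; c⁻¹ = cG⁻¹
    ; N = NG ; e₁ = e₁G ; e₂ = e₂G ; e₃ = e₃G ; κ = κG
    ; total     = total
    ; z-inverse = from-yes (all? λ r → (zG * zG⁻¹) r ℚP.≟ 1# r)
    ; c-inverse = from-yes (all? λ r → (cG * cG⁻¹) r ℚP.≟ 1# r)
    ; c⁸≈1      = trans (cG-power 8) (from-yes (all? λ r → rotation 1ℚ (# 3) 8 r ℚP.≟ 1# r))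
    ; c⁻⁸≈1     = trans (cG⁻¹-power 8) (from-yes (all? λ r → rotation 1ℚ (# 5) 8 r ℚP.≟ 1# r))
    ; Nz        = from-yes (all? λ r → (NG * zG) r ℚP.≟ NG r)
    ; Nz⁻¹      = from-yes (all? λ r → (NG * zG⁻¹) r ℚP.≟ NG r)
    ; e₁z       = from-yes (all? λ r → (e₁G * zG) r ℚP.≟ (- e₁G) r)
    ; e₁z⁻¹     = from-yes (all? λ r → (e₁G * zG⁻¹) r ℚP.≟ (- e₁G) r)
    ; e₂-sum    = from-yes (all? λ r → (e₂G * (zG + zG⁻¹)) r ℚP.≟ 0ℚ)
    ; e₃-sum    = from-yes (all? λ r → (e₃G * ((zG + zG⁻¹) + (cG + cG⁻¹))) r ℚP.≟ 0ℚ)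
    ; e₃-prod   = e₃-prod
    ; κ-factor  = from-yes (all? λ r → (κG * (1# - cG⁻¹)) r ℚP.≟ e₃G r)
    ; κ-weight  = κ-weight
    }

-- Coefficient maps from raw operations into a ring, applied to series

module SeriesImage {A : Set} (_⊞_ _⊠_ : A → A → A) (0A 1A : A) (K : CommutativeRing 0ℓ 0ℓ)
          (ι : A → CommutativeRing.Carrier K)
          (ι-+ : ∀ a b → CommutativeRing._≈_ K (ι (a ⊞ b)) (CommutativeRing._+_ K (ι a) (ι b)))
          (ι-* : ∀ a b → CommutativeRing._≈_ K (ι (a ⊠ b)) (CommutativeRing._*_ K (ι a) (ι b)))
          (ι-0 : CommutativeRing._≈_ K (ι 0A) (CommutativeRing.0# K))
          (ι-1 : CommutativeRing._≈_ K (ι 1A) (CommutativeRing.1# K)) where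

  private module K = CommutativeRing K
  private module A = Defs.PowerSeries _⊞_ _⊠_ 0A 1A
  open ThetaSeries K

  image : A.Series → Series
  image f n = ι (f n)

  image-Σ≤ : ∀ n f → ι (A.Σ≤ n f) K.≈ Σ≤ n (image f)
  image-Σ≤ zero    f = K.refl
  image-Σ≤ (suc n) f = K.trans (ι-+ _ _) (K.+-congʳ (image-Σ≤ n f))

  image-⊛ : ∀ f g → image (f A.⊛ g) ≃ image f * image g
  image-⊛ f g = coeffwise λ n → K.trans (image-Σ≤ n _)
    (K.trans (Σ≤-cong≤ n (λ k _ → ι-* (f k) (g (n ∸ k)))) (K.reflexive (≡.sym (✶-at _ _ n))))

  image-one : image A.one ≃ 1#
  image-one = coeffwise λ { zero → ι-1 ; (suc n) → ι-0 }

  image-prod : ∀ n F → image (A.prod n F) ≃ prod n (λ i → image (F i))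
  image-prod zero    F = image-one
  image-prod (suc n) F = trans (image-⊛ (A.prod n F) (F (suc n))) (*-congʳ (image-prod n F))

  image-∏∞ : ∀ F → image (A.∏∞ F) ≃ ∏∞ (λ i → image (F i))
  image-∏∞ F = coeffwise λ n → at (image-prod n F) n

-- Ring homomorphisms applied to Euler products and theta series

module RingImage (K L : CommutativeRing 0ℓ 0ℓ)
          (ι : CommutativeRing.Carrier K → CommutativeRing.Carrier L)
          (ι-cong : ∀ {a b} → CommutativeRing._≈_ K a b → CommutativeRing._≈_ L (ι a) (ι b))
          (ι-+ : ∀ a b → CommutativeRing._≈_ L (ι (CommutativeRing._+_ K a b)) (CommutativeRing._+_ L (ι a) (ι b)))
          (ι-* : ∀ a b → CommutativeRing._≈_ L (ι (CommutativeRing._*_ K a b)) (CommutativeRing._*_ L (ι a) (ι b)))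
          (ι-neg : ∀ a → CommutativeRing._≈_ L (ι (CommutativeRing.-_ K a)) (CommutativeRing.-_ L (ι a)))
          (ι-0 : CommutativeRing._≈_ L (ι (CommutativeRing.0# K)) (CommutativeRing.0# L))
          (ι-1 : CommutativeRing._≈_ L (ι (CommutativeRing.1# K)) (CommutativeRing.1# L)) where

  private
    module K  = CommutativeRing K
    module L  = CommutativeRing L
    module SK = CrankSplitting K
    module SL = CrankSplitting L
    module KF = FiniteSums K
    module LF = FiniteSums L
  open SL using (_≃_; coeffwise; at)

  image : SK.Series → SL.Series
  image f n = ι (f n)

  image-cong : ∀ {f g} → f SK.≃ g → image f ≃ image g
  image-cong p = coeffwise λ n → ι-cong (SK.at p n)

  image-+ : ∀ f g → image (f SK.+ g) ≃ image f SL.+ image g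
  image-+ f g = coeffwise λ n → L.trans (ι-cong (K.reflexive (SK.✚-at f g n)))
    (L.trans (ι-+ _ _) (L.reflexive (≡.sym (SL.✚-at _ _ n))))

  image-neg : ∀ f → image (SK.- f) ≃ SL.- image f
  image-neg f = coeffwise λ n → L.trans (ι-cong (K.reflexive (SK.negS-at f n)))
    (L.trans (ι-neg _) (L.reflexive (≡.sym (SL.negS-at _ n))))

  image-* : ∀ f g → image (f SK.* g) ≃ image f SL.* image g
  image-* f g = coeffwise λ n → L.trans (ι-cong (K.reflexive (SK.✶-at f g n)))
    (L.trans (sums n _) (L.trans (SL.Σ≤-cong≤ n (λ k _ → ι-* (f k) (g (n ∸ k)))) (L.reflexive (≡.sym (SL.✶-at _ _ n)))))
    where
    sums : ∀ n (h : ℕ → K.Carrier) → ι (SK.Σ≤ n h) L.≈ SL.Σ≤ n (λ k → ι (h k))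
    sums zero    h = L.refl
    sums (suc n) h = L.trans (ι-+ _ _) (L.+-congʳ (sums n h))

  image-1 : image SK.1# ≃ SL.1#
  image-1 = coeffwise λ { zero → ι-1 ; (suc n) → ι-0 }

  image-C : ∀ c → image (SK.C c) ≃ SL.C (ι c)
  image-C c = coeffwise λ { zero → L.refl ; (suc n) → ι-0 }

  image-q : image SK.q ≃ SL.q
  image-q = coeffwise λ { 0 → ι-0 ; 1 → ι-1 ; (suc (suc n)) → ι-0 }

  image-q^ : ∀ e → image (SK.q SK.^ e) ≃ SL.q SL.^ e
  image-q^ zero    = coeffwise λ { zero → ι-1 ; (suc n) → ι-0 }
  image-q^ (suc e) = SL.trans (image-* _ _) (SL.*-cong image-q (image-q^ e))

  image-S : ∀ f → image (SK.S f) ≃ SL.S (λ k → image (f k))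
  image-S f = coeffwise λ n → L.trans (ι-cong (SK.Σ<-at (suc n) f n))
    (L.trans (sums (suc n) (λ i → f i n)) (L.sym (SL.Σ<-at (suc n) (λ k → image (f k)) n)))
    where
    sums : ∀ n (h : ℕ → K.Carrier) → ι (KF.Σ< n h) L.≈ LF.Σ< n (λ k → ι (h k))
    sums zero    h = ι-0
    sums (suc n) h = L.trans (ι-+ _ _) (L.+-congʳ (sums n h))

  image-lin : ∀ e → image (SK.lin K.1# e) ≃ SL.lin L.1# e
  image-lin e = SL.trans (image-+ _ _) (SL.+-cong image-1 (SL.trans (image-neg _)
    (SL.-‿cong (SL.trans (image-* _ _) (SL.*-cong (SL.trans (image-C _) (SL.C-cong ι-1)) (image-q^ e))))))

  image-η : ∀ d → image (SK.η d K.1#) ≃ SL.η d L.1#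
  image-η d = coeffwise λ n → at (image-prod n) n
    where
    image-prod : ∀ n → image (SK.prod n (λ i → SK.lin K.1# (d ℕ.* i))) ≃ SL.prod n (λ i → SL.lin L.1# (d ℕ.* i))
    image-prod zero    = image-1
    image-prod (suc n) = SL.trans (image-* _ _) (SL.*-cong (image-prod n) (image-lin (d ℕ.* suc n)))

  image-U : ∀ s → image (SK.U s) ≃ SL.U s
  image-U s = SL.trans (image-S (λ i → SK.q SK.^ SK.tri (i ℕ.* 8 ℕ.+ s)))
    (SL.S-cong (λ i → image-q^ (SK.tri (i ℕ.* 8 ℕ.+ s))))

  image-φ : ∀ d → image (SK.φ d) ≃ SL.φ d
  image-φ d = SL.trans (image-+ _ _) (SL.+-cong
    (SL.trans (image-S _) (SL.S-cong (λ k → image-mono k (d ℕ.* SK.square k))))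
    (SL.trans (image-S _) (SL.S-cong (λ k → image-mono (suc k) (d ℕ.* SK.square (suc k))))))
    where
    powers : ∀ k → ι (SK.-1K SK.^K k) L.≈ SL.-1K SL.^K k
    powers zero    = ι-1
    powers (suc k) = L.trans (ι-* _ _) (L.*-cong (L.trans (ι-neg _) (L.-‿cong ι-1)) (powers k))
    image-mono : ∀ k e → image (SK.mono (SK.-1K SK.^K k) e) ≃ SL.mono (SL.-1K SL.^K k) e
    image-mono k e = SL.trans (image-* _ _)
      (SL.*-cong (SL.trans (image-C _) (SL.C-cong (powers k))) (image-q^ e))

  private
    T : ℕ → ℕ → SK.Series
    T r s = SK.U r SK.+ SK.U s
    T′ : ℕ → ℕ → SL.Series
    T′ r s = SL.U r SL.+ SL.U s
    image-T : ∀ r s → image (T r s) ≃ T′ r s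
    image-T r s = SL.trans (image-+ _ _) (SL.+-cong (image-U r) (image-U s))
    image-minus : ∀ {f g f′ g′} → image f ≃ f′ → image g ≃ g′ → image (f SK.- g) ≃ f′ SL.- g′
    image-minus p p′ = SL.trans (image-+ _ _) (SL.+-cong p (SL.trans (image-neg _) (SL.-‿cong p′)))
    image-plus : ∀ {f g f′ g′} → image f ≃ f′ → image g ≃ g′ → image (f SK.+ g) ≃ f′ SL.+ g′
    image-plus p p′ = SL.trans (image-+ _ _) (SL.+-cong p p′)

  image-ψ⁻ : image SK.ψ⁻ ≃ SL.ψ⁻
  image-ψ⁻ = image-plus (image-minus (image-minus (image-T 0 7) (image-T 1 6)) (image-T 2 5)) (image-T 3 4)

  image-ψ⁺ : image SK.ψ⁺ ≃ SL.ψ⁺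
  image-ψ⁺ = image-plus (image-plus (image-plus (image-T 0 7) (image-T 1 6)) (image-T 2 5)) (image-T 3 4)

  image-X : image SK.X ≃ SL.X
  image-X = image-minus (image-plus (image-minus (image-T 0 7) (image-T 1 6)) (image-T 2 5)) (image-T 3 4)

  image-Y : image SK.Y ≃ SL.Y
  image-Y = image-minus (image-T 1 6) (image-T 2 5)

-- Coefficient extraction and division by 1 - c q^e

module GeometricSeries (K : CommutativeRing 0ℓ 0ℓ) where

  open import Data.Nat.DivMod using (_/_; 0/n≡0; +-distrib-/-∣ˡ; n/n≡1)
  open import Data.Nat.Divisibility using (_∣?_; _∣0; ∣-refl; ∣m+n∣m⇒∣n; ∣m∣n⇒∣m+n; >⇒∤)

  private module K = CommutativeRing K
  open ThetaSeries K
  open IntegerSolver seriesRing using (solve; _:=_; _:+_; _:*_; _:-_; con)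

  q^-below : ∀ e f n → n < e → (q ^ e * f) n K.≈ K.0#
  q^-below e f n n<e = below (order-* {b = 0} (order-q^ {e} {e} ℕP.≤-refl) order-0
    (ℕP.≤-reflexive (ℕP.+-comm 0 e))) n n<e

  q-shift : ∀ f n → (q * f) (suc n) K.≈ f n
  q-shift f n = K.trans (K.reflexive (✶-at q f (suc n))) (q-⊛-suc f n)

  q^-shift : ∀ e f n → (q ^ e * f) (e ℕ.+ n) K.≈ f n
  q^-shift zero    f n = at (*-identityˡ f) n
  q^-shift (suc e) f n = K.trans (at (*-assoc q (q ^ e) f) (suc (e ℕ.+ n)))
    (K.trans (q-shift (q ^ e * f) (e ℕ.+ n)) (q^-shift e f n))

  +-at : ∀ f g n → (f + g) n K.≈ f n K.+ g n
  +-at f g n = K.reflexive (✚-at f g n)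

  C-*-at : ∀ c f n → (C c * f) n K.≈ c K.* f n
  C-*-at c f n = K.trans (K.reflexive (✶-at (C c) f n)) (C-⊛ c f n)

  coefficient : K.Carrier → ℕ → ℕ → K.Carrier
  coefficient c e n = if does (e ℕ.≟ n) then c else K.0#

  if-cond : ∀ {b b′} {x y : K.Carrier} → b ≡ b′ → (if b then x else y) ≡ (if b′ then x else y)
  if-cond ≡.refl = ≡.refl

  mono-at : ∀ c e n → mono c e n K.≈ coefficient c e n
  mono-at c e n = K.trans (C-*-at c (q ^ e) n)
    (K.trans (K.*-congˡ (at (sym (*-identityʳ (q ^ e))) n)) (go (ℕP.<-≤-connex n e)))
    where
    go : _ → c K.* (q ^ e * 1#) n K.≈ coefficient c e n
    go (inj₁ n<e) = K.trans (K.*-congˡ (q^-below e 1# n n<e))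
      (K.trans (K.zeroʳ c) (K.reflexive (≡.sym (if-cond (dec-false (e ℕ.≟ n) (ℕP.>⇒≢ n<e))))))
    go (inj₂ e≤n) with ℕP.m≤n⇒∃[o]m+o≡n e≤n
    ... | zero  , ≡.refl = K.trans (K.*-congˡ (q^-shift e 1# 0)) (K.trans (K.*-identityʳ c)
      (K.reflexive (≡.sym (if-cond (dec-true (e ℕ.≟ (e ℕ.+ 0)) (≡.sym (ℕP.+-identityʳ e)))))))
    ... | suc m , ≡.refl = K.trans (K.*-congˡ (q^-shift e 1# (suc m))) (K.trans (K.zeroʳ c)
      (K.reflexive (≡.sym (if-cond (dec-false (e ℕ.≟ (e ℕ.+ suc m))
        (λ p → ℕP.m≢1+m+n e (≡.trans p (ℕP.+-suc e m))))))))

  one-suc : ∀ e .{{_ : NonZero e}} n → one (e ℕ.+ n) K.≈ K.0#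
  one-suc (suc e) n = K.refl

  -- The hypotheses are the coefficient recurrence of f / (1 - c q^e). They allow series given by
  -- their coefficients, such as partition counts, to be recognised as quotients.
  divide-lin : ∀ c e .{{_ : NonZero e}} {f g} →
    (∀ n → n < e → g n K.≈ f n) → (∀ n → g (e ℕ.+ n) K.≈ f (e ℕ.+ n) K.+ c K.* g n) →
    g * lin c e ≃ f
  divide-lin c e {f} {g} low high = trans (*-comm g (lin c e))
    (trans (solve 3 (λ c x g → (con (+ 1) :- c :* x) :* g := g :- c :* (x :* g)) refl (C c) (q ^ e) g)
    (trans (+-congʳ expand)
    (solve 2 (λ f y → (f :+ y) :- y := f) refl f (C c * (q ^ e * g)))))
    where
    high′ : ∀ m n → e ℕ.+ m ≡ n → g n K.≈ (f + C c * (q ^ e * g)) n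
    high′ m _ ≡.refl = K.trans (high m)
      (K.trans (K.+-congˡ (K.trans (K.*-congˡ (K.sym (q^-shift e g m))) (K.sym (C-*-at c (q ^ e * g) (e ℕ.+ m)))))
      (K.sym (+-at f _ (e ℕ.+ m))))
    expand : g ≃ f + C c * (q ^ e * g)
    expand = coeffwise go
      where
      go : ∀ n → g n K.≈ (f + C c * (q ^ e * g)) n
      go n with ℕP.<-≤-connex n e
      ... | inj₁ n<e = K.trans (low n n<e)
        (K.trans (K.sym (K.+-identityʳ _))
        (K.trans (K.+-congˡ (K.sym (K.trans (C-*-at c (q ^ e * g) n)
            (K.trans (K.*-congˡ (q^-below e g n n<e)) (K.zeroʳ c)))))
        (K.sym (+-at f _ n))))
      ... | inj₂ e≤n with ℕP.m≤n⇒∃[o]m+o≡n e≤n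
      ...   | m , eq = high′ m n eq

  -- The series is the expansion of 1/(1 - c q^e). The powers of `c` enter through a recurrence for
  -- `a` because in the crank product they appear as indicators of residues.
  module Dilation (c : K.Carrier) (a : ℕ → K.Carrier) (a-0 : a 0 K.≈ K.1#)
                  (a-suc : ∀ k → a (suc k) K.≈ c K.* a k)
                  (e : ℕ) .{{_ : NonZero e}} (g : Series)
                  (g-def : ∀ n → g n K.≈ (if does (e ∣? n) then a (n / e) else K.0#)) where

    private
      if-cong : ∀ b {x x′ : K.Carrier} → x K.≈ c K.* x′ →
                (if b then x else K.0#) K.≈ c K.* (if b then x′ else K.0#)
      if-cong true  p = p
      if-cong false p = K.sym (K.zeroʳ c)

    dilation-low : ∀ n → n < e → g n K.≈ one n
    dilation-low zero _ = K.trans (g-def 0)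
      (K.trans (K.reflexive (if-cond (dec-true (e ∣? 0) (e ∣0))))
      (K.trans (K.reflexive (≡.cong a (0/n≡0 e))) a-0))
    dilation-low (suc n) n<e = K.trans (g-def (suc n))
      (K.reflexive (if-cond (dec-false (e ∣? suc n) (>⇒∤ n<e))))

    dilation-high : ∀ n → g (e ℕ.+ n) K.≈ c K.* g n
    dilation-high n = K.trans (g-def (e ℕ.+ n))
      (K.trans (K.reflexive (if-cond
         (does-⇔ (mk⇔ (λ p → ∣m+n∣m⇒∣n p ∣-refl) (∣m∣n⇒∣m+n ∣-refl)) (e ∣? (e ℕ.+ n)) (e ∣? n))))
      (K.trans (if-cong (does (e ∣? n))
         (K.trans (K.reflexive (≡.cong a (≡.trans (+-distrib-/-∣ˡ n ∣-refl) (≡.cong (ℕ._+ n / e) (n/n≡1 e))))) (a-suc (n / e))))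
      (K.*-congˡ (K.sym (g-def n)))))

    dilation-inverse : g * lin c e ≃ 1#
    dilation-inverse = divide-lin c e dilation-low
      (λ n → K.trans (dilation-high n) (K.trans (K.sym (K.+-identityˡ _)) (K.+-congʳ (K.sym (one-suc e n)))))

    dilation-order : g ≈[ e ] 1#
    dilation-order = modulo dilation-low

-- The partition generating function

module Partitions (K : CommutativeRing 0ℓ 0ℓ) (ν : ℕ → CommutativeRing.Carrier K)
          (ν-+ : ∀ m n → CommutativeRing._≈_ K (ν (m ℕ.+ n)) (CommutativeRing._+_ K (ν m) (ν n)))
          (ν-0 : CommutativeRing._≈_ K (ν 0) (CommutativeRing.0# K))
          (ν-1 : CommutativeRing._≈_ K (ν 1) (CommutativeRing.1# K)) where

  open import Data.List using (List; _++_; map; concatMap; filter; length; applyUpTo; replicate)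
  open import Data.List.Properties using (length-++; length-map)
  open import Relation.Unary using (Pred; Decidable)

  private module K = CommutativeRing K
  private module KF = FiniteSums K
  open ThetaSeries K
  open GeometricSeries K

  length-concatMap-filter : ∀ {A : Set} {P : Pred ℕ 0ℓ} (P? : Decidable P) (G : ℕ → List A) N f →
    ν (length (concatMap G (filter P? (applyUpTo f N)))) K.≈
    KF.Σ< N (λ j → if does (P? (f j)) then ν (length (G (f j))) else K.0#)
  length-concatMap-filter P? G zero    f = ν-0
  length-concatMap-filter P? G (suc N) f with does (P? (f 0)) | KF.Σ<-head N (λ j → if does (P? (f j)) then ν (length (G (f j))) else K.0#)
  ... | true  | head = K.trans (K.reflexive (≡.cong ν (length-++ (G (f 0)))))
    (K.trans (ν-+ _ _) (K.trans (K.+-congˡ (length-concatMap-filter P? G N (λ j → f (suc j)))) (K.sym head)))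
  ... | false | head = K.trans (length-concatMap-filter P? G N (λ j → f (suc j)))
    (K.trans (K.sym (K.+-identityˡ _)) (K.sym head))

  count : ℕ → Series
  count k n = ν (length (Defs.parts n k))

  module _ (k : ℕ) where
    private
      e : ℕ
      e = suc k

      summand : ℕ → ℕ → K.Carrier
      summand n j = if does (j ℕ.* e ≤? n) then count k (n ∸ j ℕ.* e) else K.0#

      if-≡ : ∀ {A : Set} {x x′ y : A} b → x ≡ x′ → (if b then x else y) ≡ (if b then x′ else y)
      if-≡ b p = ≡.cong (if b then_else _) p

      count-sum : ∀ n → count e n K.≈ KF.Σ< (suc n) (summand n)
      count-sum n = K.trans
        (length-concatMap-filter (λ j → j ℕ.* e ≤? n)
          (λ j → map (replicate j e ++_) (Defs.parts (n ∸ j ℕ.* e) k)) (suc n) (λ j → j))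
        (KF.Σ<-cong (suc n) (λ j → K.reflexive (if-≡ (does (j ℕ.* e ≤? n))
          (≡.cong ν (length-map (replicate j e ++_) (Defs.parts (n ∸ j ℕ.* e) k))))))

      vanish : ∀ n j → n < j → summand n j K.≈ K.0#
      vanish n j n<j = K.reflexive (if-cond (dec-false (j ℕ.* e ≤? n)
        (ℕP.<⇒≱ (ℕP.<-≤-trans n<j (ℕP.m≤m*n j e)))))

      Σ<-bound : ∀ n m → KF.Σ< (suc n ℕ.+ m) (summand n) K.≈ count e n
      Σ<-bound n m = K.trans (KF.Σ<-++ (suc n) m (summand n))
        (K.trans (K.+-cong (K.sym (count-sum n))
          (KF.Σ<-zero m (λ j _ → vanish n (suc n ℕ.+ j) (ℕP.m≤m+n (suc n) j))))
        (K.+-identityʳ _))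

      summand-suc : ∀ n j → summand (e ℕ.+ n) (suc j) ≡ summand n j
      summand-suc n j = ≡.trans
        (if-cond (does-⇔ (mk⇔ (ℕP.+-cancelˡ-≤ e (j ℕ.* e) n) (ℕP.+-monoʳ-≤ e)) (suc j ℕ.* e ≤? (e ℕ.+ n)) (j ℕ.* e ≤? n)))
        (if-≡ (does (j ℕ.* e ≤? n)) (≡.cong (count k) (ℕP.[m+n]∸[m+o]≡n∸o e n (j ℕ.* e))))

    -- Partitions are sorted by the multiplicity j of the part `e`: j = 0 leaves parts up to `k`,
    -- and for j > 0 one copy of `e` is removed. The range of j is longer for e + n than for n, but
    -- the surplus terms vanish.
    count-high : ∀ n → count e (e ℕ.+ n) K.≈ count k (e ℕ.+ n) K.+ K.1# K.* count e n
    count-high n = K.trans (count-sum (e ℕ.+ n))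
      (K.trans (KF.Σ<-head (e ℕ.+ n) (summand (e ℕ.+ n)))
      (K.+-congˡ (K.trans (KF.Σ<-cong (e ℕ.+ n) (λ j → K.reflexive (summand-suc n j)))
        (K.trans (K.reflexive (≡.cong (λ m → KF.Σ< m (summand n)) (≡.cong suc (ℕP.+-comm k n))))
        (K.trans (Σ<-bound n k) (K.sym (K.*-identityˡ _)))))))

    count-low : ∀ n → n < e → count e n K.≈ count k n
    count-low n n<e = K.trans (count-sum n)
      (K.trans (KF.Σ<-head n (summand n))
      (K.trans (K.+-congˡ (KF.Σ<-zero n (λ j _ → K.reflexive (if-cond (dec-false (suc j ℕ.* e ≤? n)
        (ℕP.<⇒≱ (ℕP.<-≤-trans n<e (ℕP.m≤m+n e (j ℕ.* e)))))))))
      (K.+-identityʳ _)))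

    count-lin : count e * lin K.1# e ≃ count k
    count-lin = divide-lin K.1# e count-low count-high

  count-0 : count 0 ≃ 1#
  count-0 = coeffwise λ { zero → ν-1 ; (suc n) → ν-0 }

  count-inverse : ∀ k → count k * prod k (λ i → lin K.1# (1 ℕ.* i)) ≃ 1#
  count-inverse zero    = trans (*-identityʳ _) count-0
  count-inverse (suc k) = trans (*-congˡ (*-comm _ _))
    (trans (sym (*-assoc _ _ _))
    (trans (*-congʳ (trans (*-congˡ (lin-≡ K.1# (ℕP.*-identityˡ (suc k)))) (count-lin k))) (count-inverse k)))

  partitions : Series
  partitions n = ν (Defs.p n)

  -- A part larger than n never occurs in a partition of n, so raising the bound beyond n changes
  -- nothing.
  count-limit : ∀ k → count k ≈[ suc k ] partitions
  count-limit k = modulo λ n n<1+k → stable n k (ℕP.≤-pred n<1+k)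
    where
    stable : ∀ n k → n ≤ k → count k n K.≈ count n n
    stable n zero    z≤n = K.refl
    stable n (suc k) n≤k with ℕP.m≤n⇒m<n∨m≡n n≤k
    ... | inj₁ (s≤s n≤k′) = K.trans (count-low k n (s≤s n≤k′)) (stable n k n≤k′)
    ... | inj₂ ≡.refl     = K.refl

  partitions-inverse : partitions * η 1 K.1# ≃ 1#
  partitions-inverse = ≈[]-limit λ n →
    ≈[]-trans (*-cong-≈[] (≈[]-sym (≈[]-mono (ℕP.n≤1+n n) (count-limit n)))
                          (≈[]-sym (prod≈∏∞ (η-conv 1 K.1#) n n (ℕP.n≤1+n n))))
    (≃⇒≈[] (count-inverse n))

-- The series J and J̄ as power sums

module BilateralTheta where

  open import Data.Integer.Solver using (module +-*-Solver)
  open import Data.Nat.DivMod using ([m+n]%n≡m%n)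

  open CyclicSplitting using (ℚ-ring)
  open CrankSplitting ℚ-ring
  open GeometricSeries ℚ-ring
  private module ℚF = FiniteSums ℚ-ring

  qpow≃ : ∀ k f → Defs.qpow k f ≃ q ^ k * f
  qpow≃ k f = coeffwise λ n → go n (ℕP.<-≤-connex n k)
    where
    go : ∀ n → _ → Defs.qpow k f n ≡ (q ^ k * f) n
    go n (inj₁ n<k) = ≡.trans (if-cond (dec-false (k ≤? n) (ℕP.<⇒≱ n<k))) (≡.sym (q^-below k f n n<k))
    go n (inj₂ k≤n) with ℕP.m≤n⇒∃[o]m+o≡n k≤n
    ... | m , ≡.refl = ≡.trans (if-cond (dec-true (k ≤? (k ℕ.+ m)) (ℕP.m≤m+n k m)))
      (≡.trans (≡.cong f (ℕP.m+n∸m≡n k m)) (≡.sym (q^-shift k f m)))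

  monoSum : (ℕ → ℚ) → (ℕ → ℕ) → Series
  monoSum w e = S (λ k → mono (w k) (e k))

  monoSum-at : ∀ {w e} → (∀ k → k ≤ e k) → ∀ N M → N < M →
               ℚF.Σ< M (λ k → coefficient (w k) (e k) N) ≡ monoSum w e N
  monoSum-at {w} {e} k≤e N M N<M = ≡.trans
    (ℚF.Σ<-cong M (λ k → ≡.sym (mono-at (w k) (e k) N)))
    (≡.trans (≡.sym (Σ<-at M (λ k → mono (w k) (e k)) N))
    (Σ<-stable (λ k → mono-order (w k) (k≤e k)) N M N<M))

  -- window, hit and sgn agree definitionally with private functions of Defs.
  window : ℕ → ℕ → ℤ
  window N k = (+ k) ℤ.- (+ suc N)

  window-sum : ∀ N (t : ℤ → ℚ) → Defs.Σ≤ (2 ℕ.* suc N) (λ k → t (window N k)) ≡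
    ℚF.Σ< (suc N) (λ l → t -[1+ l ]) ℚ.+ ℚF.Σ< (suc (suc N)) (λ j → t (+ j))
  window-sum N t = ≡.trans (Σ≤≡Σ< (2 ℕ.* suc N))
    (≡.trans (≡.cong (λ m → ℚF.Σ< m f) (≡.trans (≡.cong (λ m → suc (suc N ℕ.+ m)) (ℕP.+-identityʳ (suc N)))
                                           (≡.sym (ℕP.+-suc (suc N) (suc N)))))
    (≡.trans (ℚF.Σ<-++ (suc N) (suc (suc N)) f)
    (≡.cong₂ ℚ._+_
      (≡.trans (ℚF.Σ<-reverse (suc N) f) (ℚF.Σ<-cong< (suc N) (λ l l<1+N → ≡.cong t (left l l<1+N))))
      (ℚF.Σ<-cong (suc (suc N)) (λ j → ≡.cong t (right j))))))
    where
    f : ℕ → ℚ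
    f k = t (window N k)
    Σ≤≡Σ< : ∀ n → Defs.Σ≤ n f ≡ ℚF.Σ< (suc n) f
    Σ≤≡Σ< zero    = ≡.sym (ℚP.+-identityˡ _)
    Σ≤≡Σ< (suc n) = ≡.cong (ℚ._+ f (suc n)) (Σ≤≡Σ< n)
    right : ∀ j → window N (suc N ℕ.+ j) ≡ + j
    right j = ≡.trans (ℤP.m-n≡m⊖n (suc N ℕ.+ j) (suc N))
      (≡.trans (ℤP.⊖-≥ (ℕP.m≤m+n (suc N) j)) (≡.cong +_ (ℕP.m+n∸m≡n (suc N) j)))
    left : ∀ l → l < suc N → window N (suc N ∸ suc l) ≡ -[1+ l ]
    left l l<1+N = ≡.trans (ℤP.m-n≡m⊖n (suc N ∸ suc l) (suc N))
      (≡.trans (ℤP.⊖-< (ℕP.∸-monoʳ-< {o = 0} (s≤s z≤n) l<1+N))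
      (≡.cong (λ m → ℤ.- (+ m)) (ℕP.m∸[m∸n]≡n l<1+N)))

  -- Two ways to cut ℤ are provided. For a ≥ m/2 the exponents of J and J̄ have natural coefficients
  -- in k at n = k and n = -(k+1); for a < m/2 they have them at n = -k and n = k+1.
  module Bilateral {F : Series} (t : ℕ → ℤ → ℚ)
                   (F-def : ∀ N → F N ≡ Defs.Σ≤ (2 ℕ.* suc N) (λ k → t N (window N k)))
                   {w w′ : ℕ → ℚ} {e e′ : ℕ → ℕ} (k≤e : ∀ k → k ≤ e k) (k≤e′ : ∀ k → k ≤ e′ k) where

    nonnegative-negative : (∀ N k → t N (+ k) ≡ coefficient (w k) (e k) N) →
                           (∀ N k → t N -[1+ k ] ≡ coefficient (w′ k) (e′ k) N) →
                           F ≃ monoSum w e + monoSum w′ e′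
    nonnegative-negative p p′ = coeffwise λ N → ≡.trans (F-def N)
      (≡.trans (window-sum N (t N))
      (≡.trans (ℚP.+-comm (ℚF.Σ< (suc N) (λ l → t N -[1+ l ])) (ℚF.Σ< (suc (suc N)) (λ j → t N (+ j))))
      (≡.trans (≡.cong₂ ℚ._+_
        (≡.trans (ℚF.Σ<-cong (suc (suc N)) (p N)) (monoSum-at {w} k≤e N (suc (suc N)) (ℕP.m≤n⇒m≤1+n ℕP.≤-refl)))
        (≡.trans (ℚF.Σ<-cong (suc N) (p′ N)) (monoSum-at {w′} k≤e′ N (suc N) ℕP.≤-refl)))
      (≡.sym (+-at (monoSum w e) (monoSum w′ e′) N)))))

    nonpositive-positive : (∀ N k → t N (ℤ.- (+ k)) ≡ coefficient (w k) (e k) N) →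
                           (∀ N k → t N (+ suc k) ≡ coefficient (w′ k) (e′ k) N) →
                           F ≃ monoSum w e + monoSum w′ e′
    nonpositive-positive p p′ = coeffwise λ N → ≡.trans (F-def N)
      (≡.trans (window-sum N (t N))
      (≡.trans (≡.cong (ℚF.Σ< (suc N) (λ l → t N -[1+ l ]) ℚ.+_) (ℚF.Σ<-head (suc N) (λ j → t N (+ j))))
      (≡.trans (≡.sym (ℚP.+-assoc (ℚF.Σ< (suc N) (λ l → t N -[1+ l ])) (t N (+ 0)) _))
      (≡.trans (≡.cong₂ ℚ._+_
        (≡.trans (ℚP.+-comm _ (t N (+ 0)))
          (≡.trans (≡.sym (ℚF.Σ<-head (suc N) (λ k → t N (ℤ.- (+ k)))))
          (≡.trans (ℚF.Σ<-cong (suc (suc N)) (p N)) (monoSum-at {w} k≤e N (suc (suc N)) (ℕP.m≤n⇒m≤1+n ℕP.≤-refl)))))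
        (≡.trans (ℚF.Σ<-cong (suc N) (p′ N)) (monoSum-at {w′} k≤e′ N (suc N) ℕP.≤-refl)))
      (≡.sym (+-at (monoSum w e) (monoSum w′ e′) N))))))

  hit : ℕ → ℕ → ℕ → ℤ → ℚ
  hit a m N n =
    if does (((+ m) ℤ.* n ℤ.* (n ℤ.- + 1)) ℤ.+ ((+ (2 ℕ.* a)) ℤ.* n) ℤ.≟ + (2 ℕ.* N))
    then 1ℚ else 0ℚ

  sgn : ℤ → ℚ
  sgn n = if does (ℤ.∣ n ∣ ℕ.% 2 ℕ.≟ 0) then 1ℚ else ℚ.- 1ℚ

  quad : ℕ → ℕ → ℕ → ℕ → ℕ
  quad α β γ k = α ℕ.* (k ℕ.* k) ℕ.+ β ℕ.* k ℕ.+ γ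

  quadℤ : ℕ → ℕ → ℕ → ℤ → ℤ
  quadℤ α β γ x = (+ 2) ℤ.* ((+ α) ℤ.* (x ℤ.* x) ℤ.+ (+ β) ℤ.* x ℤ.+ (+ γ))

  quad≡quadℤ : ∀ α β γ k → + (2 ℕ.* quad α β γ k) ≡ quadℤ α β γ (+ k)
  quad≡quadℤ α β γ k = ≡.trans (ℤP.pos-* 2 (quad α β γ k)) (≡.cong ((+ 2) ℤ.*_)
    (≡.cong (ℤ._+ + γ) (≡.cong₂ ℤ._+_
      (≡.trans (ℤP.pos-* α (k ℕ.* k)) (≡.cong ((+ α) ℤ.*_) (ℤP.pos-* k k)))
      (ℤP.pos-* β k))))

  quad-≥ : ∀ α β γ .{{_ : ℕ.NonZero α}} k → k ≤ quad α β γ k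
  quad-≥ α β γ k = ℕP.≤-trans (n≤square k) (ℕP.≤-trans (ℕP.m≤n*m (k ℕ.* k) α)
    (ℕP.≤-trans (ℕP.m≤m+n _ (β ℕ.* k)) (ℕP.m≤m+n _ γ)))

  -- `hit` compares doubled exponents in ℤ. Cancelling the 2 and the embedding of ℕ turns its test
  -- into one on the natural number `quad α β γ k`.
  hit-quad : ∀ a m α β γ N n k →
    ((+ m) ℤ.* n ℤ.* (n ℤ.- + 1)) ℤ.+ ((+ (2 ℕ.* a)) ℤ.* n) ≡ quadℤ α β γ (+ k) →
    hit a m N n ≡ coefficient 1ℚ (quad α β γ k) N
  hit-quad a m α β γ N n k eq = if-cond (does-⇔ (mk⇔
    (λ p → ℕP.*-cancelˡ-≡ (quad α β γ k) N 2 (ℤP.+-injective (≡.trans (≡.sym eq′) p)))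
    (λ p → ≡.trans eq′ (≡.cong (λ e → + (2 ℕ.* e)) p))) (_ ℤ.≟ _) (quad α β γ k ℕ.≟ N))
    where
    eq′ = ≡.trans eq (≡.sym (quad≡quadℤ α β γ k))

  quadSum : ℕ → ℕ → ℕ → Series
  quadSum α β γ = powerSum (quad α β γ)

  monoSum-1 : ∀ e → monoSum (λ _ → 1ℚ) e ≃ powerSum e
  monoSum-1 e = S-cong (λ k → mono-1 (e k))

  open +-*-Solver using () renaming (solve to solveℤ; _:=_ to _:=ℤ_; _:*_ to _:*ℤ_; _:+_ to _:+ℤ_; _:-_ to _:-ℤ_; :-_ to :-ℤ_; con to conℤ)

  module JbarExpansion (a m α β γ α′ β′ γ′ : ℕ) .{{_ : ℕ.NonZero α}} .{{_ : ℕ.NonZero α′}} where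
    from-zero : (∀ x → (+ m) ℤ.* x ℤ.* (x ℤ.- + 1) ℤ.+ (+ (2 ℕ.* a)) ℤ.* x ≡ quadℤ α β γ x) →
      (∀ x → (+ m) ℤ.* (ℤ.- (+ 1 ℤ.+ x)) ℤ.* (ℤ.- (+ 1 ℤ.+ x) ℤ.- + 1) ℤ.+ (+ (2 ℕ.* a)) ℤ.* (ℤ.- (+ 1 ℤ.+ x)) ≡ quadℤ α′ β′ γ′ x) →
      Defs.Jbar a m ≃ quadSum α β γ + quadSum α′ β′ γ′
    from-zero p p′ = trans
      (Bilateral.nonnegative-negative (hit a m) (λ N → ≡.refl) (quad-≥ α β γ) (quad-≥ α′ β′ γ′)
        (λ N k → hit-quad a m α β γ N (+ k) k (p (+ k)))
        (λ N k → hit-quad a m α′ β′ γ′ N -[1+ k ] k (p′ (+ k))))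
      (+-cong (monoSum-1 (quad α β γ)) (monoSum-1 (quad α′ β′ γ′)))

    from-one : (∀ x → (+ m) ℤ.* (ℤ.- x) ℤ.* (ℤ.- x ℤ.- + 1) ℤ.+ (+ (2 ℕ.* a)) ℤ.* (ℤ.- x) ≡ quadℤ α β γ x) →
      (∀ x → (+ m) ℤ.* (+ 1 ℤ.+ x) ℤ.* ((+ 1 ℤ.+ x) ℤ.- + 1) ℤ.+ (+ (2 ℕ.* a)) ℤ.* (+ 1 ℤ.+ x) ≡ quadℤ α′ β′ γ′ x) →
      Defs.Jbar a m ≃ quadSum α β γ + quadSum α′ β′ γ′
    from-one p p′ = trans
      (Bilateral.nonpositive-positive (hit a m) (λ N → ≡.refl) (quad-≥ α β γ) (quad-≥ α′ β′ γ′)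
        (λ N k → hit-quad a m α β γ N (ℤ.- (+ k)) k (p (+ k)))
        (λ N k → hit-quad a m α′ β′ γ′ N (+ suc k) k (p′ (+ k))))
      (+-cong (monoSum-1 (quad α β γ)) (monoSum-1 (quad α′ β′ γ′)))

  q^-quadSum : ∀ s α β γ .{{_ : ℕ.NonZero α}} (f : ℕ → ℕ) → (∀ k → s ℕ.+ quad α β γ k ≡ f k) →
               q ^ s * quadSum α β γ ≃ powerSum f
  q^-quadSum s α β γ f p = trans (sym (S-*ˡ (q ^ s) (λ k → order-q^ (quad-≥ α β γ k))))
    (S-cong (λ k → trans (sym (^-homo-* q s (quad α β γ k))) (reflexive (≡.cong (q ^_) (p k)))))

  2*tri : ∀ n → 2 ℕ.* tri n ≡ n ℕ.* suc n
  2*tri zero    = ≡.refl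
  2*tri (suc n) = ≡.trans (ℕP.*-distribˡ-+ 2 (suc n) (tri n))
    (≡.trans (≡.cong (2 ℕ.* suc n ℕ.+_) (2*tri n)) (eq n))
    where
    eq : ∀ n → 2 ℕ.* (1 ℕ.+ n) ℕ.+ n ℕ.* (1 ℕ.+ n) ≡ (1 ℕ.+ n) ℕ.* (2 ℕ.+ n)
    eq = ℕSolver.solve-∀

  -- Doubling turns T(n) into the polynomial n(n + 1), which brings the hypothesis within reach of
  -- the ring solver.
  tri-quad : ∀ s a α β γ → (∀ k → 2 ℕ.* (s ℕ.+ quad α β γ k) ≡ (k ℕ.* 8 ℕ.+ a) ℕ.* (1 ℕ.+ (k ℕ.* 8 ℕ.+ a))) →
             ∀ k → s ℕ.+ quad α β γ k ≡ tri (k ℕ.* 8 ℕ.+ a)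
  tri-quad s a α β γ p k = ℕP.*-cancelˡ-≡ _ _ 2 (≡.trans (p k) (≡.sym (2*tri (k ℕ.* 8 ℕ.+ a))))

  U-quad : ∀ s a α β γ .{{_ : ℕ.NonZero α}} →
    (∀ k → 2 ℕ.* (s ℕ.+ quad α β γ k) ≡ (k ℕ.* 8 ℕ.+ a) ℕ.* (1 ℕ.+ (k ℕ.* 8 ℕ.+ a))) →
    q ^ s * quadSum α β γ ≃ U a
  U-quad s a α β γ p = q^-quadSum s α β γ (λ k → tri (k ℕ.* 8 ℕ.+ a)) (tri-quad s a α β γ p)

  shifted-sum : ∀ s {F f g f′ g′} → F ≃ f + g → q ^ s * f ≃ f′ → q ^ s * g ≃ g′ → Defs.qpow s F ≃ f′ + g′
  shifted-sum s {F} p pf pg = trans (qpow≃ s F) (trans (*-congˡ p) (trans (distribˡ _ _ _) (+-cong pf pg)))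

  -- Since T(-1-j) = T(j), the sum of q^(T(8n+r)) over all integers n runs through the residues r
  -- and 7 - r. The shifts 0, 1, 3, 6 of the four series are T(r) for r = 0, 1, 2, 3.
  qpow-Jbar-28-64 : Defs.qpow 0 (Defs.Jbar 28 64) ≃ U 0 + U 7
  qpow-Jbar-28-64 = shifted-sum 0
    (JbarExpansion.from-one 28 64 32 4 0 32 60 28
      (solveℤ 1 (λ x → conℤ (+ 64) :*ℤ (:-ℤ x) :*ℤ ((:-ℤ x) :-ℤ conℤ (+ 1)) :+ℤ conℤ (+ 56) :*ℤ (:-ℤ x)
        :=ℤ conℤ (+ 2) :*ℤ (conℤ (+ 32) :*ℤ (x :*ℤ x) :+ℤ conℤ (+ 4) :*ℤ x :+ℤ conℤ (+ 0))) ≡.refl)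
      (solveℤ 1 (λ x → conℤ (+ 64) :*ℤ (conℤ (+ 1) :+ℤ x) :*ℤ ((conℤ (+ 1) :+ℤ x) :-ℤ conℤ (+ 1)) :+ℤ conℤ (+ 56) :*ℤ (conℤ (+ 1) :+ℤ x)
        :=ℤ conℤ (+ 2) :*ℤ (conℤ (+ 32) :*ℤ (x :*ℤ x) :+ℤ conℤ (+ 60) :*ℤ x :+ℤ conℤ (+ 28))) ≡.refl))
    (U-quad 0 0 32 4 0 eq₁)
    (U-quad 0 7 32 60 28 eq₂)
    where
    eq₁ : ∀ k → 2 ℕ.* (0 ℕ.+ (32 ℕ.* (k ℕ.* k) ℕ.+ 4 ℕ.* k ℕ.+ 0)) ≡ (k ℕ.* 8 ℕ.+ 0) ℕ.* (1 ℕ.+ (k ℕ.* 8 ℕ.+ 0))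
    eq₁ = ℕSolver.solve-∀
    eq₂ : ∀ k → 2 ℕ.* (0 ℕ.+ (32 ℕ.* (k ℕ.* k) ℕ.+ 60 ℕ.* k ℕ.+ 28)) ≡ (k ℕ.* 8 ℕ.+ 7) ℕ.* (1 ℕ.+ (k ℕ.* 8 ℕ.+ 7))
    eq₂ = ℕSolver.solve-∀

  qpow-Jbar-20-64 : Defs.qpow 1 (Defs.Jbar 20 64) ≃ U 1 + U 6
  qpow-Jbar-20-64 = shifted-sum 1
    (JbarExpansion.from-one 20 64 32 12 0 32 52 20
      (solveℤ 1 (λ x → conℤ (+ 64) :*ℤ (:-ℤ x) :*ℤ ((:-ℤ x) :-ℤ conℤ (+ 1)) :+ℤ conℤ (+ 40) :*ℤ (:-ℤ x)
        :=ℤ conℤ (+ 2) :*ℤ (conℤ (+ 32) :*ℤ (x :*ℤ x) :+ℤ conℤ (+ 12) :*ℤ x :+ℤ conℤ (+ 0))) ≡.refl)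
      (solveℤ 1 (λ x → conℤ (+ 64) :*ℤ (conℤ (+ 1) :+ℤ x) :*ℤ ((conℤ (+ 1) :+ℤ x) :-ℤ conℤ (+ 1)) :+ℤ conℤ (+ 40) :*ℤ (conℤ (+ 1) :+ℤ x)
        :=ℤ conℤ (+ 2) :*ℤ (conℤ (+ 32) :*ℤ (x :*ℤ x) :+ℤ conℤ (+ 52) :*ℤ x :+ℤ conℤ (+ 20))) ≡.refl))
    (U-quad 1 1 32 12 0 eq₁)
    (U-quad 1 6 32 52 20 eq₂)
    where
    eq₁ : ∀ k → 2 ℕ.* (1 ℕ.+ (32 ℕ.* (k ℕ.* k) ℕ.+ 12 ℕ.* k ℕ.+ 0)) ≡ (k ℕ.* 8 ℕ.+ 1) ℕ.* (1 ℕ.+ (k ℕ.* 8 ℕ.+ 1))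
    eq₁ = ℕSolver.solve-∀
    eq₂ : ∀ k → 2 ℕ.* (1 ℕ.+ (32 ℕ.* (k ℕ.* k) ℕ.+ 52 ℕ.* k ℕ.+ 20)) ≡ (k ℕ.* 8 ℕ.+ 6) ℕ.* (1 ℕ.+ (k ℕ.* 8 ℕ.+ 6))
    eq₂ = ℕSolver.solve-∀

  qpow-Jbar-52-64 : Defs.qpow 3 (Defs.Jbar 52 64) ≃ U 2 + U 5
  qpow-Jbar-52-64 = shifted-sum 3
    (JbarExpansion.from-zero 52 64 32 20 0 32 44 12
      (solveℤ 1 (λ x → conℤ (+ 64) :*ℤ x :*ℤ (x :-ℤ conℤ (+ 1)) :+ℤ conℤ (+ 104) :*ℤ x
        :=ℤ conℤ (+ 2) :*ℤ (conℤ (+ 32) :*ℤ (x :*ℤ x) :+ℤ conℤ (+ 20) :*ℤ x :+ℤ conℤ (+ 0))) ≡.refl)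
      (solveℤ 1 (λ x → conℤ (+ 64) :*ℤ (:-ℤ (conℤ (+ 1) :+ℤ x)) :*ℤ ((:-ℤ (conℤ (+ 1) :+ℤ x)) :-ℤ conℤ (+ 1)) :+ℤ conℤ (+ 104) :*ℤ (:-ℤ (conℤ (+ 1) :+ℤ x))
        :=ℤ conℤ (+ 2) :*ℤ (conℤ (+ 32) :*ℤ (x :*ℤ x) :+ℤ conℤ (+ 44) :*ℤ x :+ℤ conℤ (+ 12))) ≡.refl))
    (U-quad 3 2 32 20 0 eq₁)
    (U-quad 3 5 32 44 12 eq₂)
    where
    eq₁ : ∀ k → 2 ℕ.* (3 ℕ.+ (32 ℕ.* (k ℕ.* k) ℕ.+ 20 ℕ.* k ℕ.+ 0)) ≡ (k ℕ.* 8 ℕ.+ 2) ℕ.* (1 ℕ.+ (k ℕ.* 8 ℕ.+ 2))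
    eq₁ = ℕSolver.solve-∀
    eq₂ : ∀ k → 2 ℕ.* (3 ℕ.+ (32 ℕ.* (k ℕ.* k) ℕ.+ 44 ℕ.* k ℕ.+ 12)) ≡ (k ℕ.* 8 ℕ.+ 5) ℕ.* (1 ℕ.+ (k ℕ.* 8 ℕ.+ 5))
    eq₂ = ℕSolver.solve-∀

  qpow-Jbar-60-64 : Defs.qpow 6 (Defs.Jbar 60 64) ≃ U 3 + U 4
  qpow-Jbar-60-64 = shifted-sum 6
    (JbarExpansion.from-zero 60 64 32 28 0 32 36 4
      (solveℤ 1 (λ x → conℤ (+ 64) :*ℤ x :*ℤ (x :-ℤ conℤ (+ 1)) :+ℤ conℤ (+ 120) :*ℤ x
        :=ℤ conℤ (+ 2) :*ℤ (conℤ (+ 32) :*ℤ (x :*ℤ x) :+ℤ conℤ (+ 28) :*ℤ x :+ℤ conℤ (+ 0))) ≡.refl)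
      (solveℤ 1 (λ x → conℤ (+ 64) :*ℤ (:-ℤ (conℤ (+ 1) :+ℤ x)) :*ℤ ((:-ℤ (conℤ (+ 1) :+ℤ x)) :-ℤ conℤ (+ 1)) :+ℤ conℤ (+ 120) :*ℤ (:-ℤ (conℤ (+ 1) :+ℤ x))
        :=ℤ conℤ (+ 2) :*ℤ (conℤ (+ 32) :*ℤ (x :*ℤ x) :+ℤ conℤ (+ 36) :*ℤ x :+ℤ conℤ (+ 4))) ≡.refl))
    (U-quad 6 3 32 28 0 eq₁)
    (U-quad 6 4 32 36 4 eq₂)
    where
    eq₁ : ∀ k → 2 ℕ.* (6 ℕ.+ (32 ℕ.* (k ℕ.* k) ℕ.+ 28 ℕ.* k ℕ.+ 0)) ≡ (k ℕ.* 8 ℕ.+ 3) ℕ.* (1 ℕ.+ (k ℕ.* 8 ℕ.+ 3))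
    eq₁ = ℕSolver.solve-∀
    eq₂ : ∀ k → 2 ℕ.* (6 ℕ.+ (32 ℕ.* (k ℕ.* k) ℕ.+ 36 ℕ.* k ℕ.+ 4)) ≡ (k ℕ.* 8 ℕ.+ 4) ℕ.* (1 ℕ.+ (k ℕ.* 8 ℕ.+ 4))
    eq₂ = ℕSolver.solve-∀

  Jbar-4-8 : Defs.Jbar 4 8 ≃ squares-even + squares-even⁺
  Jbar-4-8 = trans
    (JbarExpansion.from-zero 4 8 4 0 0 4 8 4
      (solveℤ 1 (λ x → conℤ (+ 8) :*ℤ x :*ℤ (x :-ℤ conℤ (+ 1)) :+ℤ conℤ (+ 8) :*ℤ x
        :=ℤ conℤ (+ 2) :*ℤ (conℤ (+ 4) :*ℤ (x :*ℤ x) :+ℤ conℤ (+ 0) :*ℤ x :+ℤ conℤ (+ 0))) ≡.refl)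
      (solveℤ 1 (λ x → conℤ (+ 8) :*ℤ (:-ℤ (conℤ (+ 1) :+ℤ x)) :*ℤ ((:-ℤ (conℤ (+ 1) :+ℤ x)) :-ℤ conℤ (+ 1)) :+ℤ conℤ (+ 8) :*ℤ (:-ℤ (conℤ (+ 1) :+ℤ x))
        :=ℤ conℤ (+ 2) :*ℤ (conℤ (+ 4) :*ℤ (x :*ℤ x) :+ℤ conℤ (+ 8) :*ℤ x :+ℤ conℤ (+ 4))) ≡.refl))
    (+-cong (powerSum-cong eq₁) (powerSum-cong eq₂))
    where
    eq₁ : ∀ k → 4 ℕ.* (k ℕ.* k) ℕ.+ 0 ℕ.* k ℕ.+ 0 ≡ (k ℕ.* 2) ℕ.* (k ℕ.* 2)
    eq₁ = ℕSolver.solve-∀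
    eq₂ : ∀ k → 4 ℕ.* (k ℕ.* k) ℕ.+ 8 ℕ.* k ℕ.+ 4 ≡ (2 ℕ.+ k ℕ.* 2) ℕ.* (2 ℕ.+ k ℕ.* 2)
    eq₂ = ℕSolver.solve-∀

  -- The exponent at n is 1 + 4n(n-1) = (2n-1)², so n and 1 - n give the same odd square and each
  -- one occurs twice.
  qpow-Jbar-0-8 : Defs.qpow 1 (Defs.Jbar 0 8) ≃ squares-odd + squares-odd
  qpow-Jbar-0-8 = shifted-sum 1
    (JbarExpansion.from-one 0 8 4 4 0 4 4 0
      (solveℤ 1 (λ x → conℤ (+ 8) :*ℤ (:-ℤ x) :*ℤ ((:-ℤ x) :-ℤ conℤ (+ 1)) :+ℤ conℤ (+ 0) :*ℤ (:-ℤ x)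
        :=ℤ conℤ (+ 2) :*ℤ (conℤ (+ 4) :*ℤ (x :*ℤ x) :+ℤ conℤ (+ 4) :*ℤ x :+ℤ conℤ (+ 0))) ≡.refl)
      (solveℤ 1 (λ x → conℤ (+ 8) :*ℤ (conℤ (+ 1) :+ℤ x) :*ℤ ((conℤ (+ 1) :+ℤ x) :-ℤ conℤ (+ 1)) :+ℤ conℤ (+ 0) :*ℤ (conℤ (+ 1) :+ℤ x)
        :=ℤ conℤ (+ 2) :*ℤ (conℤ (+ 4) :*ℤ (x :*ℤ x) :+ℤ conℤ (+ 4) :*ℤ x :+ℤ conℤ (+ 0))) ≡.refl))
    odd odd
    where
    eq : ∀ k → 1 ℕ.+ (4 ℕ.* (k ℕ.* k) ℕ.+ 4 ℕ.* k ℕ.+ 0) ≡ (1 ℕ.+ k ℕ.* 2) ℕ.* (1 ℕ.+ k ℕ.* 2)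
    eq = ℕSolver.solve-∀
    odd : q ^ 1 * quadSum 4 4 0 ≃ squares-odd
    odd = q^-quadSum 1 4 4 0 (λ k → square (suc (k ℕ.* 2))) eq

  sgn-pos : ∀ k → sgn (+ k) ≡ -1K ^K k
  sgn-pos zero          = ≡.refl
  sgn-pos (suc zero)    = ≡.refl
  sgn-pos (suc (suc k)) = ≡.trans (if-cond (≡.cong (λ r → does (r ℕ.≟ 0)) (≡.trans (≡.cong (ℕ._% 2) (ℕP.+-comm 2 k)) ([m+n]%n≡m%n k 2))))
    (≡.trans (sgn-pos k) (square-neg (-1K ^K k)))
    where
    square-neg : ∀ x → x ≡ -1K ℚ.* (-1K ℚ.* x)
    square-neg x = ≡.sym (≡.trans (≡.sym (ℚP.*-assoc -1K -1K x)) (ℚP.*-identityˡ x))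

  J-4-8 : Defs.J 4 8 ≃ φ 4
  J-4-8 = trans
    (Bilateral.nonnegative-negative (λ N n → sgn n ℚ.* hit 4 8 N n) (λ N → ≡.refl)
      (quad-≥ 4 0 0) (quad-≥ 4 8 4)
      (λ N k → signed (quad 4 0 0 k) N (sgn-pos k) (hit-quad 4 8 4 0 0 N (+ k) k (eqℤ₁ (+ k))))
      (λ N k → signed (quad 4 8 4 k) N (sgn-pos (suc k)) (hit-quad 4 8 4 8 4 N -[1+ k ] k (eqℤ₂ (+ k)))))
    (+-cong (S-cong (λ k → mono-cong {e = 4 ℕ.* square k} ≡.refl (eq₁ k)))
            (S-cong (λ k → mono-cong {e = 4 ℕ.* square (suc k)} ≡.refl (eq₂ k))))
    where
    eq₁ : ∀ k → 4 ℕ.* (k ℕ.* k) ℕ.+ 0 ℕ.* k ℕ.+ 0 ≡ 4 ℕ.* (k ℕ.* k)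
    eq₁ = ℕSolver.solve-∀
    eq₂ : ∀ k → 4 ℕ.* (k ℕ.* k) ℕ.+ 8 ℕ.* k ℕ.+ 4 ≡ 4 ℕ.* ((1 ℕ.+ k) ℕ.* (1 ℕ.+ k))
    eq₂ = ℕSolver.solve-∀
    eqℤ₁ : ∀ x → (+ 8) ℤ.* x ℤ.* (x ℤ.- + 1) ℤ.+ (+ 8) ℤ.* x ≡ quadℤ 4 0 0 x
    eqℤ₁ = solveℤ 1 (λ x → conℤ (+ 8) :*ℤ x :*ℤ (x :-ℤ conℤ (+ 1)) :+ℤ conℤ (+ 8) :*ℤ x
        :=ℤ conℤ (+ 2) :*ℤ (conℤ (+ 4) :*ℤ (x :*ℤ x) :+ℤ conℤ (+ 0) :*ℤ x :+ℤ conℤ (+ 0))) ≡.refl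
    eqℤ₂ : ∀ x → (+ 8) ℤ.* (ℤ.- (+ 1 ℤ.+ x)) ℤ.* (ℤ.- (+ 1 ℤ.+ x) ℤ.- + 1) ℤ.+ (+ 8) ℤ.* (ℤ.- (+ 1 ℤ.+ x)) ≡ quadℤ 4 8 4 x
    eqℤ₂ = solveℤ 1 (λ x → conℤ (+ 8) :*ℤ (:-ℤ (conℤ (+ 1) :+ℤ x)) :*ℤ ((:-ℤ (conℤ (+ 1) :+ℤ x)) :-ℤ conℤ (+ 1)) :+ℤ conℤ (+ 8) :*ℤ (:-ℤ (conℤ (+ 1) :+ℤ x))
        :=ℤ conℤ (+ 2) :*ℤ (conℤ (+ 4) :*ℤ (x :*ℤ x) :+ℤ conℤ (+ 8) :*ℤ x :+ℤ conℤ (+ 4))) ≡.refl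
    if-* : ∀ b w → w ℚ.* (if b then 1ℚ else 0ℚ) ≡ (if b then w else 0ℚ)
    if-* true  w = ℚP.*-identityʳ w
    if-* false w = ℚP.*-zeroʳ w
    signed : ∀ {s w h} e N → s ≡ w → h ≡ coefficient 1ℚ e N → s ℚ.* h ≡ coefficient w e N
    signed {w = w} e N p p′ = ≡.trans (≡.cong₂ ℚ._*_ p p′) (if-* (does (e ℕ.≟ N)) w)

-- The crank generating function over the rational group algebra

module CrankSeries where

  open import Data.Fin as Fin using (Fin; zero; suc; toℕ; #_)
  open import Data.Fin.Properties using (all?; toℕ-injective; toℕ-fromℕ<)
  open import Data.Nat.DivMod using (_mod_; _%_; _/_; %-distribˡ-+; m%n%n≡m%n; m%n<n)
  open import Data.Nat.Divisibility using (_∣?_)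
  open import Data.Rational.Unnormalised as ℚᵘ using (mkℚᵘ; *≡*)
  import Data.Rational.Unnormalised.Properties as ℚᵘP
  open Defs using (⟦_⟧)

  open CyclicSplitting
  open AG hiding (Splitting; 2K; 8K; thetaWeight; _^K_)
  private module KA = CommutativeRing groupAlgebra

  toℚᵘ-⟦⟧ : ∀ i → ℚ.toℚᵘ ⟦ i ⟧ ℚᵘ.≃ mkℚᵘ i 0
  toℚᵘ-⟦⟧ i = ℚP.toℚᵘ-fromℚᵘ (mkℚᵘ i 0)

  ⟦⟧-+ : ∀ i j → ⟦ i ℤ.+ j ⟧ ≡ ⟦ i ⟧ ℚ.+ ⟦ j ⟧
  ⟦⟧-+ i j = ℚP.toℚᵘ-injective (ℚᵘP.≃-trans (toℚᵘ-⟦⟧ (i ℤ.+ j))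
    (ℚᵘP.≃-trans (*≡* (≡.cong (ℤ._* + 1) (≡.sym (≡.cong₂ ℤ._+_ (ℤP.*-identityʳ i) (ℤP.*-identityʳ j)))))
    (ℚᵘP.≃-trans (ℚᵘP.+-cong (ℚᵘP.≃-sym (toℚᵘ-⟦⟧ i)) (ℚᵘP.≃-sym (toℚᵘ-⟦⟧ j)))
    (ℚᵘP.≃-sym (ℚP.toℚᵘ-homo-+ ⟦ i ⟧ ⟦ j ⟧)))))

  ⟦⟧-* : ∀ i j → ⟦ i ℤ.* j ⟧ ≡ ⟦ i ⟧ ℚ.* ⟦ j ⟧
  ⟦⟧-* i j = ℚP.toℚᵘ-injective (ℚᵘP.≃-trans (toℚᵘ-⟦⟧ (i ℤ.* j))
    (ℚᵘP.≃-trans (ℚᵘP.*-cong (ℚᵘP.≃-sym (toℚᵘ-⟦⟧ i)) (ℚᵘP.≃-sym (toℚᵘ-⟦⟧ j)))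
    (ℚᵘP.≃-sym (ℚP.toℚᵘ-homo-* ⟦ i ⟧ ⟦ j ⟧))))

  module GR = Defs.GroupRing 8

  cast : GR.GR → Element
  cast u r = ⟦ u r ⟧

  cast-* : ∀ u v → cast (u GR.*G v) ≈A cast u *A cast v
  cast-* u v r = sums (λ s → u s ℤ.* v (r ⊖ s)) (λ s → ⟦ u s ⟧ ℚ.* ⟦ v (r ⊖ s) ⟧) (λ s → ⟦⟧-* (u s) (v (r ⊖ s)))
    where
    open import Algebra.Properties.Semiring.Sum (CommutativeRing.semiring ℚ-ring) using (sum)
    sums : ∀ {n} (f : Fin n → ℤ) (g : Fin n → ℚ) → (∀ s → ⟦ f s ⟧ ≡ g s) → ⟦ GR.sumFin f ⟧ ≡ sum g
    sums {zero}  f g p = ≡.refl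
    sums {suc n} f g p = ≡.trans (⟦⟧-+ (f zero) (GR.sumFin (λ i → f (suc i)))) (≡.cong₂ ℚ._+_ (p zero) (sums (λ i → f (suc i)) (λ i → g (suc i)) (λ i → p (suc i))))

  cast-1 : cast GR.1G ≈A δ zero
  cast-1 = from-yes (all? λ r → cast GR.1G r ℚP.≟ δ zero r)

  open SeriesImage GR._+G_ GR._*G_ GR.0G GR.1G groupAlgebra cast (λ u v r → ⟦⟧-+ (u r) (v r)) cast-* (λ _ → ≡.refl) cast-1
  open GeometricSeries groupAlgebra

  crank : Series
  crank = image GR.crankGF

  image-oneMinusQ : ∀ i → image (GR.oneMinusQ (suc i)) ≃ lin KA.1# (suc i)
  image-oneMinusQ i = coeffwise λ n → KA.trans (go n) (KA.sym (KA.trans (+-at 1# (- mono KA.1# (suc i)) n)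
      (KA.+-congˡ {one n} (KA.trans (KA.reflexive (negS-at (mono KA.1# (suc i)) n)) (KA.-‿cong (mono-at KA.1# (suc i) n))))))
    where
    go : ∀ n → image (GR.oneMinusQ (suc i)) n KA.≈ one n KA.+ KA.- coefficient KA.1# (suc i) n
    go zero = KA.trans cast-1 (from-yes (all? λ r → δ zero r ℚP.≟ (KA.1# KA.+ KA.- KA.0#) r))
    go (suc n) with n ℕ.≟ i
    ... | yes ≡.refl = KA.trans
            (KA.reflexive (≡.cong (λ b → cast (if b then (λ r → ℤ.- GR.1G r) else GR.0G)) (ℕ≟-refl n)))
            (KA.trans (from-yes (all? λ r → ⟦ ℤ.- GR.1G r ⟧ ℚP.≟ (KA.0# KA.+ KA.- KA.1#) r))
            (KA.reflexive (≡.cong (λ b → KA.0# KA.+ KA.- (if b then KA.1# else KA.0#)) (≡.sym (ℕ≟-refl n)))))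
      where
      ℕ≟-refl : ∀ n → does (suc n ℕ.≟ suc n) ≡ true
      ℕ≟-refl n = dec-true (suc n ℕ.≟ suc n) ≡.refl
    ... | no n≢i = KA.trans
            (KA.reflexive (≡.cong (λ b → cast (if b then (λ r → ℤ.- GR.1G r) else GR.0G)) (dec-false (suc n ℕ.≟ suc i) (λ p → n≢i (ℕP.suc-injective p)))))
            (KA.trans (from-yes (all? λ r → 0ℚ ℚP.≟ (KA.0# KA.+ KA.- KA.0#) r))
            (KA.reflexive (≡.cong (λ b → KA.0# KA.+ KA.- (if b then KA.1# else KA.0#))
              (≡.sym (dec-false (suc i ℕ.≟ suc n) (λ p → n≢i (≡.sym (ℕP.suc-injective p))))))))

  mod-+ : ∀ m k → (m ℕ.+ k) mod 8 ≡ (m ℕ.+ toℕ (k mod 8)) mod 8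
  mod-+ m k = toℕ-injective (≡.trans (toℕ-mod (m ℕ.+ k)) (≡.trans eq
    (≡.trans (≡.cong (λ x → (m ℕ.+ x) % 8) (≡.sym (toℕ-mod k))) (≡.sym (toℕ-mod (m ℕ.+ toℕ (k mod 8)))))))
    where
    toℕ-mod : ∀ k → toℕ (k mod 8) ≡ k % 8
    toℕ-mod k = toℕ-fromℕ< (m%n<n k 8)
    eq : (m ℕ.+ k) % 8 ≡ (m ℕ.+ k % 8) % 8
    eq = ≡.trans (%-distribˡ-+ m k 8) (≡.sym (≡.trans (%-distribˡ-+ m (k % 8) 8)
      (≡.cong (λ x → (m % 8 ℕ.+ x) % 8) (m%n%n≡m%n k 8))))

  indicator : Fin 8 → Element
  indicator t r = ⟦ if does (r Fin.≟ t) then + 1 else + 0 ⟧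

  -- `k` ranges over all of ℕ; `mod-+` reduces it to a residue, and the remaining claim about three
  -- residues is decided by enumeration.
  indicator-shift : ∀ (s : Fin 8) k → indicator ((toℕ s ℕ.+ k) mod 8) ≈A δ s *A indicator (k mod 8)
  indicator-shift s k r = ≡.trans
    (≡.cong (λ t → indicator t r) (mod-+ (toℕ s) k))
    (≡.trans (≡.cong (λ b → ⟦ if b then + 1 else + 0 ⟧) (decided s (k mod 8) r)) (≡.sym (δ-*A s (indicator (k mod 8)) r)))
    where
    decided : ∀ s t r → does (r Fin.≟ ((toℕ s ℕ.+ toℕ t) mod 8)) ≡ does ((r ⊖ s) Fin.≟ t)
    decided = from-yes (all? λ s → all? λ t → all? λ r → does (r Fin.≟ ((toℕ s ℕ.+ toℕ t) mod 8)) ≟B does ((r ⊖ s) Fin.≟ t))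

  indicator-0 : indicator zero ≈A δ zero
  indicator-0 = from-yes (all? λ r → indicator zero r ℚP.≟ δ zero r)

  module Factor (i : ℕ) where
    e : ℕ
    e = suc i

    cast-if : ∀ b u v r → cast (if b then u else v) r ≡ (if b then cast u else cast v) r
    cast-if true  u v r = ≡.refl
    cast-if false u v r = ≡.refl

    module Z  = Dilation zG (λ k → indicator (k mod 8)) indicator-0 (λ k → indicator-shift (# 1) k)
                  e (image (GR.geomZ e)) (λ n → cast-if (does (e ∣? n)) (GR.zpow (n / e)) GR.0G)
    -- The inverse power of z is encoded as z^(7k), so passing from k to k + 1 adds 7 to the
    -- exponent, which is multiplication by z⁻¹.
    module Z⁻ = Dilation zG⁻¹ (λ k → indicator ((k ℕ.* 7) mod 8)) indicator-0 (λ k → indicator-shift (# 7) (k ℕ.* 7))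
                  e (image (GR.geomZ⁻ e)) (λ n → cast-if (does (e ∣? n)) (GR.zpow⁻ (n / e)) GR.0G)

  factor : ℕ → Series
  factor i = image ((GR.oneMinusQ i GR.⊛ GR.geomZ i) GR.⊛ GR.geomZ⁻ i)

  factor≃ : ∀ i → factor (suc i) ≃ (lin KA.1# (suc i) * image (GR.geomZ (suc i))) * image (GR.geomZ⁻ (suc i))
  factor≃ i = trans (image-⊛ (GR.oneMinusQ (suc i) GR.⊛ GR.geomZ (suc i)) (GR.geomZ⁻ (suc i)))
    (*-congʳ (trans (image-⊛ (GR.oneMinusQ (suc i)) (GR.geomZ (suc i))) (*-congʳ (image-oneMinusQ i))))

  factor-conv : Convergent factor
  factor-conv i = ≈[]-trans (≃⇒≈[] (factor≃ i))
    (≈[]-trans (*-cong-≈[] (*-cong-≈[] (lin-conv KA.1# (λ i → i) (λ i → ℕP.≤-refl) i) (Factor.Z.dilation-order i)) (Factor.Z⁻.dilation-order i))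
    (≃⇒≈[] (trans (*-identityʳ _) (*-identityˡ 1#))))

  open AG.Crank splitting using (E; h; pair-conv)

  -- In each crank factor the two geometric series are inverse to the linear factors of `E`, so only
  -- the numerators remain. This is the division-free form that `crank-splitting` asks for.
  crank-E : crank * E ≃ h
  crank-E = trans (*-cong (image-∏∞ (λ i → (GR.oneMinusQ i GR.⊛ GR.geomZ i) GR.⊛ GR.geomZ⁻ i))
      (sym (∏∞-* (η-conv 1 zG) (η-conv 1 zG⁻¹))))
    (trans (sym (∏∞-* factor-conv (pair-conv zG zG⁻¹)))
    (∏∞-cong λ i → trans (*-cong (factor≃ i) (*-cong (lin-≡ zG (ℕP.*-identityˡ (suc i))) (lin-≡ zG⁻¹ (ℕP.*-identityˡ (suc i)))))
      (trans (rearrange _ _ _ _ _)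
      (trans (*-cong (*-congˡ (Factor.Z.dilation-inverse i)) (Factor.Z⁻.dilation-inverse i))
      (trans (*-identityʳ _) (trans (*-identityʳ _) (sym (lin-≡ KA.1# (ℕP.*-identityˡ (suc i))))))))))
    where
    rearrange : ∀ l g g′ z z′ → ((l * g) * g′) * (z * z′) ≃ (l * (g * z)) * (g′ * z′)
    rearrange l g g′ z z′ = trans (*-assoc _ _ _) (trans (*-congˡ swap)
      (trans (sym (*-assoc _ _ _)) (*-congʳ (*-assoc l g z))))
      where
      swap : g′ * (z * z′) ≃ z * (g′ * z′)
      swap = trans (sym (*-assoc _ _ _)) (trans (*-congʳ (*-comm g′ z)) (*-assoc _ _ _))

-- Comparison of the coefficients of z^r

module CrankDissection where

  open import Data.Fin as Fin using (Fin; zero; suc)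
  open import Data.Fin.Properties using (all?)
  open import Data.Nat.DivMod using (_mod_)
  open import Data.Rational.Unnormalised using (mkℚᵘ; *≡*)
  import Data.Rational.Unnormalised.Properties as ℚᵘP
  open Defs using (⟦_⟧)

  open CyclicSplitting
  open CrankSplitting ℚ-ring hiding (Splitting; 2K; 8K; thetaWeight; _^K_)
  open GeometricSeries ℚ-ring
  open BilateralTheta
  open IntegerSolver seriesRing using (solve; _:=_; _:+_; _:*_; _:-_; :-_; con)
  private
    module KA = CommutativeRing groupAlgebra
    module Sℚ = IntegerSolver ℚ-ring
    module GG = GeometricSeries groupAlgebra

  open RingImage ℚ-ring groupAlgebra scalar
    (λ p r → ≡.cong (ℚ._* δ zero r) p)
    (λ a b r → ℚP.*-distribʳ-+ (δ zero r) a b)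
    (λ a b r → ≡.trans (ℚP.*-assoc a b (δ zero r)) (≡.sym (scalar-*A a (scalar b) r)))
    (λ a r → ≡.sym (ℚP.neg-distribˡ-* a (δ zero r)))
    (λ r → ℚP.*-zeroˡ (δ zero r))
    (λ r → ℚP.*-identityˡ (δ zero r))

  module Parts = Partitions ℚ-ring (λ n → ⟦ + n ⟧) (λ m n → CrankSeries.⟦⟧-+ (+ m) (+ n)) ≡.refl ≡.refl

  P I : Series
  P = Parts.partitions
  I = Defs.invJ4

  I-η : I * η 4 1ℚ ≃ 1#
  I-η = trans (*-congʳ (image-∏∞ (λ i n → if does ((4 ℕ.* i) ∣? n) then 1ℚ else 0ℚ)))
    (∏∞-inverse (λ i → ≈[]-mono (ℕP.m≤n*m (suc i) 4) (D.dilation-order i)) (η-conv 4 1ℚ) D.dilation-inverse)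
    where
    open import Data.Nat.Divisibility using (_∣?_)
    -- For the identity map, `image-∏∞` just identifies the product that defines `invJ4` with the
    -- one of the series ring.
    open SeriesImage ℚ._+_ ℚ._*_ 0ℚ 1ℚ ℚ-ring (λ a → a) (λ _ _ → ≡.refl) (λ _ _ → ≡.refl) ≡.refl ≡.refl
      using (image-∏∞)
    module D (i : ℕ) = Dilation 1ℚ (λ _ → 1ℚ) ≡.refl (λ _ → ≡.refl) (4 ℕ.* suc i)
      (λ n → if does ((4 ℕ.* suc i) ∣? n) then 1ℚ else 0ℚ) (λ _ → ≡.refl)

  T : ℕ → Series
  T s = U s + U (7 ℕ.∸ s)

  sA sB : Series
  sA = squares-even + squares-even⁺
  sB = squares-odd + squares-odd

  A₁ A₂ B₁ B₂ : Series
  A₁ = I * (φ 1 * ψ⁻)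
  A₂ = I * (φ 1 * ψ⁺)
  B₁ = I * (φ 4 * X)
  B₂ = I * (φ 4 * Y)

  tG : Element
  tG = zG KA.+ zG⁻¹

  -- The coefficients of `image G` are scalars, so the coordinate at `r` sees only `u r`. This is
  -- the passage from series over the group algebra back to rational series.
  extract : ∀ u G n r → (AG.C u AG.* image G) n r ≡ u r ℚ.* G n
  extract u G n r = ≡.trans (GG.C-*-at u (image G) n r)
    (≡.trans (*A-comm u (scalar (G n)) r) (≡.trans (scalar-*A (G n) u r) (ℚP.*-comm (G n) (u r))))

  -- X + tY is taken apart because `extract` needs every summand to be a constant of the group
  -- algebra times a rational series; the t is moved to e₃.
  image-splitting : AG.C AG.8K AG.* CrankSeries.crank AG.≃
    (AG.C NG AG.* image P AG.+ AG.C e₁G AG.* image A₁) AG.+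
    (AG.C e₂G AG.* image A₂ AG.+ (AG.C e₃G AG.* image B₁ AG.+ AG.C (e₃G KA.* tG) AG.* image B₂))
  image-splitting = AG.trans
    (AG.Crank.crank-splitting splitting CrankSeries.crank-E
      (AG.trans (AG.*-congˡ (AG.sym (image-η 1)))
        (AG.trans (AG.sym (image-* P (η 1 1ℚ))) (AG.trans (image-cong Parts.partitions-inverse) image-1)))
      (AG.trans (AG.*-congˡ (AG.sym (image-η 4)))
        (AG.trans (AG.sym (image-* I (η 4 1ℚ))) (AG.trans (image-cong I-η) image-1))))
    (AG.+-cong (AG.+-congˡ (AG.*-congˡ (AG.sym (factors 1 image-ψ⁻))))
      (AG.+-cong (AG.*-congˡ (AG.sym (factors 1 image-ψ⁺)))
        (AG.trans (split (AG.C e₃G) (image I) (AG.φ 4) AG.X (AG.C tG) AG.Y)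
          (AG.+-cong (AG.*-congˡ (AG.sym (factors 4 image-X)))
            (AG.*-cong (AG.sym (AG.C-* e₃G tG)) (AG.sym (factors 4 image-Y)))))))
    where
    factors : ∀ d {f f′} → image f AG.≃ f′ → image (I * (φ d * f)) AG.≃ image I AG.* (AG.φ d AG.* f′)
    factors d {f} p = AG.trans (image-* I (φ d * f))
      (AG.*-congˡ (AG.trans (image-* (φ d) f) (AG.*-cong (image-φ d) p)))
    split : ∀ e i f x t y → e AG.* (i AG.* (f AG.* (x AG.+ t AG.* y))) AG.≃
            e AG.* (i AG.* (f AG.* x)) AG.+ (e AG.* t) AG.* (i AG.* (f AG.* y))
    split e i f x t y = S.solve 6 (λ e i f x t y → e S.:* (i S.:* (f S.:* (x S.:+ t S.:* y)))
      S.:= e S.:* (i S.:* (f S.:* x)) S.:+ (e S.:* t) S.:* (i S.:* (f S.:* y))) AG.refl e i f x t y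
      where module S = IntegerSolver AG.seriesRing

  8ℚ 4ℚ : ℚ
  8ℚ = ⟦ + 8 ⟧
  4ℚ = ⟦ + 4 ⟧

  coefficient-identity : ∀ n r → 8ℚ ℚ.* ⟦ CrankSeries.GR.crankGF n r ⟧ ≡
    (P n ℚ.+ (e₁G r ℚ.* A₁ n)) ℚ.+ ((e₂G r ℚ.* A₂ n) ℚ.+ ((e₃G r ℚ.* B₁ n) ℚ.+ ((e₃G KA.* tG) r ℚ.* B₂ n)))
  coefficient-identity n r = ≡.trans (≡.sym lhs) (≡.trans (AG.at image-splitting n r)
    (≡.trans (at+ _ _) (≡.cong₂ ℚ._+_
      (≡.trans (at+ _ _) (≡.cong₂ ℚ._+_ (≡.trans (extract NG P n r) (ℚP.*-identityˡ (P n))) (extract e₁G A₁ n r)))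
      (≡.trans (at+ _ _) (≡.cong₂ ℚ._+_ (extract e₂G A₂ n r)
        (≡.trans (at+ _ _) (≡.cong₂ ℚ._+_ (extract e₃G B₁ n r) (extract (e₃G KA.* tG) B₂ n r))))))))
    where
    at+ : ∀ f g → (f AG.+ g) n r ≡ f n r ℚ.+ g n r
    at+ f g = GG.+-at f g n r
    lhs : (AG.C AG.8K AG.* CrankSeries.crank) n r ≡ 8ℚ ℚ.* ⟦ CrankSeries.GR.crankGF n r ⟧
    lhs = ≡.trans (GG.C-*-at AG.8K CrankSeries.crank n r)
      (≡.trans (*A-cong {AG.8K} {scalar 8ℚ} {CrankSeries.crank n} eight (λ _ → ≡.refl) r) (scalar-*A 8ℚ (CrankSeries.crank n) r))
      where
      eight : AG.8K ≈A scalar 8ℚ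
      eight = from-yes (all? λ r → AG.8K r ℚP.≟ scalar 8ℚ r)

  ⊕≃ : ∀ {f g f′ g′} → f ≃ f′ → g ≃ g′ → (f Defs.⊕ g) ≃ f′ + g′
  ⊕≃ p p′ = trans (coeffwise λ n → ≡.sym (✚-at _ _ n)) (+-cong p p′)

  ⊛≃ : ∀ {f g f′ g′} → f ≃ f′ → g ≃ g′ → (f Defs.⊛ g) ≃ f′ * g′
  ⊛≃ p p′ = trans (coeffwise λ n → ≡.sym (✶-at _ _ n)) (*-cong p p′)

  ·≃ : ∀ a {f f′} → f ≃ f′ → (a Defs.· f) ≃ C a * f′
  ·≃ a {f} p = trans (coeffwise λ n → ≡.sym (C-*-at a f n)) (*-congˡ p)

  qpow-⊛ : ∀ i f j g {f′ g′} → Defs.qpow i f ≃ f′ → Defs.qpow j g ≃ g′ → Defs.qpow (i ℕ.+ j) (f Defs.⊛ g) ≃ f′ * g′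
  qpow-⊛ i f j g p p′ = trans (qpow≃ (i ℕ.+ j) (f Defs.⊛ g))
    (trans (*-cong (^-homo-* q i j) (⊛≃ refl refl))
    (trans (solve 4 (λ a b f g → (a :* b) :* (f :* g) := (a :* f) :* (b :* g)) refl (q ^ i) (q ^ j) f g)
    (*-cong (trans (sym (qpow≃ i f)) p) (trans (sym (qpow≃ j g)) p′))))

  Jbar-28-64 : Defs.Jbar 28 64 ≃ T 0
  Jbar-28-64 = trans (sym (trans (qpow≃ 0 (Defs.Jbar 28 64)) (*-identityˡ _))) qpow-Jbar-28-64

  C-⟦-⟧ : ∀ i → C ⟦ ℤ.- i ⟧ ≃ - C ⟦ i ⟧
  C-⟦-⟧ i = trans (C-cong (≡.trans (≡.cong ⟦_⟧ (≡.sym (ℤP.-1*i≡-i i))) (≡.trans (CrankSeries.⟦⟧-* -[1+ 0 ] i)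
      (≡.trans (≡.sym (ℚP.neg-distribˡ-* 1ℚ ⟦ i ⟧)) (≡.cong ℚ.-_ (ℚP.*-identityˡ ⟦ i ⟧)))))) (C-neg ⟦ i ⟧)

  -- Every instance has coefficients of the pattern (α, β, -β, -α, β, α, -β, -α), for which the
  -- eight products in `ϑ₈` factor; sA - sB is φ(-q).
  G : ℤ → ℤ → Series
  G α β = I * ((sA - sB) * (C ⟦ α ⟧ * (T 0 + T 3) - C ⟦ β ⟧ * (T 1 + T 2)))

  H : ℤ → ℤ → Series
  H γ δ = I * (φ 4 * (C ⟦ γ ⟧ * (T 0 - T 3) + C ⟦ δ ⟧ * (T 1 - T 2)))

  ϑ₈≃ : ∀ α β → Defs.ϑ₈ α β (ℤ.- β) (ℤ.- α) β α (ℤ.- β) (ℤ.- α) ≃ C (+ 1 ℚ./ 8) * G α β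
  ϑ₈≃ α β = ·≃ (+ 1 ℚ./ 8) (⊛≃ refl (trans
    (⊕≃ (⊕≃ (⊕≃ (⊕≃ (⊕≃ (⊕≃ (⊕≃
      (·≃ ⟦ α ⟧ (⊛≃ Jbar-4-8 Jbar-28-64))
      -- Each power of q is shared between the two factors: `Jbar 0 8` takes exponent 1, `Jbar 4 8`
      -- takes 0, and the series of modulus 64 take 0, 1, 3 or 6.
      (·≃ ⟦ β ⟧ (qpow-⊛ 1 (Defs.Jbar 0 8) 3 (Defs.Jbar 52 64) qpow-Jbar-0-8 qpow-Jbar-52-64)))
      (neg· β (qpow-⊛ 0 (Defs.Jbar 4 8) 1 (Defs.Jbar 20 64) q0-Jbar-4-8 qpow-Jbar-20-64)))
      (neg· α (qpow-⊛ 1 (Defs.Jbar 0 8) 0 (Defs.Jbar 28 64) qpow-Jbar-0-8 qpow-Jbar-28-64)))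
      (·≃ ⟦ β ⟧ (qpow-⊛ 1 (Defs.Jbar 0 8) 1 (Defs.Jbar 20 64) qpow-Jbar-0-8 qpow-Jbar-20-64)))
      (·≃ ⟦ α ⟧ (qpow-⊛ 0 (Defs.Jbar 4 8) 6 (Defs.Jbar 60 64) q0-Jbar-4-8 qpow-Jbar-60-64)))
      (neg· β (qpow-⊛ 0 (Defs.Jbar 4 8) 3 (Defs.Jbar 52 64) q0-Jbar-4-8 qpow-Jbar-52-64)))
      (neg· α (qpow-⊛ 1 (Defs.Jbar 0 8) 6 (Defs.Jbar 60 64) qpow-Jbar-0-8 qpow-Jbar-60-64)))
    (solve 8 (λ a b x y t0 t1 t2 t3 →
        a :* (x :* t0) :+ b :* (y :* t2) :+ (:- b) :* (x :* t1) :+ (:- a) :* (y :* t0)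
          :+ b :* (y :* t1) :+ a :* (x :* t3) :+ (:- b) :* (x :* t2) :+ (:- a) :* (y :* t3)
        := (x :- y) :* (a :* (t0 :+ t3) :- b :* (t1 :+ t2))) refl
      (C ⟦ α ⟧) (C ⟦ β ⟧) sA sB (T 0) (T 1) (T 2) (T 3))))
    where
    q0-Jbar-4-8 : Defs.qpow 0 (Defs.Jbar 4 8) ≃ sA
    q0-Jbar-4-8 = trans (qpow≃ 0 (Defs.Jbar 4 8)) (trans (*-identityˡ _) Jbar-4-8)
    neg· : ∀ i {f f′} → f ≃ f′ → (⟦ ℤ.- i ⟧ Defs.· f) ≃ (- C ⟦ i ⟧) * f′
    neg· i p = trans (·≃ ⟦ ℤ.- i ⟧ p) (*-congʳ (C-⟦-⟧ i))

  ϑ₈′≃ : ∀ γ δ → Defs.ϑ₈′ γ δ (ℤ.- γ) (ℤ.- δ) ≃ C (+ 1 ℚ./ 2) * H γ δ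
  ϑ₈′≃ γ δ = ·≃ (+ 1 ℚ./ 2) (⊛≃ refl (trans
    (⊕≃ (⊕≃ (⊕≃
      (·≃ ⟦ γ ⟧ (⊛≃ J-4-8 Jbar-28-64))
      (·≃ ⟦ δ ⟧ (qpow-⊛ 0 (Defs.J 4 8) 1 (Defs.Jbar 20 64) q0-J-4-8 qpow-Jbar-20-64)))
      (neg· γ (qpow-⊛ 0 (Defs.J 4 8) 6 (Defs.Jbar 60 64) q0-J-4-8 qpow-Jbar-60-64)))
      (neg· δ (qpow-⊛ 0 (Defs.J 4 8) 3 (Defs.Jbar 52 64) q0-J-4-8 qpow-Jbar-52-64)))
    (solve 7 (λ c d f t0 t1 t2 t3 →
        c :* (f :* t0) :+ d :* (f :* t1) :+ (:- c) :* (f :* t3) :+ (:- d) :* (f :* t2)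
        := f :* (c :* (t0 :- t3) :+ d :* (t1 :- t2))) refl
      (C ⟦ γ ⟧) (C ⟦ δ ⟧) (φ 4) (T 0) (T 1) (T 2) (T 3))))
    where
    q0-J-4-8 : Defs.qpow 0 (Defs.J 4 8) ≃ φ 4
    q0-J-4-8 = trans (qpow≃ 0 (Defs.J 4 8)) (trans (*-identityˡ _) J-4-8)
    neg· : ∀ i {f f′} → f ≃ f′ → (⟦ ℤ.- i ⟧ Defs.· f) ≃ (- C ⟦ i ⟧) * f′
    neg· i p = trans (·≃ ⟦ ℤ.- i ⟧ p) (*-congʳ (C-⟦-⟧ i))

  -- `ψ⁻` and `ψ⁺` agree on `T 0` and `T 3` and have opposite signs on `T 1` and `T 2`; hence the
  -- sum and the difference of the coordinates of e₁ and e₂.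
  A-part : ∀ {α β} a b → a ℚ.+ b ≡ ⟦ α ⟧ → a ℚ.- b ≡ ⟦ β ⟧ → C a * A₁ + C b * A₂ ≃ G α β
  A-part {α} {β} a b p p′ = trans
    (+-cong (*-congˡ (*-congˡ (*-congʳ φ-dissection))) (*-congˡ (*-congˡ (*-congʳ φ-dissection))))
    (trans (solve 9 (λ a b i x y t0 t1 t2 t3 →
        a :* (i :* ((x :- y) :* (t0 :- t1 :- t2 :+ t3))) :+ b :* (i :* ((x :- y) :* (t0 :+ t1 :+ t2 :+ t3)))
        := i :* ((x :- y) :* ((a :+ b) :* (t0 :+ t3) :- (a :- b) :* (t1 :+ t2)))) refl
        (C a) (C b) I sA sB (T 0) (T 1) (T 2) (T 3))
    (*-congˡ (*-congˡ (+-cong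
      (*-congʳ (trans (sym (C-+ a b)) (C-cong p)))
      (-‿cong (*-congʳ (trans (+-congˡ (sym (C-neg b))) (trans (sym (C-+ a (ℚ.- b))) (C-cong p′)))))))))

  -- In aX + bY the difference `T 1 - T 2` has coefficient b - a. The 4 is common to all coordinates
  -- of e₃ and e₃(z + z⁻¹); it turns 1/8 into the 1/2 of `ϑ₈′`.
  B-part : ∀ {γ δ} a b → a ≡ 4ℚ ℚ.* ⟦ γ ⟧ → b ℚ.- a ≡ 4ℚ ℚ.* ⟦ δ ⟧ → C a * B₁ + C b * B₂ ≃ C 4ℚ * H γ δ
  B-part {γ} {δ} a b p p′ = trans
    (solve 8 (λ a b i f t0 t1 t2 t3 →
        a :* (i :* (f :* (t0 :- t1 :+ t2 :- t3))) :+ b :* (i :* (f :* (t1 :- t2)))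
        := i :* (f :* (a :* (t0 :- t3) :+ (b :- a) :* (t1 :- t2)))) refl
        (C a) (C b) I (φ 4) (T 0) (T 1) (T 2) (T 3))
    (trans (*-congˡ (*-congˡ (+-cong
      (*-congʳ (trans (C-cong p) (C-* 4ℚ ⟦ γ ⟧)))
      (*-congʳ (trans (+-congˡ (sym (C-neg a))) (trans (sym (C-+ b (ℚ.- a))) (trans (C-cong p′) (C-* 4ℚ ⟦ δ ⟧))))))))
    (solve 7 (λ k c d i f u v → i :* (f :* ((k :* c) :* u :+ (k :* d) :* v)) := k :* (i :* (f :* (c :* u :+ d :* v)))) refl
      (C 4ℚ) (C ⟦ γ ⟧) (C ⟦ δ ⟧) I (φ 4) (T 0 - T 3) (T 1 - T 2)))

  /8≡ : ∀ m → (+ m) ℚ./ 8 ≡ ⟦ + m ⟧ ℚ.* (+ 1 ℚ./ 8)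
  /8≡ m = ℚP.toℚᵘ-injective (ℚᵘP.≃-trans (ℚP.toℚᵘ-fromℚᵘ (mkℚᵘ (+ m) 7))
    (ℚᵘP.≃-trans (*≡* (≡.cong (ℤ._* + 8) (≡.sym (ℤP.*-identityʳ (+ m)))))
    (ℚᵘP.≃-trans (ℚᵘP.*-cong (ℚᵘP.≃-sym (CrankSeries.toℚᵘ-⟦⟧ (+ m))) (ℚᵘP.≃-refl {mkℚᵘ (+ 1) 7}))
    (ℚᵘP.≃-sym (ℚP.toℚᵘ-homo-* ⟦ + m ⟧ (+ 1 ℚ./ 8))))))

  -- One eighth of the N-part is p(n)/8 and cancels the subtracted term. The hypotheses are
  -- numerical conditions on the coordinates at `r`, settled by computation for each residue.
  dissection : ∀ a α β γ δ → let r = a mod 8 in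
    e₁G r ℚ.+ e₂G r ≡ ⟦ α ⟧ → e₁G r ℚ.- e₂G r ≡ ⟦ β ⟧ →
    e₃G r ≡ 4ℚ ℚ.* ⟦ γ ⟧ → (e₃G KA.* tG) r ℚ.- e₃G r ≡ 4ℚ ℚ.* ⟦ δ ⟧ →
    Defs.D-C a 8 Defs.≋ (Defs.ϑ₈ α β (ℤ.- β) (ℤ.- α) β α (ℤ.- β) (ℤ.- α) Defs.⊕ Defs.ϑ₈′ γ δ (ℤ.- γ) (ℤ.- δ))
  dissection a α β γ δ pα pβ pγ pδ n = ≡.trans (≡.cong (λ x → F ℚ.- x) (/8≡ (Defs.p n)))
    (≡.trans (≡.cong (λ x → x ℚ.- P n ℚ.* k) (≡.trans (≡.sym (ℚP.*-identityˡ F)) (≡.trans (ℚP.*-assoc k 8ℚ F) (≡.cong (k ℚ.*_) eight-F))))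
    (≡.trans (Sℚ.solve 5 (λ k P G H f → k Sℚ.:* ((P Sℚ.:+ G) Sℚ.:+ f Sℚ.:* H) Sℚ.:- P Sℚ.:* k
                  Sℚ.:= k Sℚ.:* G Sℚ.:+ (k Sℚ.:* f) Sℚ.:* H) ≡.refl k (P n) (G α β n) (H γ δ n) 4ℚ)
    (≡.sym (≡.cong₂ ℚ._+_
      (≡.trans (at (ϑ₈≃ α β) n) (C-*-at k (G α β) n))
      (≡.trans (at (ϑ₈′≃ γ δ) n) (C-*-at (+ 1 ℚ./ 2) (H γ δ) n))))))
    where
    r : Fin 8
    r = a mod 8
    F k : ℚ
    F = ⟦ CrankSeries.GR.crankGF n r ⟧
    k = + 1 ℚ./ 8
    sum-at : ∀ x y f g → (C x * f + C y * g) n ≡ (x ℚ.* f n) ℚ.+ (y ℚ.* g n)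
    sum-at x y f g = ≡.trans (+-at (C x * f) (C y * g) n) (≡.cong₂ ℚ._+_ (C-*-at x f n) (C-*-at y g n))
    eight-F : 8ℚ ℚ.* F ≡ (P n ℚ.+ G α β n) ℚ.+ 4ℚ ℚ.* H γ δ n
    eight-F = ≡.trans (coefficient-identity n r)
      (≡.trans (Sℚ.solve 4 (λ p x y z → (p Sℚ.:+ x) Sℚ.:+ (y Sℚ.:+ z) Sℚ.:= (p Sℚ.:+ (x Sℚ.:+ y)) Sℚ.:+ z) ≡.refl
                  (P n) (e₁G r ℚ.* A₁ n) (e₂G r ℚ.* A₂ n) ((e₃G r ℚ.* B₁ n) ℚ.+ ((e₃G KA.* tG) r ℚ.* B₂ n)))
      (≡.cong₂ (λ x y → (P n ℚ.+ x) ℚ.+ y)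
        (≡.trans (≡.sym (sum-at (e₁G r) (e₂G r) A₁ A₂)) (at (A-part {α} {β} (e₁G r) (e₂G r) pα pβ) n))
        (≡.trans (≡.sym (sum-at (e₃G r) ((e₃G KA.* tG) r) B₁ B₂))
          (≡.trans (at (B-part {γ} {δ} (e₃G r) ((e₃G KA.* tG) r) pγ pδ) n) (C-*-at 4ℚ (H γ δ) n)))))

  ϑ₈′-zero : ∀ n → Defs.ϑ₈′ (+ 0) (+ 0) (+ 0) (+ 0) n ≡ 0ℚ
  ϑ₈′-zero = at (trans (ϑ₈′≃ (+ 0) (+ 0)) (trans
    (*-congˡ (*-congˡ (*-congˡ (+-cong (*-congʳ C-0) (*-congʳ C-0)))))
    (solve 5 (λ k i f u v → k :* (i :* (f :* (con (+ 0) :* u :+ con (+ 0) :* v))) := con (+ 0)) refl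
      (C (+ 1 ℚ./ 2)) I (φ 4) (T 0 - T 3) (T 1 - T 2))))

  -- e₃ is supported on the residues 0 and 4, and e₃(z + z⁻¹) on the odd ones, so at 2 and 6 nothing
  -- of `ϑ₈′` remains.
  dissection₀ : ∀ a α β → let r = a mod 8 in
    e₁G r ℚ.+ e₂G r ≡ ⟦ α ⟧ → e₁G r ℚ.- e₂G r ≡ ⟦ β ⟧ → e₃G r ≡ 0ℚ → (e₃G KA.* tG) r ≡ 0ℚ →
    Defs.D-C a 8 Defs.≋ Defs.ϑ₈ α β (ℤ.- β) (ℤ.- α) β α (ℤ.- β) (ℤ.- α)
  dissection₀ a α β pα pβ p₃ p₄ n = ≡.trans
    (dissection a α β (+ 0) (+ 0) pα pβ p₃ (≡.cong₂ ℚ._-_ p₄ p₃) n)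
    (≡.trans (≡.cong (Defs.ϑ₈ α β (ℤ.- β) (ℤ.- α) β α (ℤ.- β) (ℤ.- α) n ℚ.+_) (ϑ₈′-zero n)) (ℚP.+-identityʳ _))

open import Defs
open import Data.Product using (_×_)

theorem8p1 : (D-C 0 8 ≋ (ϑ₈ (+ 3) -[1+ 0 ] (+ 1) -[1+ 2 ] -[1+ 0 ] (+ 3) (+ 1) -[1+ 2 ] ⊕ ϑ₈′ (+ 1) -[1+ 0 ] -[1+ 0 ] (+ 1)))
    × (D-C 1 8 ≋ (ϑ₈ -[1+ 0 ] -[1+ 0 ] (+ 1) (+ 1) -[1+ 0 ] -[1+ 0 ] (+ 1) (+ 1) ⊕ ϑ₈′ (+ 0) (+ 1) (+ 0) -[1+ 0 ]))
    × (D-C 7 8 ≋ (ϑ₈ -[1+ 0 ] -[1+ 0 ] (+ 1) (+ 1) -[1+ 0 ] -[1+ 0 ] (+ 1) (+ 1) ⊕ ϑ₈′ (+ 0) (+ 1) (+ 0) -[1+ 0 ]))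
    × (D-C 2 8 ≋ ϑ₈ -[1+ 0 ] (+ 3) -[1+ 2 ] (+ 1) (+ 3) -[1+ 0 ] -[1+ 2 ] (+ 1))
    × (D-C 6 8 ≋ ϑ₈ -[1+ 0 ] (+ 3) -[1+ 2 ] (+ 1) (+ 3) -[1+ 0 ] -[1+ 2 ] (+ 1))
    × (D-C 3 8 ≋ (ϑ₈ -[1+ 0 ] -[1+ 0 ] (+ 1) (+ 1) -[1+ 0 ] -[1+ 0 ] (+ 1) (+ 1) ⊕ ϑ₈′ (+ 0) -[1+ 0 ] (+ 0) (+ 1)))
    × (D-C 5 8 ≋ (ϑ₈ -[1+ 0 ] -[1+ 0 ] (+ 1) (+ 1) -[1+ 0 ] -[1+ 0 ] (+ 1) (+ 1) ⊕ ϑ₈′ (+ 0) -[1+ 0 ] (+ 0) (+ 1)))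
    × (D-C 4 8 ≋ (ϑ₈ (+ 3) -[1+ 0 ] (+ 1) -[1+ 2 ] -[1+ 0 ] (+ 3) (+ 1) -[1+ 2 ] ⊕ ϑ₈′ -[1+ 0 ] (+ 1) (+ 1) -[1+ 0 ]))
theorem8p1 =
    -- At residue 0 the coordinates of e₁, e₂, e₃, e₃(z + z⁻¹) are 1, 2, 4, 0, whence α = 1 + 2, β =
    -- 1 - 2, γ = 4/4 and δ = (0 - 4)/4; the other residues are read off in the same way.
    dissection 0 (+ 3) -[1+ 0 ] (+ 1) -[1+ 0 ] ≡.refl ≡.refl ≡.refl ≡.refl
  , dissection 1 -[1+ 0 ] -[1+ 0 ] (+ 0) (+ 1) ≡.refl ≡.refl ≡.refl ≡.refl
  , dissection 7 -[1+ 0 ] -[1+ 0 ] (+ 0) (+ 1) ≡.refl ≡.refl ≡.refl ≡.refl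
  , dissection₀ 2 -[1+ 0 ] (+ 3) ≡.refl ≡.refl ≡.refl ≡.refl
  , dissection₀ 6 -[1+ 0 ] (+ 3) ≡.refl ≡.refl ≡.refl ≡.refl
  , dissection 3 -[1+ 0 ] -[1+ 0 ] (+ 0) -[1+ 0 ] ≡.refl ≡.refl ≡.refl ≡.refl
  , dissection 5 -[1+ 0 ] -[1+ 0 ] (+ 0) -[1+ 0 ] ≡.refl ≡.refl ≡.refl ≡.refl
  , dissection 4 (+ 3) -[1+ 0 ] -[1+ 0 ] (+ 1) ≡.refl ≡.refl ≡.refl ≡.refl
  where open CrankDissection using (dissection; dissection₀)
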